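{- Let $q$ be an odd prime power, $\mathbb F_q$ the finite field of order $q$, $d$ a positive integer, and $A\subset \mathbb F_q^d$. Let $\mathcal{SQ}(A)$ be the number of pairs $(x,y)\in A\times A$ such that $\eta(\|x-y\|)=1$. \begin{enumerate} \item If $d\equiv 2\pmod 4$ and $q\equiv 3\pmod 4$, then $$\mathcal{SQ}(A)\le \frac{|A|^2}{2} + \frac{q^{\frac{d}{2}} |A|}{2} -\frac{|A|^2}{2q}- \frac{q^{\frac{d-2}{2}}|A|}{2}.$$ \item Let $d\equiv 0\pmod 4$, or $d\equiv 2\pmod 4$ and $q\equiv 1\pmod 4$. If $|A|\ge (q^{d/2}+q)/(1+q^{ -(d-2)/2})$, then $$\mathcal{SQ}(A)\le \frac{|A|^2}{2} + \frac{q^{\frac{d}{2}} |A|}{2}-\frac{|A|^2}{q^{\frac{d}{2}}} -\frac{|A|^2}{2q}+ \frac{q^{\frac{d-2}{2}}|A|}{2}.$$ If $|A|\le (q^{d/2}+q)/(1+q^{ -(d-2)/2})$, then $$\mathcal{SQ}(A) \le \frac{|A|^2}{2} + \frac{q^{\frac{d}{2}} |A|}{2} - \frac{|A|^2}{2 q^{\frac{d}{2}}} -\frac{|A|}{2}.$$ \end{enumerate}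
   Context: For $x,y\in\mathbb F_q^d$, $\|x-y\|:=(x_1-y_1)^2+\cdots+(x_d-y_d)^2\in\mathbb F_q$. $\eta$ denotes the quadratic character of $\mathbb F_q$ (so $\eta(a)=1$ if $a$ is a nonzero square, $\eta(a)=-1$ if $a$ is a non-square) with the convention $\eta(0)=0$. -}

module Defs where

open import Algebra.Apartness.Bundles using (HeytingCommutativeRing; HeytingField)
open import Algebra.Bundles using (CommutativeRing)
open import Data.Bool.Base using (if_then_else_)
open import Data.Fin.Base using (Fin)
import Data.Fin.Properties as Fin
open import Data.Integer.Base as ℤ using (ℤ; 0ℤ; 1ℤ; -1ℤ)
import Data.Integer.Properties as ℤ
open import Data.List.Base using (List; length; filter; cartesianProduct)
open import Data.Nat.Base as ℕ using (ℕ; NonZero)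
open import Data.Nat.DivMod using (_%_)
import Data.Nat.Properties as ℕ
open import Data.Nat.Primality using (Prime)
open import Data.Product.Base using (∃; ∃₂; _×_; _,_)
open import Data.Rational.Base as ℚ using (ℚ; 1ℚ)
import Data.Rational.Properties as ℚ
open import Data.Vec.Functional using (Vector)
import Data.Vec.Functional.Relation.Binary.Equality.Setoid as Vector≋
import Data.List.Relation.Unary.Unique.Setoid as UniqueSetoid
open import Function.Bundles using (Inverse)
open import Function.Properties.Inverse using (Inverse⇒Injection)
open import Level using (Level; _⊔_; suc)
open import Relation.Binary.Definitions using (Decidable)
open import Relation.Binary.PropositionalEquality as ≡ using (_≡_)
open import Relation.Nullary.Decidable using (Dec; does; map′; via-injection)
import Algebra.Properties.Semiring.Sum as SemiringSum

OddPrimePower : ℕ → Set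
OddPrimePower q = q % 2 ≡ 1 × ∃₂ λ p k → Prime p × 1 ℕ.≤ k × q ≡ p ℕ.^ k

-- The apartness of a Heyting field is x # y ⇔ x - y invertible.  The
-- enumeration makes _≈_ decidable, and apartness then coincides with _≉_, so
-- these are exactly the classical fields of order q.
record FiniteField (c ℓ₁ ℓ₂ : Level) (q : ℕ) : Set (suc (c ⊔ ℓ₁ ⊔ ℓ₂)) where
  field
    heytingField : HeytingField c ℓ₁ ℓ₂

  open HeytingField heytingField public

  commutativeRing : CommutativeRing c ℓ₁
  commutativeRing = HeytingCommutativeRing.commutativeRing heytingCommutativeRing

  open CommutativeRing commutativeRing public using (semiring)

  field
    enumeration : Inverse setoid (≡.setoid (Fin q))

  open Inverse enumeration public using (to; from; strictlyInverseʳ)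

  infix 4 _≟_
  _≟_ : Decidable _≈_
  _≟_ = via-injection (Inverse⇒Injection enumeration) Fin._≟_

module _ {c ℓ₁ ℓ₂ : Level} {q : ℕ} (F : FiniteField c ℓ₁ ℓ₂ q) where
  open FiniteField F
  open SemiringSum semiring using (sum)

  IsSquare : Carrier → Set (c ⊔ ℓ₁)
  IsSquare a = ∃ λ b → b * b ≈ a

  isSquare? : ∀ a → Dec (IsSquare a)
  isSquare? a = map′
    (λ (i , eq) → from i , eq)
    (λ (b , eq) → to b ,
      trans (*-cong (strictlyInverseʳ b) (strictlyInverseʳ b)) eq)
    (Fin.any? (λ i → from i * from i ≟ a))

  η : Carrier → ℤ
  η a = if does (a ≟ 0#) then 0ℤ
        else if does (isSquare? a) then 1ℤ
        else -1ℤ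

  -- An element of F itself: no square root is taken.
  ‖_-_‖ : ∀ {d} → Vector Carrier d → Vector Carrier d → Carrier
  ‖ x - y ‖ = sum (λ i → (x i - y i) * (x i - y i))

  -- A list without repetitions, up to coordinatewise _≈_, represents a subset
  -- of F^d whose cardinality is the length of the list.
  record Subset (d : ℕ) : Set (c ⊔ ℓ₁) where
    field
      elements : List (Vector Carrier d)
      unique   : UniqueSetoid.Unique (Vector≋.≋-setoid setoid d) elements

module _ {c ℓ₁ ℓ₂ : Level} {q : ℕ} {F : FiniteField c ℓ₁ ℓ₂ q} {d : ℕ} where

  ∣_∣ : Subset F d → ℕ
  ∣ A ∣ = length (Subset.elements A)

  SQ : Subset F d → ℕ
  SQ A = length
    (filter (λ (x , y) → η F (‖_-_‖ F x y) ℤ.≟ 1ℤ) (cartesianProduct elements elements))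
    where open Subset A

infix 7 _⁄_

_⁄_ : (m n : ℕ) .{{_ : NonZero n}} → ℚ
m ⁄ n = ℤ.+ m ℚ./ n

-- Stated at the exact denominators: instance search cannot solve for the
-- arguments of _^_ or _*_.  For even d ≥ 2 the natural-number operations in
-- the exponents are exact, so these are powers with exponents d/2 and (d-2)/2.
module Denominators (q d : ℕ) .{{_ : NonZero q}} where
  instance
    q^[d/2]≢0 : NonZero (q ℕ.^ (d ℕ./ 2))
    q^[d/2]≢0 = ℕ.m^n≢0 q (d ℕ./ 2)

    q^[[d∸2]/2]≢0 : NonZero (q ℕ.^ ((d ℕ.∸ 2) ℕ./ 2))
    q^[[d∸2]/2]≢0 = ℕ.m^n≢0 q ((d ℕ.∸ 2) ℕ./ 2)

    2*q≢0 : NonZero (2 ℕ.* q)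
    2*q≢0 = ℕ.m*n≢0 2 q

    2*q^[d/2]≢0 : NonZero (2 ℕ.* q ℕ.^ (d ℕ./ 2))
    2*q^[d/2]≢0 = ℕ.m*n≢0 2 (q ℕ.^ (d ℕ./ 2))

    1+1/q^[[d∸2]/2]≢0 : ℚ.NonZero (1ℚ ℚ.+ 1 ⁄ (q ℕ.^ ((d ℕ.∸ 2) ℕ./ 2)))
    1+1/q^[[d∸2]/2]≢0 =
      ℚ.pos⇒nonZero (1ℚ ℚ.+ 1 ⁄ r) {{ℚ.pos+pos⇒pos 1ℚ (1 ⁄ r) {{ℚ.normalize-pos 1 r}}}}
      where r = q ℕ.^ ((d ℕ.∸ 2) ℕ./ 2)

{-# OPTIONS --safe #-}
module Submission where

-- Write K for convolution on 𝔽_q^d with η(‖·‖), and Z for convolution with the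
-- indicator of ‖·‖ = 0.  For d = 2m, s = q^m, r = q^(m-1) and ε = η(-1)^m one
-- has K Z = -ε r K and K² = (s² - s r) I - ε s Z + ε r J, where J is the
-- all-ones kernel and K J = 0; hence K³ = s² K.  For the indicator f of A this
-- gives, without additive characters or eigenvalues,
--   0 ≤ |K² f - s K f|² = 2 s² (⟨f, K² f⟩ - s ⟨f, K f⟩),
--   0 ≤ |s² f - J f - K² f|² = s² (s² |A| - |A|² - ⟨f, K² f⟩),
-- and the bounds are combinations of these with 2 SQ(A) = |A|² - ⟨f, Z f⟩ + ⟨f, K f⟩
-- and |A| ≤ ⟨f, Z f⟩.
-- The two identities for K come from counting points of quadrics, which
-- reduces to ∑ η(quadratic polynomial) by translating or dilating vectors along
-- a line.

open import Algebra.Bundles using (CommutativeRing)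
open import Data.Nat using (ℕ; _%_)
open import Defs
open import Relation.Binary.PropositionalEquality using (_≡_)

-- K is symmetric, so K³ = s² K says that its eigenvalues lie among 0, s and -s; and J / s² is the
-- projection onto constants, because q^d = s². Hence K² - s K is 2 s² times the projection onto the
-- eigenvalue -s, and s² I - J - K² is s² times the projection onto the part of the kernel of K
-- orthogonal to constants. The two squared vectors are these operators applied to f. Being
-- multiples of projections, they turn a squared norm back into their own quadratic form, so
-- positivity comes from a sum of integer squares. The sign of Z in K² decides how the two
-- inequalities combine. For ε = -1 the first one cancels -⟨f, Z f⟩ in 2 SQ(A). For ε = 1 it doubles
-- that term, and twice the second one removes it. One copy of each eliminates ε and r and leaves
-- -⟨f, Z f⟩, which the diagonal pairs estimate. The delicate count is that of isotropic x with x·v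
-- = 0: it depends on whether v is isotropic, and each case has its own fibration. Both are summed
-- over a free scalar and then divided by q or q - 1, so that no explicit bases or changes of
-- coordinates appear.

module Sums where

  open import Data.Bool.Base using (if_then_else_)
  open import Data.Empty using (⊥-elim)
  open import Data.Fin.Base using (Fin; zero; suc)
  open import Data.Integer.Base as ℤ
    using (ℤ; 0ℤ; 1ℤ; _+_; _*_; -_; _-_; _≤_; +≤+)
  import Data.Integer.Properties as ℤ
  open import Data.Integer.Tactic.RingSolver using (solve-∀)
  open import Data.List.Base
    using (List; []; _∷_; length; map; _++_; tabulate; cartesianProductWith)
  open import Data.Nat.Base using (zero; suc; z≤n)
  open import Data.Product.Base using (_×_; _,_; uncurry)
  open import Data.Sum.Base using (_⊎_; [_,_])
  open import Function.Base using (_∘_)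
  open import Level using (Level; _⊔_)
  open import Relation.Binary.Bundles using (Setoid)
  open import Relation.Binary.Definitions using (Decidable)
  open import Relation.Binary.PropositionalEquality.Core
    using (_≡_; _≢_; refl; sym; trans; cong; cong₂)
  open import Relation.Binary.PropositionalEquality.Properties using (module ≡-Reasoning)
  open import Relation.Nullary.Decidable using (Dec; yes; no; does; _×-dec_)
  open import Relation.Nullary.Negation using (¬_)

  private variable
    a b p r : Level
    A : Set a
    B : Set b
    C : Set r
    P : Set p
    Q : Set b
    R : Set r

  -- Integer indicators, sums over lists and finite setoids

  𝟙 : Dec P → ℤ
  𝟙 P? = if does P? then 1ℤ else 0ℤ

  𝟙-yes : (P? : Dec P) → P → 𝟙 P? ≡ 1ℤ
  𝟙-yes (yes _) _ = refl
  𝟙-yes (no ¬p) p = ⊥-elim (¬p p)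

  𝟙-no : (P? : Dec P) → ¬ P → 𝟙 P? ≡ 0ℤ
  𝟙-no (yes p) ¬p = ⊥-elim (¬p p)
  𝟙-no (no _) _ = refl

  𝟙-cong : (P? : Dec P) (R? : Dec R) → (P → R) → (R → P) → 𝟙 P? ≡ 𝟙 R?
  𝟙-cong (yes p) R? f g = sym (𝟙-yes R? (f p))
  𝟙-cong (no ¬p) R? f g = sym (𝟙-no R? (¬p ∘ g))

  𝟙-× : (P? : Dec P) (R? : Dec R) → 𝟙 (P? ×-dec R?) ≡ 𝟙 P? * 𝟙 R?
  𝟙-× (yes _) (yes _) = refl
  𝟙-× (yes _) (no _) = refl
  𝟙-× (no _) _ = refl

  𝟙-*-cong : {P₁ : Set a} {P₂ : Set b} {R₁ : Set p} {R₂ : Set r} (P₁? : Dec P₁) (P₂? : Dec P₂)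
    (R₁? : Dec R₁) (R₂? : Dec R₂) → (P₁ → P₂ → R₁ × R₂) → (R₁ → R₂ → P₁ × P₂) →
    𝟙 P₁? * 𝟙 P₂? ≡ 𝟙 R₁? * 𝟙 R₂?
  𝟙-*-cong P₁? P₂? R₁? R₂? f g = trans (sym (𝟙-× P₁? P₂?))
    (trans (𝟙-cong (P₁? ×-dec P₂?) (R₁? ×-dec R₂?) (uncurry f) (uncurry g)) (𝟙-× R₁? R₂?))

  𝟙-⊎ : (P? : Dec P) (Q? : Dec Q) (R? : Dec R) → (P → ¬ Q) →
    (R → P ⊎ Q) → (P → R) → (Q → R) → 𝟙 R? ≡ 𝟙 P? + 𝟙 Q?
  𝟙-⊎ (yes p) (yes q) R? P⇒¬Q f g h = ⊥-elim (P⇒¬Q p q)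
  𝟙-⊎ (yes p) (no _) R? _ f g h = 𝟙-yes R? (g p)
  𝟙-⊎ (no _) (yes q) R? _ f g h = 𝟙-yes R? (h q)
  𝟙-⊎ (no ¬p) (no ¬q) R? _ f g h = 𝟙-no R? ([ ¬p , ¬q ] ∘ f)

  -- A quantity with one value on a condition and another value off it becomes affine in the
  -- indicator, so that it can be summed linearly without splitting the sum.
  𝟙-interpolate : (P? : Dec P) {i j k : ℤ} → (P → i ≡ j) → (¬ P → i ≡ k) →
    i ≡ k + (j - k) * 𝟙 P?
  𝟙-interpolate (yes p) {j = j} {k} f g = trans (f p) (lemma j k)
    where
    lemma : ∀ j k → j ≡ k + (j - k) * 1ℤ
    lemma = solve-∀
  𝟙-interpolate (no ¬p) {j = j} {k} f g = trans (g ¬p) (lemma j k)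
    where
    lemma : ∀ j k → k ≡ k + (j - k) * 0ℤ
    lemma = solve-∀

  0≤𝟙 : (P? : Dec P) → 0ℤ ≤ 𝟙 P?
  0≤𝟙 (yes _) = +≤+ z≤n
  0≤𝟙 (no _) = +≤+ z≤n

  ∑ : List A → (A → ℤ) → ℤ
  ∑ [] f = 0ℤ
  ∑ (x ∷ xs) f = f x + ∑ xs f

  syntax ∑ xs (λ x → e) = ∑[ x ← xs ] e
  infixr 5 ∑

  ∑-cong : (xs : List A) {f g : A → ℤ} → (∀ x → f x ≡ g x) → ∑ xs f ≡ ∑ xs g
  ∑-cong [] eq = refl
  ∑-cong (x ∷ xs) eq = cong₂ _+_ (eq x) (∑-cong xs eq)

  ∑-+ : (xs : List A) (f g : A → ℤ) → ∑ xs (λ x → f x + g x) ≡ ∑ xs f + ∑ xs g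
  ∑-+ [] f g = refl
  ∑-+ (x ∷ xs) f g rewrite ∑-+ xs f g = lemma (f x) (g x) _ _
    where
    lemma : ∀ a b c d → a + b + (c + d) ≡ a + c + (b + d)
    lemma = solve-∀

  ∑-*ˡ : (xs : List A) (c : ℤ) (f : A → ℤ) → ∑ xs (λ x → c * f x) ≡ c * ∑ xs f
  ∑-*ˡ [] c f = sym (ℤ.*-zeroʳ c)
  ∑-*ˡ (x ∷ xs) c f rewrite ∑-*ˡ xs c f = sym (ℤ.*-distribˡ-+ c (f x) _)

  ∑-*ʳ : (xs : List A) (c : ℤ) (f : A → ℤ) → ∑ xs (λ x → f x * c) ≡ ∑ xs f * c
  ∑-*ʳ xs c f = trans (∑-cong xs (λ x → ℤ.*-comm (f x) c)) (trans (∑-*ˡ xs c f) (ℤ.*-comm c _))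

  ∑-const : (xs : List A) (c : ℤ) → ∑ xs (λ _ → c) ≡ ℤ.+ length xs * c
  ∑-const [] c = refl
  ∑-const (x ∷ xs) c rewrite ∑-const xs c = sym (ℤ.suc-* (ℤ.+ length xs) c)

  ∑-0 : (xs : List A) → ∑ xs (λ _ → 0ℤ) ≡ 0ℤ
  ∑-0 [] = refl
  ∑-0 (x ∷ xs) = trans (ℤ.+-identityˡ _) (∑-0 xs)

  ∑-comm : (xs : List A) (ys : List B) (f : A → B → ℤ) →
    ∑ xs (λ x → ∑ ys (λ y → f x y)) ≡ ∑ ys (λ y → ∑ xs (λ x → f x y))
  ∑-comm [] ys f = sym (∑-0 ys)
  ∑-comm (x ∷ xs) ys f = trans (cong (∑ ys (f x) +_) (∑-comm xs ys f)) (sym (∑-+ ys (f x) _))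

  ∑-mono : (xs : List A) {f g : A → ℤ} → (∀ x → f x ≤ g x) → ∑ xs f ≤ ∑ xs g
  ∑-mono [] le = ℤ.≤-refl
  ∑-mono (x ∷ xs) le = ℤ.+-mono-≤ (le x) (∑-mono xs le)

  ∑-nonneg : (xs : List A) {f : A → ℤ} → (∀ x → 0ℤ ≤ f x) → 0ℤ ≤ ∑ xs f
  ∑-nonneg xs {f} le = ℤ.≤-trans (ℤ.≤-reflexive (sym (∑-0 xs))) (∑-mono xs le)

  ∑-++ : (xs ys : List A) (f : A → ℤ) → ∑ (xs ++ ys) f ≡ ∑ xs f + ∑ ys f
  ∑-++ [] ys f = sym (ℤ.+-identityˡ _)
  ∑-++ (x ∷ xs) ys f = trans (cong (f x +_) (∑-++ xs ys f)) (sym (ℤ.+-assoc (f x) _ _))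

  ∑-map : (xs : List A) (g : A → B) (f : B → ℤ) → ∑ (map g xs) f ≡ ∑ xs (λ x → f (g x))
  ∑-map [] g f = refl
  ∑-map (x ∷ xs) g f = cong (f (g x) +_) (∑-map xs g f)

  ∑-cartesianProductWith : (g : A → B → C) (xs : List A) (ys : List B) (f : C → ℤ) →
    ∑ (cartesianProductWith g xs ys) f ≡ ∑ xs (λ x → ∑ ys (λ y → f (g x y)))
  ∑-cartesianProductWith g [] ys f = refl
  ∑-cartesianProductWith g (x ∷ xs) ys f =
    trans (∑-++ (map (g x) ys) _ f)
      (cong₂ _+_ (∑-map ys (g x) f) (∑-cartesianProductWith g xs ys f))

  ∑-tabulate-single : ∀ {n} (f : Fin n → A) (g : A → ℤ) i → (∀ j → j ≢ i → g (f j) ≡ 0ℤ) →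
    ∑ (tabulate f) g ≡ g (f i)
  ∑-tabulate-single {n = suc n} f g zero eq =
    trans (cong (g (f zero) +_) (vanishes n (f ∘ suc) (λ j → eq (suc j) (λ ())))) (ℤ.+-identityʳ _)
    where
    vanishes : ∀ n (h : Fin n → _) → (∀ j → g (h j) ≡ 0ℤ) → ∑ (tabulate h) g ≡ 0ℤ
    vanishes zero h eq = refl
    vanishes (suc n) h eq = cong₂ _+_ (eq zero) (vanishes n (h ∘ suc) (eq ∘ suc))
  ∑-tabulate-single f g (suc i) eq =
    trans (cong₂ _+_ (eq zero (λ ())) (∑-tabulate-single (f ∘ suc) g i (λ j j≢i → eq (suc j) (λ where refl → j≢i refl))))
      (ℤ.+-identityˡ _)

  -- The single equation `once` says both that the list meets every class and that it meets none
  -- twice, in exactly the form that sums consume.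
  record Finite {c ℓ} (S : Setoid c ℓ) : Set (c ⊔ ℓ) where
    open Setoid S using (Carrier; _≈_)
    infix 4 _≟_
    field
      _≟_      : Decidable _≈_
      elements : List Carrier
      once     : ∀ x → ∑[ y ← elements ] 𝟙 (x ≟ y) ≡ 1ℤ

    pick-weight : ∀ {h : Carrier → ℤ} → (∀ {x y} → x ≈ y → h x ≡ h y) →
      ∀ x y → h y * 𝟙 (x ≟ y) ≡ h x * 𝟙 (x ≟ y)
    pick-weight {h} h-cong x y with x ≟ y
    ... | yes x≈y = cong (_* 1ℤ) (sym (h-cong x≈y))
    ... | no _ = trans (ℤ.*-zeroʳ (h y)) (sym (ℤ.*-zeroʳ (h x)))

    pick : ∀ {h : Carrier → ℤ} → (∀ {x y} → x ≈ y → h x ≡ h y) →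
      ∀ x → ∑[ y ← elements ] (h y * 𝟙 (x ≟ y)) ≡ h x
    pick {h} h-cong x = begin
      ∑[ y ← elements ] (h y * 𝟙 (x ≟ y)) ≡⟨ ∑-cong elements (pick-weight h-cong x) ⟩
      ∑[ y ← elements ] (h x * 𝟙 (x ≟ y)) ≡⟨ ∑-*ˡ elements (h x) _ ⟩
      h x * (∑[ y ← elements ] 𝟙 (x ≟ y)) ≡⟨ cong (h x *_) (once x) ⟩
      h x * 1ℤ                            ≡⟨ ℤ.*-identityʳ (h x) ⟩
      h x                                 ∎
      where open ≡-Reasoning

    -- Each `h (φ x)` is expanded over all y by `pick`; exchanging the two sums leaves the fibre
    -- sizes of `φ` as weights.
    ∑-fibres : (xs : List A) (φ : A → Carrier) {h : Carrier → ℤ} →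
      (∀ {x y} → x ≈ y → h x ≡ h y) →
      ∑[ x ← xs ] h (φ x) ≡ ∑[ y ← elements ] (h y * (∑[ x ← xs ] 𝟙 (φ x ≟ y)))
    ∑-fibres xs φ {h} h-cong = begin
      ∑[ x ← xs ] h (φ x)
        ≡⟨ ∑-cong xs (λ x → sym (pick h-cong (φ x))) ⟩
      ∑[ x ← xs ] ∑[ y ← elements ] (h y * 𝟙 (φ x ≟ y))
        ≡⟨ ∑-comm xs elements _ ⟩
      ∑[ y ← elements ] ∑[ x ← xs ] (h y * 𝟙 (φ x ≟ y))
        ≡⟨ ∑-cong elements (λ y → ∑-*ˡ xs (h y) _) ⟩
      ∑[ y ← elements ] (h y * (∑[ x ← xs ] 𝟙 (φ x ≟ y))) ∎
      where open ≡-Reasoning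

    ∑-member : ∀ {h : Carrier → ℤ} → (∀ {x y} → x ≈ y → h x ≡ h y) → (∀ x → 0ℤ ≤ h x) →
      ∀ x → h x ≤ ∑ elements h
    ∑-member {h} h-cong 0≤h x =
      ℤ.≤-trans (ℤ.≤-reflexive (sym (pick h-cong x))) (∑-mono elements below)
      where
      below : ∀ y → h y * 𝟙 (x ≟ y) ≤ h y
      below y with x ≟ y
      ... | yes _ = ℤ.≤-reflexive (ℤ.*-identityʳ (h y))
      ... | no _ = ℤ.≤-trans (ℤ.≤-reflexive (ℤ.*-zeroʳ (h y))) (0≤h y)

  module _ {c ℓ c′ ℓ′} {S : Setoid c ℓ} {T : Setoid c′ ℓ′} (FS : Finite S) (FT : Finite T) where
    private
      module S = Setoid S
      module T = Setoid T
      module FS = Finite FS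
      module FT = Finite FT

    -- The two implications make `φ x ≈ y` equivalent to `ψ y ≈ x`, so every fibre of `φ` is a
    -- single class and has size 1 by `once`.
    ∑-reindex : (φ : S.Carrier → T.Carrier) (ψ : T.Carrier → S.Carrier) →
      (∀ {x y} → φ x T.≈ y → ψ y S.≈ x) → (∀ {x y} → ψ y S.≈ x → φ x T.≈ y) →
      {h : T.Carrier → ℤ} → (∀ {x y} → x T.≈ y → h x ≡ h y) →
      ∑[ x ← FS.elements ] h (φ x) ≡ ∑[ y ← FT.elements ] h y
    ∑-reindex φ ψ φ⇒ψ ψ⇒φ {h} h-cong =
      trans (FT.∑-fibres FS.elements φ h-cong) (∑-cong FT.elements fibre)
      where
      fibre : ∀ y → h y * (∑[ x ← FS.elements ] 𝟙 (φ x FT.≟ y)) ≡ h y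
      fibre y = trans (cong (h y *_) (trans
        (∑-cong FS.elements (λ x → 𝟙-cong (φ x FT.≟ y) (ψ y FS.≟ x) φ⇒ψ ψ⇒φ)) (FS.once (ψ y))))
        (ℤ.*-identityʳ (h y))

-- A ring solver with integer numerals for an abstract commutative ring

module IntegerCoefficients {c ℓ} (R : CommutativeRing c ℓ) where

  open CommutativeRing R
  open import Algebra.Properties.Ring ring
    using (-0#≈0#; -‿distribˡ-*; -‿distribʳ-*; -‿involutive)
  open import Algebra.Properties.AbelianGroup +-abelianGroup using (⁻¹-∙-comm)
  open import Algebra.Properties.Semiring.Mult.TCOptimised semiring
    using (1+×; ×-homo-+; ×1-homo-*) renaming (_×_ to infixl 8 _×_)
  import Algebra.Solver.Ring as RingSolver
  open import Algebra.Solver.Ring.AlmostCommutativeRing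
    using (fromCommutativeRing; _-Raw-AlmostCommutative⟶_)
  open import Data.Integer.Base as ℤ using (ℤ; -[1+_])
  import Data.Integer.Properties as ℤ
  open import Data.Maybe.Base using (Maybe; just; nothing)
  open import Data.Nat.Base as ℕ using (ℕ; zero; suc)
  open import Relation.Binary.PropositionalEquality.Core as ≡ using (_≡_)
  open import Relation.Binary.Reasoning.Setoid setoid
  open import Relation.Nullary.Decidable using (yes; no)

  -- The optimised multiple makes the numerals 1 and 2 compute to `1#` and `1# + 1#`, so solved
  -- identities mention the constants as the later proofs write them.
  ⟦_⟧ : ℤ → Carrier
  ⟦ ℤ.+ n ⟧ = n × 1#
  ⟦ -[1+ n ] ⟧ = - (suc n × 1#)

  neg-homo : ∀ i → ⟦ ℤ.- i ⟧ ≈ - ⟦ i ⟧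
  neg-homo (ℤ.+ zero) = sym -0#≈0#
  neg-homo (ℤ.+ suc n) = refl
  neg-homo -[1+ n ] = sym (-‿involutive _)

  ⊖-homo : ∀ m n → ⟦ m ℤ.⊖ n ⟧ ≈ m × 1# + - (n × 1#)
  ⊖-homo zero zero = sym (-‿inverseʳ 0#)
  ⊖-homo zero (suc n) = sym (+-identityˡ _)
  ⊖-homo (suc m) zero = sym (trans (+-congˡ -0#≈0#) (+-identityʳ _))
  ⊖-homo (suc m) (suc n) = begin
    ⟦ suc m ℤ.⊖ suc n ⟧                   ≡⟨ ≡.cong ⟦_⟧ (ℤ.[1+m]⊖[1+n]≡m⊖n m n) ⟩
    ⟦ m ℤ.⊖ n ⟧                           ≈⟨ ⊖-homo m n ⟩
    m × 1# + - (n × 1#)                    ≈⟨ +-congˡ (+-identityˡ _) ⟨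
    m × 1# + (0# + - (n × 1#))             ≈⟨ +-congˡ (+-congʳ (-‿inverseʳ 1#)) ⟨
    m × 1# + (1# + - 1# + - (n × 1#))      ≈⟨ +-congˡ (+-assoc _ _ _) ⟩
    m × 1# + (1# + (- 1# + - (n × 1#)))    ≈⟨ +-assoc _ _ _ ⟨
    m × 1# + 1# + (- 1# + - (n × 1#))      ≈⟨ +-cong (+-comm _ _) (⁻¹-∙-comm _ _) ⟩
    1# + m × 1# + - (1# + n × 1#)          ≈⟨ +-cong (1+× m 1#) (-‿cong (1+× n 1#)) ⟨
    suc m × 1# + - (suc n × 1#)            ∎

  +-homo : ∀ i j → ⟦ i ℤ.+ j ⟧ ≈ ⟦ i ⟧ + ⟦ j ⟧
  +-homo (ℤ.+ m) (ℤ.+ n) = ×-homo-+ 1# m n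
  +-homo (ℤ.+ m) -[1+ n ] = ⊖-homo m (suc n)
  +-homo -[1+ m ] (ℤ.+ n) = trans (⊖-homo n (suc m)) (+-comm _ _)
  +-homo -[1+ m ] -[1+ n ] = begin
    - (suc (suc (m ℕ.+ n)) × 1#)      ≡⟨ ≡.cong (λ k → - (k × 1#)) (ℕ.+-suc (suc m) n) ⟨
    - ((suc m ℕ.+ suc n) × 1#)        ≈⟨ -‿cong (×-homo-+ 1# (suc m) (suc n)) ⟩
    - (suc m × 1# + suc n × 1#)       ≈⟨ ⁻¹-∙-comm _ _ ⟨
    - (suc m × 1#) + - (suc n × 1#)   ∎
    where import Data.Nat.Properties as ℕ

  *-homo : ∀ i j → ⟦ i ℤ.* j ⟧ ≈ ⟦ i ⟧ * ⟦ j ⟧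
  *-homo (ℤ.+ m) (ℤ.+ n) = trans (reflexive (≡.cong ⟦_⟧ (ℤ.+◃n≡+n (m ℕ.* n)))) (×1-homo-* m n)
  *-homo (ℤ.+ m) -[1+ n ] = begin
    ⟦ ℤ.+ m ℤ.* -[1+ n ] ⟧       ≡⟨ ≡.cong ⟦_⟧ (ℤ.-◃n≡-n (m ℕ.* suc n)) ⟩
    ⟦ ℤ.- ℤ.+ (m ℕ.* suc n) ⟧    ≈⟨ neg-homo (ℤ.+ (m ℕ.* suc n)) ⟩
    - ((m ℕ.* suc n) × 1#)       ≈⟨ -‿cong (×1-homo-* m (suc n)) ⟩
    - (m × 1# * suc n × 1#)      ≈⟨ -‿distribʳ-* _ _ ⟩
    m × 1# * - (suc n × 1#)      ∎
  *-homo -[1+ m ] (ℤ.+ n) = begin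
    ⟦ -[1+ m ] ℤ.* ℤ.+ n ⟧       ≡⟨ ≡.cong ⟦_⟧ (ℤ.-◃n≡-n (suc m ℕ.* n)) ⟩
    ⟦ ℤ.- ℤ.+ (suc m ℕ.* n) ⟧    ≈⟨ neg-homo (ℤ.+ (suc m ℕ.* n)) ⟩
    - ((suc m ℕ.* n) × 1#)       ≈⟨ -‿cong (×1-homo-* (suc m) n) ⟩
    - (suc m × 1# * n × 1#)      ≈⟨ -‿distribˡ-* _ _ ⟩
    - (suc m × 1#) * n × 1#      ∎
  *-homo -[1+ m ] -[1+ n ] = begin
    (suc m ℕ.* suc n) × 1#               ≈⟨ ×1-homo-* (suc m) (suc n) ⟩
    suc m × 1# * suc n × 1#              ≈⟨ -‿involutive _ ⟨
    - - (suc m × 1# * suc n × 1#)        ≈⟨ -‿cong (-‿distribˡ-* _ _) ⟩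
    - (- (suc m × 1#) * suc n × 1#)      ≈⟨ -‿distribʳ-* _ _ ⟩
    - (suc m × 1#) * - (suc n × 1#)      ∎

  morphism : ℤ.+-*-rawRing -Raw-AlmostCommutative⟶ fromCommutativeRing R
  morphism = record
    { ⟦_⟧    = ⟦_⟧
    ; +-homo = +-homo
    ; *-homo = *-homo
    ; -‿homo = neg-homo
    ; 0-homo = refl
    ; 1-homo = refl
    }

  -- Coefficients are compared in ℤ. Integers that agree only modulo the characteristic remain
  -- distinct for the solver, which is sound and enough for identities valid in every commutative
  -- ring.
  coeff≟ : ∀ i j → Maybe (⟦ i ⟧ ≈ ⟦ j ⟧)
  coeff≟ i j with i ℤ.≟ j
  ... | yes i≡j = just (reflexive (≡.cong ⟦_⟧ i≡j))
  ... | no _ = nothing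

  open RingSolver ℤ.+-*-rawRing (fromCommutativeRing R) morphism coeff≟ public
    using (solve; _:=_; _:+_; _:*_; :-_; _:-_; con)

-- Field arithmetic, the quadratic character and its multiplicativity

module QuadraticCharacter {c ℓ₁ ℓ₂} {q : ℕ} (F : FiniteField c ℓ₁ ℓ₂ q) (q-odd : q % 2 ≡ 1) where

  open Sums
  open import Algebra.Apartness.Properties.HeytingCommutativeRing
    using (1#0)
  open import Data.Bool.Base using (if_then_else_)
  open import Data.Empty using (⊥-elim)
  open import Data.Fin.Base as Fin using (Fin)
  import Data.Fin.Properties as Fin
  open import Data.Integer.Base as ℤ
    using (ℤ; 0ℤ; 1ℤ; -1ℤ; _+_; _*_; -_; _-_; _≤_)
  import Data.Integer.Properties as ℤ
  open import Data.Integer.Tactic.RingSolver using (solve-∀)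
  open import Algebra.Properties.AbelianGroup ℤ.+-0-abelianGroup
    using () renaming (∙-cancelˡ to +-cancelˡ)
  open import Data.List.Base using (List; length; tabulate)
  open import Data.List.Properties using (length-tabulate)
  open import Data.Nat.Base as ℕ using (zero)
  open import Data.Nat.DivMod using (m*n%n≡0)
  import Data.Nat.Properties as ℕ
  open import Data.Product.Base using (∃; _,_; proj₁; proj₂)
  open import Data.Sum.Base using (_⊎_; inj₁; inj₂)
  open import Function.Base using (_∘_)
  open import Function.Bundles using (Inverse; Injection)
  open import Function.Properties.Inverse using (Inverse⇒Injection)
  import Level
  open import Relation.Binary.PropositionalEquality.Core
    using (_≢_; refl; sym; trans; cong; cong₂; subst)
  open import Relation.Binary.PropositionalEquality.Properties using (module ≡-Reasoning)
  open import Relation.Binary.Definitions using (tri<; tri≈; tri>)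
  open import Relation.Nullary.Decidable using (does; yes; no; dec-true; dec-false)
  open import Relation.Nullary.Negation using (¬_)

  open FiniteField F public
    using (Carrier; _≈_; 0#; 1#; setoid; to; from; enumeration; commutativeRing; tight;
           #⇒invertible; heytingCommutativeRing)
    renaming (_+_ to _⊕_; _*_ to _⊗_; -_ to ⊖_; _-_ to _⊝_;
              refl to ≈-refl; sym to ≈-sym; trans to ≈-trans;
              +-cong to ⊕-cong; *-cong to ⊗-cong; -‿cong to ⊖-cong;
              +-identityˡ to ⊕-identityˡ; *-identityˡ to ⊗-identityˡ; *-comm to ⊗-comm;
              *-assoc to ⊗-assoc; zeroˡ to ⊗-zeroˡ; zeroʳ to ⊗-zeroʳ; -‿inverseʳ to ⊖-inverseʳ)
  open IntegerCoefficients commutativeRing public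
    using (solve; _:=_; _:+_; _:*_; :-_; _:-_; con)

  to-injective : ∀ {x y} → to x ≡ to y → x ≈ y
  to-injective = Injection.injective (Inverse⇒Injection enumeration)

  -- Opaque because the decision procedure otherwise unfolds into the
  -- enumeration whenever a goal is normalised.
  opaque
    field-finite : Finite setoid
    field-finite = record
      { _≟_ = FiniteField._≟_ F
      ; elements = tabulate from
      ; once = λ x → trans
          (∑-tabulate-single from (λ y → 𝟙 (FiniteField._≟_ F x y)) (to x)
            (λ j j≢ → 𝟙-no (FiniteField._≟_ F x (from j)) (λ x≈ → j≢ (sym (Inverse.inverseˡ enumeration x≈)))))
          (𝟙-yes (FiniteField._≟_ F x (from (to x))) (≈-sym (Inverse.strictlyInverseʳ enumeration x)))
      }

    length-elements : length (Finite.elements field-finite) ≡ q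
    length-elements = length-tabulate from

  open Finite field-finite public using (_≟_) renaming
    (elements to 𝔽; once to once𝔽; pick to pick𝔽; ∑-fibres to ∑-fibres𝔽; ∑-member to ∑-member𝔽)

  Cong : (Carrier → ℤ) → Set _
  Cong h = ∀ {x y} → x ≈ y → h x ≡ h y

  ∑𝔽-const : ∀ i → (∑[ x ← 𝔽 ] i) ≡ ℤ.+ q * i
  ∑𝔽-const i = trans (∑-const 𝔽 i) (cong (λ n → ℤ.+ n * i) length-elements)

  𝟙≈-cong : ∀ {a b x y} → a ≈ b → x ≈ y → 𝟙 (a ≟ x) ≡ 𝟙 (b ≟ y)
  𝟙≈-cong {a} {b} {x} {y} a≈b x≈y = 𝟙-cong (a ≟ x) (b ≟ y)
    (λ a≈x → ≈-trans (≈-sym a≈b) (≈-trans a≈x x≈y))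
    (λ b≈y → ≈-trans a≈b (≈-trans b≈y (≈-sym x≈y)))

  1≉0 : ¬ 1# ≈ 0#
  1≉0 1≈0 = proj₂ (tight 1# 0#) 1≈0 (1#0 heytingCommutativeRing)

  -- Apartness from 0 is not given as decidable, so an inverse is searched for in the enumeration.
  -- If none is found then x cannot be apart from 0, and tightness forces x ≈ 0.
  inverse : ∀ {x} → ¬ x ≈ 0# → ∃ λ y → x ⊗ y ≈ 1#
  inverse {x} x≉0 with Fin.any? (λ i → x ⊗ from i ≟ 1#)
  ... | yes (i , eq) = from i , eq
  ... | no none = ⊥-elim (x≉0 (proj₁ (tight x 0#) not-apart))
    where
    x0 : ∀ a b → (a ⊝ 0#) ⊗ b ≈ a ⊗ b
    x0 = solve 2 (λ a b → (a :- con 0ℤ) :* b := a :* b) ≈-refl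
    not-apart : _
    not-apart x#0 with #⇒invertible x#0
    ... | (y , _ , right) = none (to y ,
      ≈-trans (⊗-cong ≈-refl (Inverse.strictlyInverseʳ enumeration y)) (≈-trans (≈-sym (x0 x y)) right))

  ⊗-cancelˡ : ∀ {x y z} → ¬ x ≈ 0# → x ⊗ y ≈ x ⊗ z → y ≈ z
  ⊗-cancelˡ {x} {y} {z} x≉0 eq with inverse x≉0
  ... | (w , xw≈1) = ≈-trans (≈-sym (undo y)) (≈-trans (⊗-cong ≈-refl eq) (undo z))
    where
    undo : ∀ u → w ⊗ (x ⊗ u) ≈ u
    undo u = ≈-trans (solve 3 (λ w x u → w :* (x :* u) := x :* w :* u) ≈-refl w x u)
      (≈-trans (⊗-cong xw≈1 ≈-refl) (⊗-identityˡ u))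

  ⊗-integral : ∀ {x y} → ¬ x ≈ 0# → x ⊗ y ≈ 0# → y ≈ 0#
  ⊗-integral {x} x≉0 eq = ⊗-cancelˡ x≉0 (≈-trans eq (≈-sym (⊗-zeroʳ x)))

  ⊗-nonzero : ∀ {x y} → ¬ x ≈ 0# → ¬ y ≈ 0# → ¬ x ⊗ y ≈ 0#
  ⊗-nonzero x≉0 y≉0 eq = y≉0 (⊗-integral x≉0 eq)

  ⊝-zero : ∀ {x y} → x ⊝ y ≈ 0# → x ≈ y
  ⊝-zero {x} {y} eq = ≈-trans (solve 2 (λ x y → x := x :- y :+ y) ≈-refl x y)
    (≈-trans (⊕-cong eq ≈-refl) (⊕-identityˡ y))

  ⊝-self : ∀ {x y} → x ≈ y → x ⊝ y ≈ 0#
  ⊝-self {x} {y} eq = ≈-trans (⊕-cong eq ≈-refl) (⊖-inverseʳ y)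

  ∑-translate : ∀ a {h} → Cong h → (∑[ x ← 𝔽 ] h (x ⊕ a)) ≡ (∑[ x ← 𝔽 ] h x)
  ∑-translate a = ∑-reindex field-finite field-finite (_⊕ a) (_⊝ a)
    (λ {x} eq → ≈-trans (⊕-cong (≈-sym eq) ≈-refl) (solve 2 (λ x a → x :+ a :- a := x) ≈-refl x a))
    (λ {_} {y} eq → ≈-trans (⊕-cong (≈-sym eq) ≈-refl) (solve 2 (λ y a → y :- a :+ a := y) ≈-refl y a))

  ∑-dilate : ∀ {a} → ¬ a ≈ 0# → ∀ {h} → Cong h → (∑[ x ← 𝔽 ] h (a ⊗ x)) ≡ (∑[ x ← 𝔽 ] h x)
  ∑-dilate {a} a≉0 with inverse a≉0
  ... | (b , ab≈1) = ∑-reindex field-finite field-finite (a ⊗_) (b ⊗_)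
    (λ {x} {y} eq → ≈-trans (⊗-cong ≈-refl (≈-sym eq))
      (≈-trans (solve 3 (λ a b x → b :* (a :* x) := a :* b :* x) ≈-refl a b x)
        (≈-trans (⊗-cong ab≈1 ≈-refl) (⊗-identityˡ x))))
    (λ {x} {y} eq → ≈-trans (⊗-cong ≈-refl (≈-sym eq))
      (≈-trans (≈-sym (⊗-assoc a b y)) (≈-trans (⊗-cong ab≈1 ≈-refl) (⊗-identityˡ y))))

  -- If 2 = 0 then x ↦ x + 1 is a fixed-point-free involution, so exactly one
  -- of each pair precedes its partner in the enumeration and q is even.
  2≉0 : ¬ 1# ⊕ 1# ≈ 0#
  2≉0 2≈0 = odd≢even (trans (cong (_% 2) q≡) (m*n%n≡0 ℤ.∣ S ∣ 2))
    where
    precedes : Carrier → ℤ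
    precedes x = 𝟙 (to x Fin.<? to (x ⊕ 1#))

    precedes-cong : Cong precedes
    precedes-cong x≈y = cong₂ (λ i j → 𝟙 (i Fin.<? j)) (Inverse.to-cong enumeration x≈y)
      (Inverse.to-cong enumeration (⊕-cong x≈y ≈-refl))

    S = ∑ 𝔽 precedes

    back : ∀ x → to (x ⊕ 1# ⊕ 1#) ≡ to x
    back x = Inverse.to-cong enumeration
      (≈-trans (solve 1 (λ x → x :+ con 1ℤ :+ con 1ℤ := con (ℤ.+ 2) :+ x) ≈-refl x)
        (≈-trans (⊕-cong 2≈0 ≈-refl) (⊕-identityˡ x)))

    distinct : ∀ x → to x ≢ to (x ⊕ 1#)
    distinct x eq = 1≉0 (≈-trans (solve 1 (λ x → con 1ℤ := x :+ con 1ℤ :- x) ≈-refl x)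
      (⊝-self (≈-sym (to-injective eq))))

    pair : ∀ x → 1ℤ ≡ precedes x + precedes (x ⊕ 1#)
    pair x rewrite back x with Fin.<-cmp (to x) (to (x ⊕ 1#))
    ... | tri< i<j _ i≯j = sym (cong₂ _+_ (𝟙-yes (to x Fin.<? _) i<j) (𝟙-no (_ Fin.<? to x) i≯j))
    ... | tri≈ _ i≡j _ = ⊥-elim (distinct x i≡j)
    ... | tri> i≮j _ i>j = sym (cong₂ _+_ (𝟙-no (to x Fin.<? _) i≮j) (𝟙-yes (_ Fin.<? to x) i>j))

    +q≡ : ℤ.+ q ≡ S * ℤ.+ 2
    +q≡ = begin
      ℤ.+ q                          ≡⟨ ℤ.*-identityʳ (ℤ.+ q) ⟨
      ℤ.+ q * 1ℤ                     ≡⟨ ∑𝔽-const 1ℤ ⟨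
      ∑[ x ← 𝔽 ] 1ℤ                  ≡⟨ ∑-cong 𝔽 pair ⟩
      ∑[ x ← 𝔽 ] precedes x + precedes (x ⊕ 1#)   ≡⟨ ∑-+ 𝔽 precedes _ ⟩
      S + (∑[ x ← 𝔽 ] precedes (x ⊕ 1#)) ≡⟨ cong (S +_) (∑-translate 1# precedes-cong) ⟩
      S + S                          ≡⟨ double S ⟩
      S * ℤ.+ 2                      ∎
      where
      open ≡-Reasoning
      double : ∀ s → s + s ≡ s * ℤ.+ 2
      double = solve-∀

    q≡ : q ≡ ℤ.∣ S ∣ ℕ.* 2
    q≡ = trans (cong ℤ.∣_∣ +q≡) (ℤ.abs-* S (ℤ.+ 2))

    odd≢even : q % 2 ≢ 0
    odd≢even eq with () ← trans (sym q-odd) eq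

  q-1≢0 : ℤ.+ q - 1ℤ ≢ 0ℤ
  q-1≢0 eq = 1≉0 (to-injective (unique _ _))
    where
    q≡1 : q ≡ 1
    q≡1 = ℤ.+-injective (ℤ.i-j≡0⇒i≡j (ℤ.+ q) 1ℤ eq)
    unique : ∀ (i j : Fin q) → i ≡ j
    unique = subst (λ n → (i j : Fin n) → i ≡ j) (sym q≡1) (λ where Fin.zero Fin.zero → refl)

  opaque
    -- An opaque copy of η keeps the search for a square root out of goals. Its values are reached
    -- through `residue`, which pairs each of them with its reason; `η′≡η` leads back to the
    -- original.
    η′ : Carrier → ℤ
    η′ = η F

    η′≡η : ∀ a → η′ a ≡ η F a
    η′≡η a = refl

  data Residue (a : Carrier) : Set (c Level.⊔ ℓ₁) where
    zero      : a ≈ 0# → η′ a ≡ 0ℤ → Residue a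
    square    : ¬ a ≈ 0# → IsSquare F a → η′ a ≡ 1ℤ → Residue a
    nonsquare : ¬ a ≈ 0# → ¬ IsSquare F a → η′ a ≡ -1ℤ → Residue a

  IsSquare-resp : ∀ {a b} → a ≈ b → IsSquare F a → IsSquare F b
  IsSquare-resp a≈b (x , eq) = x , ≈-trans eq a≈b

  opaque
    unfolding η′

    residue : ∀ a → Residue a
    residue a with FiniteField._≟_ F a 0# | isSquare? F a
    ... | yes a≈0 | _ = zero a≈0 (cong (if_then 0ℤ else (if does (isSquare? F a) then 1ℤ else -1ℤ)) (dec-true (FiniteField._≟_ F a 0#) a≈0))
    ... | no a≉0 | yes sq = square a≉0 sq (trans
        (cong (if_then 0ℤ else (if does (isSquare? F a) then 1ℤ else -1ℤ)) (dec-false (FiniteField._≟_ F a 0#) a≉0))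
        (cong (if_then 1ℤ else -1ℤ) (dec-true (isSquare? F a) sq)))
    ... | no a≉0 | no ¬sq = nonsquare a≉0 ¬sq (trans
        (cong (if_then 0ℤ else (if does (isSquare? F a) then 1ℤ else -1ℤ)) (dec-false (FiniteField._≟_ F a 0#) a≉0))
        (cong (if_then 1ℤ else -1ℤ) (dec-false (isSquare? F a) ¬sq)))

  η-zero : ∀ {a} → a ≈ 0# → η′ a ≡ 0ℤ
  η-zero {a} a≈0 with residue a
  ... | zero _ eq = eq
  ... | square a≉0 _ _ = ⊥-elim (a≉0 a≈0)
  ... | nonsquare a≉0 _ _ = ⊥-elim (a≉0 a≈0)

  η-square : ∀ {a} → ¬ a ≈ 0# → IsSquare F a → η′ a ≡ 1ℤ
  η-square {a} a≉0 s with residue a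
  ... | zero a≈0 _ = ⊥-elim (a≉0 a≈0)
  ... | square _ _ eq = eq
  ... | nonsquare _ ¬s _ = ⊥-elim (¬s s)

  η-nonsquare : ∀ {a} → ¬ IsSquare F a → η′ a ≡ -1ℤ
  η-nonsquare {a} ¬s with residue a
  ... | zero a≈0 _ = ⊥-elim (¬s (0# , ≈-trans (⊗-zeroˡ 0#) (≈-sym a≈0)))
  ... | square _ s _ = ⊥-elim (¬s s)
  ... | nonsquare _ _ eq = eq

  η-resp : ∀ {a b} → (a ≈ 0# → b ≈ 0#) → (b ≈ 0# → a ≈ 0#) →
    (IsSquare F a → IsSquare F b) → (IsSquare F b → IsSquare F a) → η′ a ≡ η′ b
  η-resp {a} z z′ s s′ with residue a
  ... | zero a≈0 eq = trans eq (sym (η-zero (z a≈0)))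
  ... | square a≉0 sq eq = trans eq (sym (η-square (a≉0 ∘ z′) (s sq)))
  ... | nonsquare _ ¬sq eq = trans eq (sym (η-nonsquare (¬sq ∘ s′)))

  η-cong : Cong η′
  η-cong a≈b = η-resp (≈-trans (≈-sym a≈b)) (≈-trans a≈b)
    (IsSquare-resp a≈b) (IsSquare-resp (≈-sym a≈b))

  η≤1 : ∀ a → η′ a ≤ 1ℤ
  η≤1 a with residue a
  ... | zero _ eq rewrite eq = ℤ.+≤+ ℕ.z≤n
  ... | square _ _ eq rewrite eq = ℤ.≤-refl
  ... | nonsquare _ _ eq rewrite eq = ℤ.-≤+

  η² : ∀ a → η′ a * η′ a ≡ 1ℤ - 𝟙 (a ≟ 0#)
  η² a with residue a
  ... | zero a≈0 eq rewrite eq | 𝟙-yes (a ≟ 0#) a≈0 = refl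
  ... | square a≉0 _ eq rewrite eq | 𝟙-no (a ≟ 0#) a≉0 = refl
  ... | nonsquare a≉0 _ eq rewrite eq | 𝟙-no (a ≟ 0#) a≉0 = refl

  η²≡1 : ∀ {a} → ¬ a ≈ 0# → η′ a * η′ a ≡ 1ℤ
  η²≡1 {a} a≉0 = trans (η² a) (cong (λ i → 1ℤ - i) (𝟙-no (a ≟ 0#) a≉0))

  η1 : η′ 1# ≡ 1ℤ
  η1 = η-square 1≉0 (1# , ⊗-identityˡ 1#)

  -- A nonzero square b² has the two roots b and -b, distinct because 2 ≠ 0, and no others because
  -- (b - x)(x + b) = 0 forces one factor to vanish. At 0 the only root is 0.
  square-roots : ∀ t → (∑[ x ← 𝔽 ] 𝟙 (x ⊗ x ≟ t)) ≡ 1ℤ + η′ t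
  square-roots t with residue t
  ... | zero t≈0 eq = trans
    (trans (∑-cong 𝔽 (λ x → 𝟙-cong (x ⊗ x ≟ t) (0# ≟ x) (root x) (root⁻¹ x))) (once𝔽 0#))
    (cong (1ℤ +_) (sym eq))
    where
    root : ∀ x → x ⊗ x ≈ t → 0# ≈ x
    root x x²≈t with x ≟ 0#
    ... | yes x≈0 = ≈-sym x≈0
    ... | no x≉0 = ⊥-elim (⊗-nonzero x≉0 x≉0 (≈-trans x²≈t t≈0))
    root⁻¹ : ∀ x → 0# ≈ x → x ⊗ x ≈ t
    root⁻¹ x 0≈x = ≈-trans (⊗-cong (≈-sym 0≈x) ≈-refl) (≈-trans (⊗-zeroˡ x) (≈-sym t≈0))
  ... | square t≉0 (b , b²≈t) eq = begin
    ∑[ x ← 𝔽 ] 𝟙 (x ⊗ x ≟ t)                ≡⟨ ∑-cong 𝔽 roots ⟩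
    ∑[ x ← 𝔽 ] 𝟙 (b ≟ x) + 𝟙 (⊖ b ≟ x)      ≡⟨ ∑-+ 𝔽 _ _ ⟩
    (∑[ x ← 𝔽 ] 𝟙 (b ≟ x)) + (∑[ x ← 𝔽 ] 𝟙 (⊖ b ≟ x)) ≡⟨ cong₂ _+_ (once𝔽 b) (once𝔽 (⊖ b)) ⟩
    1ℤ + 1ℤ                                  ≡⟨ cong (1ℤ +_) eq ⟨
    1ℤ + η′ t                                ∎
    where
    open ≡-Reasoning
    b≉0 : ¬ b ≈ 0#
    b≉0 b≈0 = t≉0 (≈-trans (≈-sym b²≈t) (≈-trans (⊗-cong b≈0 ≈-refl) (⊗-zeroˡ b)))
    b≉-b : ¬ b ≈ ⊖ b
    b≉-b eq = ⊗-nonzero 2≉0 b≉0 (≈-trans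
      (solve 1 (λ b → con (ℤ.+ 2) :* b := b :- (:- b)) ≈-refl b) (⊝-self eq))
    roots : ∀ x → 𝟙 (x ⊗ x ≟ t) ≡ 𝟙 (b ≟ x) + 𝟙 (⊖ b ≟ x)
    roots x = 𝟙-⊎ (b ≟ x) (⊖ b ≟ x) (x ⊗ x ≟ t)
      (λ b≈x -b≈x → b≉-b (≈-trans b≈x (≈-sym -b≈x)))
      factor
      (λ b≈x → ≈-trans (⊗-cong (≈-sym b≈x) (≈-sym b≈x)) b²≈t)
      (λ -b≈x → ≈-trans (⊗-cong (≈-sym -b≈x) (≈-sym -b≈x))
        (≈-trans (solve 1 (λ b → (:- b) :* (:- b) := b :* b) ≈-refl b) b²≈t))
      where
      sum≈0 : ¬ b ≈ x → x ⊗ x ≈ t → x ⊕ b ≈ 0#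
      sum≈0 b≉x x²≈t = ⊗-integral (b≉x ∘ ⊝-zero)
        (≈-trans (solve 2 (λ b x → (b :- x) :* (x :+ b) := b :* b :- x :* x) ≈-refl b x)
          (⊝-self (≈-trans b²≈t (≈-sym x²≈t))))
      factor : x ⊗ x ≈ t → b ≈ x ⊎ ⊖ b ≈ x
      factor x²≈t with b ≟ x
      ... | yes b≈x = inj₁ b≈x
      ... | no b≉x = inj₂ (≈-trans (solve 2 (λ b x → :- b := x :- (x :+ b)) ≈-refl b x)
        (≈-trans (⊕-cong ≈-refl (⊖-cong (sum≈0 b≉x x²≈t))) (solve 1 (λ x → x :- con 0ℤ := x) ≈-refl x)))
  ... | nonsquare _ ¬s eq = trans
    (trans (∑-cong 𝔽 (λ x → 𝟙-no (x ⊗ x ≟ t) (λ x²≈t → ¬s (x , x²≈t)))) (∑-0 𝔽))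
    (cong (1ℤ +_) (sym eq))

  ∑-squares : ∀ {h} → Cong h → (∑[ x ← 𝔽 ] h (x ⊗ x)) ≡ (∑[ t ← 𝔽 ] h t * (1ℤ + η′ t))
  ∑-squares {h} h-cong = trans (∑-fibres𝔽 𝔽 (λ x → x ⊗ x) h-cong)
    (∑-cong 𝔽 (λ t → cong (h t *_) (square-roots t)))

  -- Counting the field through the fibres of squaring, of sizes 1 + η(t), gives q = q + ∑ η.
  ∑η : ∑ 𝔽 η′ ≡ 0ℤ
  ∑η = +-cancelˡ N (∑ 𝔽 η′) 0ℤ (trans (sym split) (sym (ℤ.+-identityʳ N)))
    where
    N = ∑[ x ← 𝔽 ] 1ℤ
    split : N ≡ N + ∑ 𝔽 η′
    split = trans (∑-squares {λ _ → 1ℤ} (λ _ → refl))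
      (trans (∑-cong 𝔽 (λ t → ℤ.*-identityˡ (1ℤ + η′ t))) (∑-+ 𝔽 (λ _ → 1ℤ) η′))

  η-⊗-square : ∀ {a} s → ¬ a ≈ 0# → IsSquare F a → η′ (a ⊗ s) ≡ η′ s
  η-⊗-square {a} s a≉0 (b , b²≈a) = η-resp (⊗-integral a≉0)
    (λ s≈0 → ≈-trans (⊗-cong ≈-refl s≈0) (⊗-zeroʳ a)) divide multiply
    where
    b≉0 : ¬ b ≈ 0#
    b≉0 b≈0 = a≉0 (≈-trans (≈-sym b²≈a) (≈-trans (⊗-cong b≈0 ≈-refl) (⊗-zeroˡ b)))
    multiply : IsSquare F s → IsSquare F (a ⊗ s)
    multiply (x , x²≈s) = b ⊗ x ,
      ≈-trans (solve 2 (λ b x → (b :* x) :* (b :* x) := (b :* b) :* (x :* x)) ≈-refl b x)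
        (⊗-cong b²≈a x²≈s)
    divide : IsSquare F (a ⊗ s) → IsSquare F s
    divide (x , x²≈as) with inverse b≉0
    ... | (w , bw≈1) = x ⊗ w , ⊗-cancelˡ a≉0 (≈-trans (⊗-cong (≈-sym b²≈a) ≈-refl)
      (≈-trans (solve 3 (λ b x w → b :* b :* ((x :* w) :* (x :* w)) := (x :* x) :* ((b :* w) :* (b :* w))) ≈-refl b x w)
        (≈-trans (⊗-cong x²≈as (≈-trans (⊗-cong bw≈1 bw≈1) (⊗-identityˡ 1#)))
          (≈-trans (⊗-comm _ 1#) (⊗-identityˡ _)))))

  -- For a non-square a, all terms of ∑ₛ (η(a s) + η(s)) = 0 are ≤ 0, hence 0.
  η-⊗-nonsquare : ∀ {a} s → ¬ a ≈ 0# → ¬ IsSquare F a → η′ (a ⊗ s) ≡ - η′ s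
  η-⊗-nonsquare {a} s a≉0 ¬sq = begin
    η′ (a ⊗ s)                  ≡⟨ rearrange (η′ (a ⊗ s)) (η′ s) ⟩
    - g s - η′ s                ≡⟨ cong (λ t → - t - η′ s) (ℤ.≤-antisym gs≤0 (0≤g s)) ⟩
    - 0ℤ - η′ s                 ≡⟨ ℤ.+-identityˡ _ ⟩
    - η′ s                      ∎
    where
    open ≡-Reasoning
    -- The summand is negated because `∑-member𝔽` bounds a term of a nonnegative sum by the total.
    g : Carrier → ℤ
    g t = - (η′ (a ⊗ t) + η′ t)
    rearrange : ∀ x y → x ≡ - - (x + y) - y
    rearrange = solve-∀
    η-dilate-cong : Cong (λ t → η′ (a ⊗ t))
    η-dilate-cong = λ x≈y → η-cong (⊗-cong ≈-refl x≈y)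
    g-cong : Cong g
    g-cong x≈y = cong -_ (cong₂ _+_ (η-dilate-cong x≈y) (η-cong x≈y))
    nonpos : ∀ {x} → x ≤ 0ℤ → 0ℤ ≤ - x
    nonpos = ℤ.neg-mono-≤
    0≤g : ∀ t → 0ℤ ≤ g t
    0≤g t with residue t
    ... | zero t≈0 eq rewrite eq | η-zero (≈-trans (⊗-cong (≈-refl {a}) t≈0) (⊗-zeroʳ a)) = ℤ.≤-refl
    -- Here t plays the square factor, so η(a t) = η(a) = -1 cancels η(t) = 1.
    ... | square t≉0 sq eq
      rewrite eq | trans (η-cong (⊗-comm a t)) (η-⊗-square a t≉0 sq) | η-nonsquare ¬sq = ℤ.≤-refl
    ... | nonsquare _ _ eq rewrite eq = nonpos (ℤ.+-monoˡ-≤ -1ℤ (η≤1 (a ⊗ t)))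
    ∑g : ∑ 𝔽 g ≡ 0ℤ
    ∑g = begin
      ∑ 𝔽 g                                       ≡⟨ ∑-cong 𝔽 (λ t → sym (ℤ.-1*i≡-i _)) ⟩
      ∑[ t ← 𝔽 ] -1ℤ * (η′ (a ⊗ t) + η′ t)        ≡⟨ ∑-*ˡ 𝔽 -1ℤ _ ⟩
      -1ℤ * (∑[ t ← 𝔽 ] η′ (a ⊗ t) + η′ t)        ≡⟨ cong (-1ℤ *_) (∑-+ 𝔽 _ η′) ⟩
      -1ℤ * ((∑[ t ← 𝔽 ] η′ (a ⊗ t)) + ∑ 𝔽 η′)
        ≡⟨ cong (λ x → -1ℤ * (x + ∑ 𝔽 η′)) (∑-dilate a≉0 η-cong) ⟩
      -1ℤ * (∑ 𝔽 η′ + ∑ 𝔽 η′)                     ≡⟨ cong (λ x → -1ℤ * (x + x)) ∑η ⟩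
      0ℤ                                          ∎
    gs≤0 : g s ≤ 0ℤ
    gs≤0 = ℤ.≤-trans (∑-member𝔽 g-cong 0≤g s) (ℤ.≤-reflexive ∑g)

  η-⊗ : ∀ a s → η′ (a ⊗ s) ≡ η′ a * η′ s
  η-⊗ a s with residue a
  ... | zero a≈0 eq rewrite eq = η-zero (≈-trans (⊗-cong a≈0 ≈-refl) (⊗-zeroˡ s))
  ... | square a≉0 sq eq rewrite eq = trans (η-⊗-square s a≉0 sq) (sym (ℤ.*-identityˡ _))
  ... | nonsquare a≉0 ¬sq eq rewrite eq = trans (η-⊗-nonsquare s a≉0 ¬sq) (sym (ℤ.-1*i≡-i _))

-- Character sums of quadratic polynomials, sums of two squares and the value η(-1)

module CharacterSums {c ℓ₁ ℓ₂} {q : ℕ} (F : FiniteField c ℓ₁ ℓ₂ q) (q-odd : q % 2 ≡ 1) where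

  open Sums
  open QuadraticCharacter F q-odd
  open import Data.Empty using (⊥-elim)
  open import Data.Integer.Base as ℤ
    using (ℤ; 0ℤ; 1ℤ; -1ℤ; _+_; _*_; -_; _-_)
  import Data.Integer.Properties as ℤ
  open import Data.Integer.Tactic.RingSolver using (solve-∀)
  open import Data.Nat.Base as ℕ using ()
  open import Data.Nat.DivMod using (%-distribˡ-+; m*n%n≡0)
  open import Function.Base using (_∘_)
  open import Relation.Binary.PropositionalEquality.Core
    using (_≢_; refl; sym; trans; cong; cong₂)
  open import Relation.Binary.PropositionalEquality.Properties using (module ≡-Reasoning)
  open import Relation.Nullary.Negation using (¬_)
  open ≡-Reasoning

  qℤ : ℤ
  qℤ = ℤ.+ q

  *-cancel : ∀ {i} → i ≢ 0ℤ → ∀ {j k} → i * j ≡ i * k → j ≡ k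
  *-cancel {i} i≢0 = ℤ.*-cancelˡ-≡ i _ _ {{ℤ.≢-nonZero i≢0}}

  q≢0 : qℤ ≢ 0ℤ
  q≢0 eq with () ← trans (sym q-odd) (cong (_% 2) (ℤ.+-injective eq))

  𝟙≈-sym : ∀ x y → 𝟙 (x ≟ y) ≡ 𝟙 (y ≟ x)
  𝟙≈-sym x y = 𝟙-cong (x ≟ y) (y ≟ x) ≈-sym ≈-sym

  ∑-translateˡ : ∀ a {h} → Cong h → (∑[ x ← 𝔽 ] h (a ⊕ x)) ≡ (∑[ x ← 𝔽 ] h x)
  ∑-translateˡ a h-cong = trans (∑-cong 𝔽 (λ x → h-cong (solve 2 (λ a x → a :+ x := x :+ a) ≈-refl a x)))
    (∑-translate a h-cong)

  autocorrelation : Carrier → ℤ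
  autocorrelation a = ∑[ t ← 𝔽 ] η′ t * η′ (t ⊕ a)

  ∑-1-𝟙 : ∀ a → (∑[ t ← 𝔽 ] 1ℤ - 𝟙 (a ≟ t)) ≡ qℤ - 1ℤ
  ∑-1-𝟙 a = begin
    ∑[ t ← 𝔽 ] 1ℤ - 𝟙 (a ≟ t)                    ≡⟨ ∑-+ 𝔽 _ _ ⟩
    (∑[ t ← 𝔽 ] 1ℤ) + (∑[ t ← 𝔽 ] - 𝟙 (a ≟ t))
      ≡⟨ cong₂ _+_ (∑𝔽-const 1ℤ) (trans (∑-cong 𝔽 (λ t → sym (ℤ.-1*i≡-i _))) (∑-*ˡ 𝔽 -1ℤ _)) ⟩
    qℤ * 1ℤ + -1ℤ * (∑[ t ← 𝔽 ] 𝟙 (a ≟ t))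
      ≡⟨ cong₂ _+_ (ℤ.*-identityʳ qℤ) (cong (-1ℤ *_) (once𝔽 a)) ⟩
    qℤ - 1ℤ                                      ∎

  autocorrelation-zero : ∀ {a} → a ≈ 0# → autocorrelation a ≡ qℤ - 1ℤ
  autocorrelation-zero {a} a≈0 = trans (∑-cong 𝔽 (λ t → begin
    η′ t * η′ (t ⊕ a)
      ≡⟨ cong (η′ t *_) (η-cong (≈-trans (⊕-cong ≈-refl a≈0) (solve 1 (λ t → t :+ con 0ℤ := t) ≈-refl t))) ⟩
    η′ t * η′ t       ≡⟨ η² t ⟩
    1ℤ - 𝟙 (t ≟ 0#)   ≡⟨ cong (λ i → 1ℤ - i) (𝟙≈-sym t 0#) ⟩
    1ℤ - 𝟙 (0# ≟ t)   ∎)) (∑-1-𝟙 0#)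

  -- Substituting a t for t pulls the factor η(a)² = 1 out of every term.
  autocorrelation-scale : ∀ {a} → ¬ a ≈ 0# → autocorrelation a ≡ autocorrelation 1#
  autocorrelation-scale {a} a≉0 = trans
    (sym (∑-dilate a≉0 (λ x≈y → cong₂ _*_ (η-cong x≈y) (η-cong (⊕-cong x≈y ≈-refl)))))
    (∑-cong 𝔽 (λ t → begin
      η′ (a ⊗ t) * η′ (a ⊗ t ⊕ a)
        ≡⟨ cong (η′ (a ⊗ t) *_) (η-cong (solve 2 (λ a t → a :* t :+ a := a :* (t :+ con 1ℤ)) ≈-refl a t)) ⟩
      η′ (a ⊗ t) * η′ (a ⊗ (t ⊕ 1#))     ≡⟨ cong₂ _*_ (η-⊗ a t) (η-⊗ a (t ⊕ 1#)) ⟩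
      η′ a * η′ t * (η′ a * η′ (t ⊕ 1#)) ≡⟨ shuffle (η′ a) _ _ ⟩
      η′ a * η′ a * (η′ t * η′ (t ⊕ 1#)) ≡⟨ cong (_* (η′ t * η′ (t ⊕ 1#))) (η²≡1 a≉0) ⟩
      1ℤ * (η′ t * η′ (t ⊕ 1#))          ≡⟨ ℤ.*-identityˡ _ ⟩
      η′ t * η′ (t ⊕ 1#)                 ∎))
    where
    shuffle : ∀ x y z → x * y * (x * z) ≡ x * x * (y * z)
    shuffle = solve-∀

  autocorrelation-𝟙 : ∀ a → autocorrelation a ≡
    autocorrelation 1# + (qℤ - 1ℤ - autocorrelation 1#) * 𝟙 (0# ≟ a)
  autocorrelation-𝟙 a = 𝟙-interpolate (0# ≟ a)
    (autocorrelation-zero ∘ ≈-sym) (λ 0≉a → autocorrelation-scale (0≉a ∘ ≈-sym))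

  -- ∑ₐ autocorrelation a = (∑ η)² = 0 while all values at a ≠ 0 agree.
  autocorrelation-1 : autocorrelation 1# ≡ -1ℤ
  autocorrelation-1 = *-cancel q-1≢0 (begin
    (qℤ - 1ℤ) * S                       ≡⟨ expand qℤ S ⟩
    qℤ * S + (qℤ - 1ℤ - S) * 1ℤ - (qℤ - 1ℤ)
      ≡⟨ cong (λ i → i - (qℤ - 1ℤ)) (trans (sym by-values) by-swapping) ⟩
    0ℤ - (qℤ - 1ℤ)                      ≡⟨ final qℤ ⟩
    (qℤ - 1ℤ) * -1ℤ                     ∎)
    where
    S = autocorrelation 1#
    expand : ∀ x s → (x - 1ℤ) * s ≡ x * s + (x - 1ℤ - s) * 1ℤ - (x - 1ℤ)
    expand = solve-∀
    final : ∀ x → 0ℤ - (x - 1ℤ) ≡ (x - 1ℤ) * -1ℤ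
    final = solve-∀
    by-values : (∑[ a ← 𝔽 ] autocorrelation a) ≡ qℤ * S + (qℤ - 1ℤ - S) * 1ℤ
    by-values = begin
      ∑[ a ← 𝔽 ] autocorrelation a                         ≡⟨ ∑-cong 𝔽 autocorrelation-𝟙 ⟩
      ∑[ a ← 𝔽 ] S + (qℤ - 1ℤ - S) * 𝟙 (0# ≟ a)            ≡⟨ ∑-+ 𝔽 _ _ ⟩
      (∑[ a ← 𝔽 ] S) + (∑[ a ← 𝔽 ] (qℤ - 1ℤ - S) * 𝟙 (0# ≟ a))
        ≡⟨ cong₂ _+_ (∑𝔽-const S) (∑-*ˡ 𝔽 (qℤ - 1ℤ - S) _) ⟩
      qℤ * S + (qℤ - 1ℤ - S) * (∑[ a ← 𝔽 ] 𝟙 (0# ≟ a))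
        ≡⟨ cong (λ i → qℤ * S + (qℤ - 1ℤ - S) * i) (once𝔽 0#) ⟩
      qℤ * S + (qℤ - 1ℤ - S) * 1ℤ                          ∎
    by-swapping : (∑[ a ← 𝔽 ] autocorrelation a) ≡ 0ℤ
    by-swapping = begin
      ∑[ a ← 𝔽 ] ∑[ t ← 𝔽 ] η′ t * η′ (t ⊕ a)       ≡⟨ ∑-comm 𝔽 𝔽 _ ⟩
      ∑[ t ← 𝔽 ] ∑[ a ← 𝔽 ] η′ t * η′ (t ⊕ a)       ≡⟨ ∑-cong 𝔽 (λ t → ∑-*ˡ 𝔽 (η′ t) _) ⟩
      ∑[ t ← 𝔽 ] η′ t * (∑[ a ← 𝔽 ] η′ (t ⊕ a))
        ≡⟨ ∑-cong 𝔽 (λ t → trans (cong (η′ t *_) (trans (∑-translateˡ t η-cong) ∑η)) (ℤ.*-zeroʳ (η′ t))) ⟩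
      ∑[ t ← 𝔽 ] 0ℤ                                 ≡⟨ ∑-0 𝔽 ⟩
      0ℤ                                            ∎

  ∑ηη : ∀ a → (∑[ t ← 𝔽 ] η′ t * η′ (t ⊕ a)) ≡ qℤ * 𝟙 (0# ≟ a) - 1ℤ
  ∑ηη a = begin
    autocorrelation a                           ≡⟨ autocorrelation-𝟙 a ⟩
    S + (qℤ - 1ℤ - S) * 𝟙 (0# ≟ a)
      ≡⟨ cong (λ s → s + (qℤ - 1ℤ - s) * 𝟙 (0# ≟ a)) autocorrelation-1 ⟩
    -1ℤ + (qℤ - 1ℤ - -1ℤ) * 𝟙 (0# ≟ a)          ≡⟨ lemma qℤ (𝟙 (0# ≟ a)) ⟩
    qℤ * 𝟙 (0# ≟ a) - 1ℤ                        ∎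
    where
    S = autocorrelation 1#
    lemma : ∀ x i → -1ℤ + (x - 1ℤ - -1ℤ) * i ≡ x * i - 1ℤ
    lemma = solve-∀

  -- Replacing x² by t with weight 1 + η(t) leaves a translate of ∑ η, which is 0, and an
  -- autocorrelation.
  ∑η-square+ : ∀ a → (∑[ x ← 𝔽 ] η′ (x ⊗ x ⊕ a)) ≡ qℤ * 𝟙 (0# ≟ a) - 1ℤ
  ∑η-square+ a = begin
    ∑[ x ← 𝔽 ] η′ (x ⊗ x ⊕ a)                   ≡⟨ ∑-squares (λ x≈y → η-cong (⊕-cong x≈y ≈-refl)) ⟩
    ∑[ t ← 𝔽 ] η′ (t ⊕ a) * (1ℤ + η′ t)         ≡⟨ ∑-cong 𝔽 (λ t → expand (η′ (t ⊕ a)) (η′ t)) ⟩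
    ∑[ t ← 𝔽 ] η′ (t ⊕ a) + η′ t * η′ (t ⊕ a)   ≡⟨ ∑-+ 𝔽 _ _ ⟩
    (∑[ t ← 𝔽 ] η′ (t ⊕ a)) + autocorrelation a ≡⟨ cong₂ _+_ (trans (∑-translate a η-cong) ∑η) (∑ηη a) ⟩
    0ℤ + (qℤ * 𝟙 (0# ≟ a) - 1ℤ)                 ≡⟨ ℤ.+-identityˡ _ ⟩
    qℤ * 𝟙 (0# ≟ a) - 1ℤ                        ∎
    where
    expand : ∀ x y → x * (1ℤ + y) ≡ x + y * x
    expand = solve-∀

  -- Multiplying the polynomial a x² + 2 b x + e by a completes the square to (a x + b)² + (a e -
  -- b²), at the cost of a factor η(a). The indicator detects a vanishing discriminant. The order of
  -- the terms is the one in which `Q-line` expands Q along a line.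
  ∑η-quadratic : ∀ {a} b e → ¬ a ≈ 0# →
    (∑[ x ← 𝔽 ] η′ (e ⊕ (x ⊗ (b ⊕ b) ⊕ x ⊗ x ⊗ a))) ≡ η′ a * (qℤ * 𝟙 (b ⊗ b ≟ a ⊗ e) - 1ℤ)
  ∑η-quadratic {a} b e a≉0 = begin
    ∑[ x ← 𝔽 ] η′ (p x)
      ≡⟨ ∑-cong 𝔽 (λ x → sym (trans (sym (ℤ.*-assoc (η′ a) _ _)) (trans (cong (_* η′ (p x)) (η²≡1 a≉0)) (ℤ.*-identityˡ _)))) ⟩
    ∑[ x ← 𝔽 ] η′ a * (η′ a * η′ (p x))          ≡⟨ ∑-*ˡ 𝔽 (η′ a) _ ⟩
    η′ a * (∑[ x ← 𝔽 ] η′ a * η′ (p x))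
      ≡⟨ cong (η′ a *_) (∑-cong 𝔽 (λ x → trans (sym (η-⊗ a (p x))) (η-cong (complete-square x)))) ⟩
    η′ a * (∑[ x ← 𝔽 ] g (a ⊗ x))                ≡⟨ cong (η′ a *_) (∑-dilate a≉0 g-cong) ⟩
    η′ a * ∑ 𝔽 g
      ≡⟨ cong (η′ a *_) (∑-translate b {λ x → η′ (x ⊗ x ⊕ d)} (λ x≈y → η-cong (⊕-cong (⊗-cong x≈y x≈y) ≈-refl))) ⟩
    η′ a * (∑[ x ← 𝔽 ] η′ (x ⊗ x ⊕ d))           ≡⟨ cong (η′ a *_) (∑η-square+ d) ⟩
    η′ a * (qℤ * 𝟙 (0# ≟ d) - 1ℤ)
      ≡⟨ cong (λ i → η′ a * (qℤ * i - 1ℤ)) (𝟙-cong (0# ≟ d) (b ⊗ b ≟ a ⊗ e) (≈-sym ∘ ⊝-zero ∘ ≈-sym) (≈-sym ∘ ⊝-self ∘ ≈-sym)) ⟩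
    η′ a * (qℤ * 𝟙 (b ⊗ b ≟ a ⊗ e) - 1ℤ)         ∎
    where
    p : Carrier → Carrier
    p x = e ⊕ (x ⊗ (b ⊕ b) ⊕ x ⊗ x ⊗ a)
    d = a ⊗ e ⊝ b ⊗ b
    g : Carrier → ℤ
    g x = η′ ((x ⊕ b) ⊗ (x ⊕ b) ⊕ d)
    g-cong : Cong g
    g-cong x≈y = η-cong (⊕-cong (⊗-cong (⊕-cong x≈y ≈-refl) (⊕-cong x≈y ≈-refl)) ≈-refl)
    complete-square : ∀ x → a ⊗ p x ≈ (a ⊗ x ⊕ b) ⊗ (a ⊗ x ⊕ b) ⊕ d
    complete-square x = solve 4 (λ a b e x →
      a :* (e :+ (x :* (b :+ b) :+ x :* x :* a)) :=
      (a :* x :+ b) :* (a :* x :+ b) :+ (a :* e :- b :* b)) ≈-refl a b e x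

  κ : ℤ
  κ = η′ (⊖ 1#)

  -1≉0 : ¬ ⊖ 1# ≈ 0#
  -1≉0 eq = 1≉0 (≈-trans (solve 0 (con 1ℤ := :- (:- con 1ℤ)) ≈-refl)
    (≈-trans (⊖-cong eq) (solve 0 (:- con 0ℤ := con 0ℤ) ≈-refl)))

  η-⊖ : ∀ a → η′ (⊖ a) ≡ κ * η′ a
  η-⊖ a = trans (η-cong (solve 1 (λ a → :- a := (:- con 1ℤ) :* a) ≈-refl a)) (η-⊗ (⊖ 1#) a)

  κ²≡1 : κ * κ ≡ 1ℤ
  κ²≡1 = trans (sym (η-⊗ (⊖ 1#) (⊖ 1#)))
    (trans (η-cong (solve 0 ((:- con 1ℤ) :* (:- con 1ℤ) := con 1ℤ) ≈-refl)) η1)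

  ∑η-minus-square : ∀ a → (∑[ x ← 𝔽 ] η′ (a ⊝ x ⊗ x)) ≡ κ * (qℤ * 𝟙 (0# ≟ a) - 1ℤ)
  ∑η-minus-square a = begin
    ∑[ x ← 𝔽 ] η′ (a ⊝ x ⊗ x)
      ≡⟨ ∑-cong 𝔽 (λ x → trans (η-cong (solve 2 (λ a x → a :- x :* x := :- (x :* x :+ (:- a))) ≈-refl a x)) (η-⊖ _)) ⟩
    ∑[ x ← 𝔽 ] κ * η′ (x ⊗ x ⊕ ⊖ a) ≡⟨ ∑-*ˡ 𝔽 κ _ ⟩
    κ * (∑[ x ← 𝔽 ] η′ (x ⊗ x ⊕ ⊖ a)) ≡⟨ cong (κ *_) (∑η-square+ (⊖ a)) ⟩
    κ * (qℤ * 𝟙 (0# ≟ ⊖ a) - 1ℤ)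
      ≡⟨ cong (λ i → κ * (qℤ * i - 1ℤ)) (𝟙-cong (0# ≟ ⊖ a) (0# ≟ a) flip flip′) ⟩
    κ * (qℤ * 𝟙 (0# ≟ a) - 1ℤ)      ∎
    where
    flip : 0# ≈ ⊖ a → 0# ≈ a
    flip 0≈-a = ≈-trans (solve 0 (con 0ℤ := :- con 0ℤ) ≈-refl)
      (≈-trans (⊖-cong 0≈-a) (solve 1 (λ a → :- (:- a) := a) ≈-refl a))
    flip′ : 0# ≈ a → 0# ≈ ⊖ a
    flip′ 0≈a = ≈-trans (solve 0 (con 0ℤ := :- con 0ℤ) ≈-refl) (⊖-cong 0≈a)

  -- For fixed x, y² is replaced by t with weight 1 + η(t), and t is then shifted by x². Summing the
  -- weights over x shows that t is a sum of two squares in q - κ + κ q 𝟙(t = 0) ways.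
  ∑-two-squares : ∀ {h} → Cong h →
    (∑[ x ← 𝔽 ] ∑[ y ← 𝔽 ] h (x ⊗ x ⊕ y ⊗ y)) ≡ (qℤ - κ) * ∑ 𝔽 h + κ * qℤ * h 0#
  ∑-two-squares {h} h-cong = begin
    ∑[ x ← 𝔽 ] ∑[ y ← 𝔽 ] h (x ⊗ x ⊕ y ⊗ y)
      ≡⟨ ∑-cong 𝔽 (λ x → ∑-squares (λ eq → h-cong (⊕-cong ≈-refl eq))) ⟩
    ∑[ x ← 𝔽 ] ∑[ t ← 𝔽 ] h (x ⊗ x ⊕ t) * (1ℤ + η′ t)
      ≡⟨ ∑-cong 𝔽 (λ x → sym (shift x)) ⟩
    ∑[ x ← 𝔽 ] ∑[ t ← 𝔽 ] h t * (1ℤ + η′ (t ⊝ x ⊗ x))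
      ≡⟨ ∑-comm 𝔽 𝔽 _ ⟩
    ∑[ t ← 𝔽 ] ∑[ x ← 𝔽 ] h t * (1ℤ + η′ (t ⊝ x ⊗ x))
      ≡⟨ ∑-cong 𝔽 (λ t → trans (∑-*ˡ 𝔽 (h t) _) (cong (h t *_) (count t))) ⟩
    ∑[ t ← 𝔽 ] h t * (qℤ * 1ℤ + κ * (qℤ * 𝟙 (0# ≟ t) - 1ℤ))
      ≡⟨ ∑-cong 𝔽 (λ t → expand (h t) qℤ κ (𝟙 (0# ≟ t))) ⟩
    ∑[ t ← 𝔽 ] (qℤ - κ) * h t + κ * qℤ * (h t * 𝟙 (0# ≟ t))
      ≡⟨ ∑-+ 𝔽 _ _ ⟩
    (∑[ t ← 𝔽 ] (qℤ - κ) * h t) + (∑[ t ← 𝔽 ] κ * qℤ * (h t * 𝟙 (0# ≟ t)))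
      ≡⟨ cong₂ _+_ (∑-*ˡ 𝔽 (qℤ - κ) h) (trans (∑-*ˡ 𝔽 (κ * qℤ) _) (cong (κ * qℤ *_) (pick𝔽 h-cong 0#))) ⟩
    (qℤ - κ) * ∑ 𝔽 h + κ * qℤ * h 0# ∎
    where
    expand : ∀ h q k i → h * (q * 1ℤ + k * (q * i - 1ℤ)) ≡ (q - k) * h + k * q * (h * i)
    expand = solve-∀
    shift : ∀ x → (∑[ t ← 𝔽 ] h t * (1ℤ + η′ (t ⊝ x ⊗ x))) ≡ (∑[ t ← 𝔽 ] h (x ⊗ x ⊕ t) * (1ℤ + η′ t))
    shift x = trans
      (sym (∑-translateˡ (x ⊗ x) (λ eq → cong₂ _*_ (h-cong eq) (cong (1ℤ +_) (η-cong (⊕-cong eq ≈-refl))))))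
      (∑-cong 𝔽 (λ t → cong (λ i → h (x ⊗ x ⊕ t) * (1ℤ + i))
        (η-cong (solve 2 (λ x t → x :+ t :- x := t) ≈-refl (x ⊗ x) t))))
    count : ∀ t → (∑[ x ← 𝔽 ] 1ℤ + η′ (t ⊝ x ⊗ x)) ≡ qℤ * 1ℤ + κ * (qℤ * 𝟙 (0# ≟ t) - 1ℤ)
    count t = trans (∑-+ 𝔽 _ _) (cong₂ _+_ (∑𝔽-const 1ℤ) (∑η-minus-square t))

  -- The number of t for which t and 1 - t are both nonzero squares; it supplies the quotient in a
  -- division by 4.
  adjacent-residues : ℤ
  adjacent-residues = ∑[ t ← 𝔽 ] 𝟙 (η′ t ℤ.≟ 1ℤ) * 𝟙 (η′ (1# ⊝ t) ℤ.≟ 1ℤ)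

  -- Evaluating ∑ₜ (1 + η t)(1 + η (1 - t)) termwise modulo 4, where every
  -- term other than t = 0, 1 is 0 or 4, determines q - η(-1) modulo 4.
  q-κ-mod-4 : qℤ - κ ≡ adjacent-residues * ℤ.+ 4 + ℤ.+ 4
  q-κ-mod-4 = trans (sym by-sums) by-values
    where
    z : Carrier → ℤ
    z t = 𝟙 (0# ≟ t)
    z′ : Carrier → ℤ
    z′ t = 𝟙 (1# ≟ t)
    u : Carrier → ℤ
    u t = 𝟙 (η′ t ℤ.≟ 1ℤ)
    u-cong : Cong u
    u-cong x≈y = cong (λ i → 𝟙 (i ℤ.≟ 1ℤ)) (η-cong x≈y)
    term : ∀ t → 1ℤ + η′ t ≡ ℤ.+ 2 * u t + z t
    term t with residue t
    ... | zero t≈0 eq rewrite eq | 𝟙-yes (0# ≟ t) (≈-sym t≈0) = refl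
    ... | square t≉0 _ eq rewrite eq | 𝟙-no (0# ≟ t) (t≉0 ∘ ≈-sym) = refl
    ... | nonsquare t≉0 _ eq rewrite eq | 𝟙-no (0# ≟ t) (t≉0 ∘ ≈-sym) = refl
    term′ : ∀ t → 1ℤ + η′ (1# ⊝ t) ≡ ℤ.+ 2 * u (1# ⊝ t) + z′ t
    term′ t = trans (term (1# ⊝ t)) (cong (λ i → ℤ.+ 2 * u (1# ⊝ t) + i)
      (𝟙-cong (0# ≟ 1# ⊝ t) (1# ≟ t) (⊝-zero ∘ ≈-sym) (≈-sym ∘ ⊝-self)))
    T : ℤ
    T = ∑[ t ← 𝔽 ] (1ℤ + η′ t) * (1ℤ + η′ (1# ⊝ t))
    by-values : T ≡ adjacent-residues * ℤ.+ 4 + ℤ.+ 4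
    by-values = begin
      T
        ≡⟨ ∑-cong 𝔽 (λ t → trans (cong₂ _*_ (term t) (term′ t)) (expand (u t) (u (1# ⊝ t)) (z t) (z′ t))) ⟩
      ∑[ t ← 𝔽 ] u t * u (1# ⊝ t) * ℤ.+ 4 + (ℤ.+ 2 * u t * z′ t + (ℤ.+ 2 * u (1# ⊝ t) + z′ t) * z t)
        ≡⟨ trans (∑-+ 𝔽 _ _) (cong₂ _+_ (∑-*ʳ 𝔽 (ℤ.+ 4) _) (∑-+ 𝔽 _ _)) ⟩
      adjacent-residues * ℤ.+ 4 + ((∑[ t ← 𝔽 ] ℤ.+ 2 * u t * z′ t) + (∑[ t ← 𝔽 ] (ℤ.+ 2 * u (1# ⊝ t) + z′ t) * z t))
        ≡⟨ cong (adjacent-residues * ℤ.+ 4 +_) (cong₂ _+_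
            (pick𝔽 (λ x≈y → cong (ℤ.+ 2 *_) (u-cong x≈y)) 1#)
            (pick𝔽 (λ x≈y → cong₂ (λ i j → ℤ.+ 2 * i + j)
              (u-cong (⊕-cong ≈-refl (⊖-cong x≈y))) (𝟙≈-cong ≈-refl x≈y)) 0#)) ⟩
      adjacent-residues * ℤ.+ 4 + (ℤ.+ 2 * u 1# + (ℤ.+ 2 * u (1# ⊝ 0#) + z′ 0#))
        ≡⟨ cong (adjacent-residues * ℤ.+ 4 +_) (cong₂ (λ i j → ℤ.+ 2 * i + j) u1
            (cong₂ (λ i j → ℤ.+ 2 * i + j) (trans (u-cong (solve 0 (con 1ℤ :- con 0ℤ := con 1ℤ) ≈-refl)) u1)
              (𝟙-no (1# ≟ 0#) 1≉0))) ⟩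
      adjacent-residues * ℤ.+ 4 + ℤ.+ 4 ∎
      where
      u1 : u 1# ≡ 1ℤ
      u1 = cong (λ i → 𝟙 (i ℤ.≟ 1ℤ)) η1
      expand : ∀ u u′ z z′ → (ℤ.+ 2 * u + z) * (ℤ.+ 2 * u′ + z′) ≡
        u * u′ * ℤ.+ 4 + (ℤ.+ 2 * u * z′ + (ℤ.+ 2 * u′ + z′) * z)
      expand = solve-∀
    by-sums : T ≡ qℤ - κ
    by-sums = begin
      T
        ≡⟨ ∑-cong 𝔽 (λ t → trans (expand (η′ t) (η′ (1# ⊝ t))) (cong (λ i → 1ℤ + η′ t + (η′ (1# ⊝ t) + i)) (swap t))) ⟩
      ∑[ t ← 𝔽 ] 1ℤ + η′ t + (η′ (1# ⊝ t) + κ * (η′ t * η′ (t ⊕ ⊖ 1#)))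
        ≡⟨ trans (∑-+ 𝔽 _ _) (cong₂ _+_ (∑-+ 𝔽 _ _) (∑-+ 𝔽 _ _)) ⟩
      (∑[ t ← 𝔽 ] 1ℤ) + ∑ 𝔽 η′ + ((∑[ t ← 𝔽 ] η′ (1# ⊝ t)) + (∑[ t ← 𝔽 ] κ * (η′ t * η′ (t ⊕ ⊖ 1#))))
        ≡⟨ cong₂ _+_ (cong₂ _+_ (∑𝔽-const 1ℤ) ∑η) (cong₂ _+_ ∑η-reflect
            (trans (∑-*ˡ 𝔽 κ _) (cong (κ *_) (trans (∑ηη (⊖ 1#)) (cong (λ i → qℤ * i - 1ℤ) (𝟙-no (0# ≟ ⊖ 1#) (-1≉0 ∘ ≈-sym))))))) ⟩
      qℤ * 1ℤ + 0ℤ + (0ℤ + κ * (qℤ * 0ℤ - 1ℤ)) ≡⟨ tidy qℤ κ ⟩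
      qℤ - κ ∎
      where
      expand : ∀ x y → (1ℤ + x) * (1ℤ + y) ≡ 1ℤ + x + (y + x * y)
      expand = solve-∀
      tidy : ∀ q k → q * 1ℤ + 0ℤ + (0ℤ + k * (q * 0ℤ - 1ℤ)) ≡ q - k
      tidy = solve-∀
      reflect : ∀ t → η′ (1# ⊝ t) ≡ κ * η′ (t ⊕ ⊖ 1#)
      reflect t = trans (η-cong (solve 1 (λ t → con 1ℤ :- t := :- (t :+ (:- con 1ℤ))) ≈-refl t)) (η-⊖ _)
      -- Writing 1 - t as -(t - 1) turns the product term into κ times the autocorrelation at -1,
      -- which is -1 since -1 ≠ 0. This is how η(-1) enters the count.
      swap : ∀ t → η′ t * η′ (1# ⊝ t) ≡ κ * (η′ t * η′ (t ⊕ ⊖ 1#))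
      swap t = trans (cong (η′ t *_) (reflect t)) (shuffle (η′ t) κ _)
        where
        shuffle : ∀ x k y → x * (k * y) ≡ k * (x * y)
        shuffle = solve-∀
      ∑η-reflect : (∑[ t ← 𝔽 ] η′ (1# ⊝ t)) ≡ 0ℤ
      ∑η-reflect = trans (∑-cong 𝔽 reflect) (trans (∑-*ˡ 𝔽 κ _)
        (trans (cong (κ *_) (trans (∑-translate (⊖ 1#) η-cong) ∑η)) (ℤ.*-zeroʳ κ)))

  residue-mod-4 : ∀ k {i : ℤ} → ℤ.+ (q ℕ.+ k) ≡ i * ℤ.+ 4 → (q % 4 ℕ.+ k % 4) % 4 ≡ 0
  residue-mod-4 k {i} eq = trans (sym (%-distribˡ-+ q k 4))
    (trans (cong (_% 4) (trans (cong ℤ.∣_∣ eq) (ℤ.abs-* i (ℤ.+ 4)))) (m*n%n≡0 ℤ.∣ i ∣ 4))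

  private
    2≢0 : 2 ≢ 0
    2≢0 ()
    regroup : ∀ i → i + ℤ.+ 3 ≡ i - 1ℤ + ℤ.+ 4
    regroup = solve-∀
    collect₁ : ∀ i → i * ℤ.+ 4 + ℤ.+ 4 ≡ (i + 1ℤ) * ℤ.+ 4
    collect₁ = solve-∀
    collect₂ : ∀ i → i * ℤ.+ 4 + ℤ.+ 4 + ℤ.+ 4 ≡ (i + ℤ.+ 2) * ℤ.+ 4
    collect₂ = solve-∀

  -- In the excluded case q + 1, resp. q + 3, is divisible by 4; adding keeps
  -- the reduction modulo 4 within ℕ.
  κ≡1 : q % 4 ≡ 1 → κ ≡ 1ℤ
  κ≡1 q≡1 with residue (⊖ 1#)
  ... | square _ _ eq = eq
  ... | zero -1≈0 _ = ⊥-elim (-1≉0 -1≈0)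
  ... | nonsquare _ _ eq = ⊥-elim (2≢0 (trans (sym (cong (λ r → (r ℕ.+ 1) % 4) q≡1))
    (residue-mod-4 1 {adjacent-residues + 1ℤ}
      (trans (cong (λ i → qℤ - i) (sym eq)) (trans q-κ-mod-4 (collect₁ adjacent-residues))))))

  κ≡-1 : q % 4 ≡ 3 → κ ≡ -1ℤ
  κ≡-1 q≡3 with residue (⊖ 1#)
  ... | nonsquare _ _ eq = eq
  ... | zero -1≈0 _ = ⊥-elim (-1≉0 -1≈0)
  ... | square _ _ eq = ⊥-elim (2≢0 (trans (sym (cong (λ r → (r ℕ.+ 3) % 4) q≡3))
    (residue-mod-4 3 {adjacent-residues + ℤ.+ 2}
      (trans (regroup qℤ) (trans (cong (λ i → qℤ - i + ℤ.+ 4) (sym eq))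
        (trans (cong (_+ ℤ.+ 4) q-κ-mod-4) (collect₂ adjacent-residues)))))))

-- Vectors, the dot product and the distribution of values of Q in even dimension

module QuadraticSpace {c ℓ₁ ℓ₂} {q : ℕ} (F : FiniteField c ℓ₁ ℓ₂ q) (q-odd : q % 2 ≡ 1) where

  open Sums
  open QuadraticCharacter F q-odd
  open CharacterSums F q-odd
  open import Algebra.Properties.Semiring.Sum (FiniteField.semiring F) using (sum; sum-cong-≋)
  open import Data.Empty using (⊥-elim)
  open import Data.Fin.Base using (zero; suc)
  import Data.Fin.Properties as Fin
  open import Data.Integer.Base as ℤ
    using (ℤ; 0ℤ; 1ℤ; _+_; _*_; -_; _-_; _^_)
  import Data.Integer.Properties as ℤ
  open import Data.Integer.Tactic.RingSolver using (solve-∀)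
  open import Data.List.Base as List using (List; cartesianProductWith)
  open import Data.Nat.Base as ℕ using (zero; suc)
  open import Data.Product.Base using (∃; _,_)
  open import Data.Vec.Functional using (Vector; []; _∷_; head; tail)
  import Data.Vec.Functional.Relation.Binary.Equality.Setoid as Vector≋
  open import Function.Base using (_∘_)
  open import Relation.Binary.PropositionalEquality.Core
    using (refl; sym; trans; cong; cong₂)
  open import Relation.Binary.PropositionalEquality.Properties using (module ≡-Reasoning)
  open import Relation.Nullary.Decidable using (Dec; yes; no; _×-dec_)
  open import Relation.Nullary.Negation using (¬_)
  open ≡-Reasoning

  open Vector≋ setoid public using (_≋_; ≋-refl; ≋-sym; ≋-trans; ≋-setoid)

  V : ℕ → Set c
  V d = Vector Carrier d

  opaque
    vector-finite : ∀ d → Finite (≋-setoid d)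
    vector-finite d = record { _≟_ = dec ; elements = vectors d ; once = once d }
      where
      dec : ∀ {d} (x y : V d) → Dec (x ≋ y)
      dec x y = Fin.all? (λ i → x i ≟ y i)
      vectors : ∀ d → List (V d)
      vectors zero = [] List.∷ List.[]
      vectors (suc d) = cartesianProductWith _∷_ 𝔽 (vectors d)
      once : ∀ d x → (∑[ y ← vectors d ] 𝟙 (dec x y)) ≡ 1ℤ
      once zero x = refl
      once (suc d) x = begin
        ∑[ y ← vectors (suc d) ] 𝟙 (dec x y)
          ≡⟨ ∑-cartesianProductWith _∷_ 𝔽 (vectors d) _ ⟩
        ∑[ a ← 𝔽 ] ∑[ y ← vectors d ] 𝟙 (dec x (a ∷ y))
          ≡⟨ ∑-cong 𝔽 (λ a → ∑-cong (vectors d) (split a)) ⟩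
        ∑[ a ← 𝔽 ] ∑[ y ← vectors d ] 𝟙 (head x ≟ a) * 𝟙 (dec (tail x) y)
          ≡⟨ ∑-cong 𝔽 (λ a → ∑-*ˡ (vectors d) (𝟙 (head x ≟ a)) _) ⟩
        ∑[ a ← 𝔽 ] 𝟙 (head x ≟ a) * (∑[ y ← vectors d ] 𝟙 (dec (tail x) y))
          ≡⟨ ∑-cong 𝔽 (λ a → trans (cong (𝟙 (head x ≟ a) *_) (once d (tail x))) (ℤ.*-identityʳ _)) ⟩
        ∑[ a ← 𝔽 ] 𝟙 (head x ≟ a)
          ≡⟨ once𝔽 (head x) ⟩
        1ℤ ∎
        where
        split : ∀ a y → 𝟙 (dec x (a ∷ y)) ≡ 𝟙 (head x ≟ a) * 𝟙 (dec (tail x) y)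
        split a y = trans
          (𝟙-cong (dec x (a ∷ y)) ((head x ≟ a) ×-dec dec (tail x) y)
            (λ eq → eq zero , eq ∘ suc)
            (λ where (eq , eq′) zero → eq
                     (eq , eq′) (suc i) → eq′ i))
          (𝟙-× (head x ≟ a) (dec (tail x) y))

    -- The recursion on the first coordinate is recorded inside the opaque block because `𝕍` does
    -- not reduce outside it.
    ∑-vectors-suc : ∀ d (h : V (suc d) → ℤ) → ∑ (Finite.elements (vector-finite (suc d))) h ≡
      (∑[ a ← 𝔽 ] ∑[ y ← Finite.elements (vector-finite d) ] h (a ∷ y))
    ∑-vectors-suc d h = ∑-cartesianProductWith _∷_ 𝔽 (Finite.elements (vector-finite d)) h

    ∑-vectors-zero : (h : V 0 → ℤ) → ∑ (Finite.elements (vector-finite 0)) h ≡ h []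
    ∑-vectors-zero h = ℤ.+-identityʳ (h [])

  𝕍 : ∀ {d} → List (V d)
  𝕍 {d} = Finite.elements (vector-finite d)

  infix 4 _≋?_
  _≋?_ : ∀ {d} (x y : V d) → Dec (x ≋ y)
  _≋?_ {d} = Finite._≟_ (vector-finite d)

  ∑𝕍-const : ∀ d i → (∑[ x ← 𝕍 {d} ] i) ≡ qℤ ^ d * i
  ∑𝕍-const zero i = trans (∑-vectors-zero (λ _ → i)) (sym (ℤ.*-identityˡ i))
  ∑𝕍-const (suc d) i = begin
    ∑[ x ← 𝕍 {suc d} ] i              ≡⟨ ∑-vectors-suc d (λ _ → i) ⟩
    ∑[ a ← 𝔽 ] ∑[ x ← 𝕍 {d} ] i       ≡⟨ ∑-cong 𝔽 (λ _ → ∑𝕍-const d i) ⟩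
    ∑[ a ← 𝔽 ] qℤ ^ d * i             ≡⟨ ∑𝔽-const (qℤ ^ d * i) ⟩
    qℤ * (qℤ ^ d * i)                 ≡⟨ ℤ.*-assoc qℤ (qℤ ^ d) i ⟨
    qℤ ^ suc d * i                    ∎

  Cong𝕍 : ∀ {d} → (V d → ℤ) → Set _
  Cong𝕍 h = ∀ {x y} → x ≋ y → h x ≡ h y

  infixl 6 _⊞_ _⊟_
  infixl 7 _∙_ _·_

  _⊞_ _⊟_ : ∀ {d} → V d → V d → V d
  (x ⊞ y) i = x i ⊕ y i
  (x ⊟ y) i = x i ⊝ y i

  _·_ : ∀ {d} → Carrier → V d → V d
  (a · x) i = a ⊗ x i

  𝟎 : ∀ {d} → V d
  𝟎 i = 0#

  _∙_ : ∀ {d} → V d → V d → Carrier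
  x ∙ y = sum (λ i → x i ⊗ y i)

  Q : ∀ {d} → V d → Carrier
  Q x = x ∙ x

  ∙-cong : ∀ {d} {x x′ y y′ : V d} → x ≋ x′ → y ≋ y′ → x ∙ y ≈ x′ ∙ y′
  ∙-cong eq eq′ = sum-cong-≋ (λ i → ⊗-cong (eq i) (eq′ i))

  Q-cong : ∀ {d} {x y : V d} → x ≋ y → Q x ≈ Q y
  Q-cong eq = ∙-cong eq eq

  ⊞-cong : ∀ {d} {x x′ y y′ : V d} → x ≋ x′ → y ≋ y′ → x ⊞ y ≋ x′ ⊞ y′
  ⊞-cong eq eq′ i = ⊕-cong (eq i) (eq′ i)

  ⊟-cong : ∀ {d} {x x′ y y′ : V d} → x ≋ x′ → y ≋ y′ → x ⊟ y ≋ x′ ⊟ y′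
  ⊟-cong eq eq′ i = ⊕-cong (eq i) (⊖-cong (eq′ i))

  ·-cong : ∀ {d} {a b} {x y : V d} → a ≈ b → x ≋ y → a · x ≋ b · y
  ·-cong eq eq′ i = ⊗-cong eq (eq′ i)

  ∙-comm : ∀ {d} (x y : V d) → x ∙ y ≈ y ∙ x
  ∙-comm x y = sum-cong-≋ (λ i → ⊗-comm (x i) (y i))

  ∙-line : ∀ {d} (x : V d) a y z → (x ⊞ a · y) ∙ z ≈ x ∙ z ⊕ a ⊗ (y ∙ z)
  ∙-line {zero} x a y z = solve 1 (λ a → con 0ℤ := con 0ℤ :+ a :* con 0ℤ) ≈-refl a
  ∙-line {suc d} x a y z = ≈-trans (⊕-cong ≈-refl (∙-line (tail x) a (tail y) (tail z)))
    (solve 6 (λ x a y z u v → (x :+ a :* y) :* z :+ (u :+ a :* v) := x :* z :+ u :+ a :* (y :* z :+ v))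
      ≈-refl (head x) a (head y) (head z) (tail x ∙ tail z) (tail y ∙ tail z))

  𝟎-∙ : ∀ {d} (x : V d) → 𝟎 ∙ x ≈ 0#
  𝟎-∙ {zero} x = ≈-refl
  𝟎-∙ {suc d} x = ≈-trans (⊕-cong (⊗-zeroˡ (head x)) (𝟎-∙ (tail x))) (⊕-identityˡ 0#)

  ·-∙ : ∀ {d} a (x y : V d) → (a · x) ∙ y ≈ a ⊗ (x ∙ y)
  ·-∙ a x y = ≈-trans (∙-cong {y = y} (λ i → ≈-sym (⊕-identityˡ (a ⊗ x i))) ≋-refl)
    (≈-trans (∙-line 𝟎 a x y) (≈-trans (⊕-cong (𝟎-∙ y) ≈-refl) (⊕-identityˡ _)))

  Q-line : ∀ {d} (x : V d) a y → Q (x ⊞ a · y) ≈ Q x ⊕ (a ⊗ (x ∙ y ⊕ x ∙ y) ⊕ a ⊗ a ⊗ Q y)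
  Q-line x a y = ≈-trans (∙-line x a y (x ⊞ a · y))
    (≈-trans (⊕-cong (flip x) (⊗-cong ≈-refl (flip y)))
      (≈-trans (⊕-cong ≈-refl (⊗-cong ≈-refl (⊕-cong (∙-comm y x) ≈-refl)))
        (solve 4 (λ a p s r → p :+ a :* s :+ a :* (s :+ a :* r) := p :+ (a :* (s :+ s) :+ a :* a :* r))
          ≈-refl a (Q x) (x ∙ y) (Q y))) )
    where
    flip : ∀ z → z ∙ (x ⊞ a · y) ≈ z ∙ x ⊕ a ⊗ (z ∙ y)
    flip z = ≈-trans (∙-comm z (x ⊞ a · y)) (≈-trans (∙-line x a y z)
      (⊕-cong (∙-comm x z) (⊗-cong ≈-refl (∙-comm y z))))

  Q-· : ∀ {d} a (x : V d) → Q (a · x) ≈ a ⊗ a ⊗ Q x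
  Q-· a x = ≈-trans (·-∙ a x (a · x)) (≈-trans (⊗-cong ≈-refl
    (≈-trans (∙-comm x (a · x)) (·-∙ a x x))) (≈-sym (⊗-assoc a a (Q x))))

  ⊟-line : ∀ {d} (x y : V d) → x ⊟ y ≋ x ⊞ (⊖ 1#) · y
  ⊟-line x y i = solve 2 (λ x y → x :- y := x :+ (:- con 1ℤ) :* y) ≈-refl (x i) (y i)

  Q-⊟ : ∀ {d} (x y : V d) → Q (x ⊟ y) ≈ Q x ⊝ (y ∙ x ⊕ y ∙ x) ⊕ Q y
  Q-⊟ x y = ≈-trans (Q-cong (⊟-line x y)) (≈-trans (Q-line x (⊖ 1#) y)
    (≈-trans (⊕-cong ≈-refl (⊕-cong (⊗-cong ≈-refl (⊕-cong (∙-comm x y) (∙-comm x y))) ≈-refl))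
      (solve 3 (λ p s r → p :+ ((:- con 1ℤ) :* (s :+ s) :+ (:- con 1ℤ) :* (:- con 1ℤ) :* r)
        := p :- (s :+ s) :+ r) ≈-refl (Q x) (y ∙ x) (Q y))))

  Q-⊟-comm : ∀ {d} (x y : V d) → Q (x ⊟ y) ≈ Q (y ⊟ x)
  Q-⊟-comm x y = ≈-trans (Q-cong (λ i → solve 2 (λ x y → x :- y := (:- con 1ℤ) :* (y :- x)) ≈-refl (x i) (y i)))
    (≈-trans (Q-· (⊖ 1#) (y ⊟ x)) (solve 1 (λ p → (:- con 1ℤ) :* (:- con 1ℤ) :* p := p) ≈-refl (Q (y ⊟ x))))

  -- Nondegeneracy of the dot product: u is supported on the first nonzero coordinate of v and holds
  -- its inverse there.
  dual-vector : ∀ {d} (v : V d) → ¬ v ≋ 𝟎 → ∃ λ u → u ∙ v ≈ 1#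
  dual-vector {zero} v v≉0 = ⊥-elim (v≉0 (λ ()))
  dual-vector {suc d} v v≉0 with head v ≟ 0#
  ... | no v₀≉0 with inverse v₀≉0
  ...   | (a , v₀a≈1) = a ∷ 𝟎 , ≈-trans (⊕-cong (≈-trans (⊗-comm a (head v)) v₀a≈1) (𝟎-∙ (tail v)))
    (solve 0 (con 1ℤ :+ con 0ℤ := con 1ℤ) ≈-refl)
  dual-vector {suc d} v v≉0 | yes v₀≈0 with dual-vector (tail v) (λ eq → v≉0 (λ where
    zero → v₀≈0
    (suc i) → eq i))
  ...   | (u , uv≈1) = 0# ∷ u , ≈-trans (⊕-cong (⊗-zeroˡ (head v)) uv≈1) (⊕-identityˡ 1#)

  module _ {d : ℕ} where

    ∑𝕍-translate : (u : V d) {h : V d → ℤ} → Cong𝕍 h → (∑[ x ← 𝕍 ] h (x ⊞ u)) ≡ ∑ 𝕍 h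
    ∑𝕍-translate u = ∑-reindex (vector-finite d) (vector-finite d) (_⊞ u) (_⊟ u)
      (λ {x} eq i → ≈-trans (⊕-cong (≈-sym (eq i)) ≈-refl) (solve 2 (λ x u → x :+ u :- u := x) ≈-refl (x i) (u i)))
      (λ {_} {y} eq i → ≈-trans (⊕-cong (≈-sym (eq i)) ≈-refl) (solve 2 (λ y u → y :- u :+ u := y) ≈-refl (y i) (u i)))

    ∑𝕍-reflect : (u : V d) {h : V d → ℤ} → Cong𝕍 h → (∑[ x ← 𝕍 ] h (u ⊟ x)) ≡ ∑ 𝕍 h
    ∑𝕍-reflect u = ∑-reindex (vector-finite d) (vector-finite d) (u ⊟_) (u ⊟_)
      (λ {x} eq i → ≈-trans (⊕-cong ≈-refl (⊖-cong (≈-sym (eq i)))) (solve 2 (λ x u → u :- (u :- x) := x) ≈-refl (x i) (u i)))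
      (λ {_} {y} eq i → ≈-trans (⊕-cong ≈-refl (⊖-cong (≈-sym (eq i)))) (solve 2 (λ y u → u :- (u :- y) := y) ≈-refl (y i) (u i)))

    ∑𝕍-dilate : ∀ {a} → ¬ a ≈ 0# → {h : V d → ℤ} → Cong𝕍 h → (∑[ x ← 𝕍 ] h (a · x)) ≡ ∑ 𝕍 h
    ∑𝕍-dilate {a} a≉0 with inverse a≉0
    ... | (b , ab≈1) = ∑-reindex (vector-finite d) (vector-finite d) (a ·_) (b ·_)
      (λ {x} {y} eq i → ≈-trans (⊗-cong ≈-refl (≈-sym (eq i)))
        (≈-trans (solve 3 (λ a b x → b :* (a :* x) := a :* b :* x) ≈-refl a b (x i))
          (≈-trans (⊗-cong ab≈1 ≈-refl) (⊗-identityˡ (x i)))))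
      (λ {x} {y} eq i → ≈-trans (⊗-cong ≈-refl (≈-sym (eq i)))
        (≈-trans (≈-sym (⊗-assoc a b (y i))) (≈-trans (⊗-cong ab≈1 ≈-refl) (⊗-identityˡ (y i)))))

  -- The number of vectors in dimension 2m on which Q takes a given nonzero value, q^(2m-1) - κ^m
  -- q^(m-1). The recursion adds two coordinates at a time and avoids the negative exponents at m =
  -- 0; the closed form appears in `q*spread` after multiplication by q.
  spread : ℕ → ℤ
  spread zero = 0ℤ
  spread (suc m) = (qℤ - κ) * (κ * qℤ) ^ m + qℤ * (qℤ * spread m)

  q*spread : ∀ m → qℤ * spread m ≡ qℤ ^ m * qℤ ^ m - (κ * qℤ) ^ m
  q*spread zero = ℤ.*-zeroʳ qℤ
  q*spread (suc m) = begin
    qℤ * ((qℤ - κ) * b + qℤ * (qℤ * spread m))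
      ≡⟨ cong (λ i → qℤ * ((qℤ - κ) * b + qℤ * i)) (q*spread m) ⟩
    qℤ * ((qℤ - κ) * b + qℤ * (p * p - b))        ≡⟨ lemma qℤ κ b p ⟩
    (qℤ * p) * (qℤ * p) - κ * qℤ * b              ∎
    where
    b = (κ * qℤ) ^ m
    p = qℤ ^ m
    lemma : ∀ q k b p → q * ((q - k) * b + q * (p * p - b)) ≡ (q * p) * (q * p) - k * q * b
    lemma = solve-∀

  -- Two coordinates a and b are split off. The induction hypothesis for the translate of h by a² +
  -- b² leaves one term in h(a² + b²), handled by `∑-two-squares`, and one in ∑ h, which translation
  -- does not change.
  ∑-Q : ∀ m {h : Carrier → ℤ} → Cong h →
    (∑[ x ← 𝕍 {m ℕ.* 2} ] h (Q x)) ≡ (κ * qℤ) ^ m * h 0# + spread m * ∑ 𝔽 h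
  ∑-Q zero {h} h-cong = trans (∑-vectors-zero (λ x → h (Q x))) (lemma (h 0#) (∑ 𝔽 h))
    where
    lemma : ∀ x y → x ≡ 1ℤ * x + 0ℤ * y
    lemma = solve-∀
  ∑-Q (suc m) {h} h-cong = begin
    ∑[ x ← 𝕍 ] h (Q x)
      ≡⟨ ∑-vectors-suc (suc (m ℕ.* 2)) (λ x → h (Q x)) ⟩
    ∑[ a ← 𝔽 ] ∑[ x ← 𝕍 ] h (Q (a ∷ x))
      ≡⟨ ∑-cong 𝔽 (λ a → ∑-vectors-suc (m ℕ.* 2) (λ x → h (Q (a ∷ x)))) ⟩
    ∑[ a ← 𝔽 ] ∑[ b ← 𝔽 ] ∑[ x ← 𝕍 ] h (a ⊗ a ⊕ (b ⊗ b ⊕ Q x))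
      ≡⟨ ∑-cong 𝔽 (λ a → ∑-cong 𝔽 (λ b → trans
          (∑-cong 𝕍 (λ x → h-cong (solve 3 (λ a b x → a :+ (b :+ x) := a :+ b :+ x) ≈-refl (a ⊗ a) (b ⊗ b) (Q x))))
          (fibre (a ⊗ a ⊕ b ⊗ b)))) ⟩
    ∑[ a ← 𝔽 ] ∑[ b ← 𝔽 ] β * h (a ⊗ a ⊕ b ⊗ b) + σ * H
      ≡⟨ ∑-cong 𝔽 (λ a → trans (∑-+ 𝔽 (λ b → β * h (a ⊗ a ⊕ b ⊗ b)) (λ _ → σ * H))
          (cong₂ _+_ (∑-*ˡ 𝔽 β (λ b → h (a ⊗ a ⊕ b ⊗ b))) (∑𝔽-const (σ * H)))) ⟩
    ∑[ a ← 𝔽 ] β * (∑[ b ← 𝔽 ] h (a ⊗ a ⊕ b ⊗ b)) + qℤ * (σ * H)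
      ≡⟨ trans (∑-+ 𝔽 (λ a → β * (∑[ b ← 𝔽 ] h (a ⊗ a ⊕ b ⊗ b))) (λ _ → qℤ * (σ * H)))
          (cong₂ _+_ (∑-*ˡ 𝔽 β (λ a → ∑[ b ← 𝔽 ] h (a ⊗ a ⊕ b ⊗ b))) (∑𝔽-const (qℤ * (σ * H)))) ⟩
    β * (∑[ a ← 𝔽 ] ∑[ b ← 𝔽 ] h (a ⊗ a ⊕ b ⊗ b)) + qℤ * (qℤ * (σ * H))
      ≡⟨ cong (λ i → β * i + qℤ * (qℤ * (σ * H))) (∑-two-squares h-cong) ⟩
    β * ((qℤ - κ) * H + κ * qℤ * h 0#) + qℤ * (qℤ * (σ * H))
      ≡⟨ lemma β qℤ κ H (h 0#) σ ⟩
    κ * qℤ * β * h 0# + ((qℤ - κ) * β + qℤ * (qℤ * σ)) * H ∎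
    where
    β = (κ * qℤ) ^ m
    σ = spread m
    H = ∑ 𝔽 h
    lemma : ∀ b q k t z s → b * ((q - k) * t + k * q * z) + q * (q * (s * t)) ≡
      k * q * b * z + ((q - k) * b + q * (q * s)) * t
    lemma = solve-∀
    fibre : ∀ t → (∑[ x ← 𝕍 {m ℕ.* 2} ] h (t ⊕ Q x)) ≡ β * h t + σ * H
    fibre t = trans (∑-Q m (λ eq → h-cong (⊕-cong ≈-refl eq)))
      (cong₂ (λ i j → β * i + σ * j) (h-cong (solve 1 (λ t → t :+ con 0ℤ := t) ≈-refl t)) (∑-translateˡ t h-cong))

-- Counting isotropic vectors on hyperplanes and composing the two kernels

module Kernels {c ℓ₁ ℓ₂} {q : ℕ} (F : FiniteField c ℓ₁ ℓ₂ q) (q-odd : q % 2 ≡ 1) where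

  open Sums
  open QuadraticCharacter F q-odd
  open CharacterSums F q-odd
  open QuadraticSpace F q-odd
  open import Data.Empty using (⊥-elim)
  open import Data.Integer.Base as ℤ using (ℤ; 0ℤ; 1ℤ; -1ℤ; _+_; _*_; -_; _-_)
  import Data.Integer.Properties as ℤ
  open import Data.Integer.Tactic.RingSolver using (solve-∀)
  open import Data.Product.Base using (_×_; _,_)
  open import Function.Base using (_∘_)
  open import Relation.Binary.PropositionalEquality.Core
    using (_≢_; refl; sym; trans; cong; cong₂)
  open import Relation.Binary.PropositionalEquality.Properties using (module ≡-Reasoning)
  open import Relation.Nullary.Decidable using (Dec; yes; no)
  open import Relation.Nullary.Negation using (¬_)
  open ≡-Reasoning

  isotropic : ∀ {d} → V d → ℤ
  isotropic x = 𝟙 (Q x ≟ 0#)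

  ηQ : ∀ {d} → V d → ℤ
  ηQ x = η′ (Q x)

  isotropic-cong : ∀ {d} {x y : V d} → x ≋ y → isotropic x ≡ isotropic y
  isotropic-cong eq = 𝟙≈-cong (Q-cong eq) ≈-refl

  ηQ-cong : ∀ {d} {x y : V d} → x ≋ y → ηQ x ≡ ηQ y
  ηQ-cong eq = η-cong (Q-cong eq)

  ηQ-· : ∀ {d a} → ¬ a ≈ 0# → (x : V d) → ηQ (a · x) ≡ ηQ x
  ηQ-· {d} {a} a≉0 x = trans (η-cong (Q-· a x))
    (η-⊗-square (Q x) (⊗-nonzero a≉0 a≉0) (a , ≈-refl))

  -- In dimension d = 2m the parameters are r = q^(m-1), s = q^m, ε = η(-1)^m.
  module Convolutions {d : ℕ} (r s ε : ℤ) (s≡qr : s ≡ qℤ * r)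
    (∑𝕍-1 : (∑[ x ← 𝕍 {d} ] 1ℤ) ≡ s * s)
    (∑ηQ : (∑[ x ← 𝕍 {d} ] ηQ x) ≡ 0ℤ)
    (∑isotropic : (∑[ x ← 𝕍 {d} ] isotropic x) ≡ s * r - ε * r + ε * s) where

    section : V d → Carrier → ℤ
    section v b = ∑[ x ← 𝕍 ] 𝟙 (x ∙ v ≟ b) * isotropic x

    -- The condition is the vanishing of the Gram determinant of v and x. For Q v ≠ 0 it is also the
    -- vanishing of the discriminant of a ↦ Q(x + a v).
    cone : V d → ℤ
    cone v = ∑[ x ← 𝕍 ] 𝟙 ((x ∙ v) ⊗ (x ∙ v) ≟ Q v ⊗ Q x)

    hyperplane : V d → Carrier → ℤ
    hyperplane v b = ∑[ x ← 𝕍 ] 𝟙 (x ∙ v ≟ b)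

    -- Dilation by b preserves isotropy and carries the hyperplane x·v = 1 to x·v = b, so a section
    -- has only two possible sizes.
    section-dilate : ∀ v {b} → ¬ b ≈ 0# → section v b ≡ section v 1#
    section-dilate v {b} b≉0 = trans
      (sym (∑𝕍-dilate b≉0 (λ eq → cong₂ _*_ (𝟙≈-cong (∙-cong eq ≋-refl) ≈-refl) (isotropic-cong eq))))
      (∑-cong 𝕍 (λ x → 𝟙-*-cong ((b · x) ∙ v ≟ b) (Q (b · x) ≟ 0#) (x ∙ v ≟ 1#) (Q x ≟ 0#)
        (λ eq eq′ → ⊗-cancelˡ b≉0 (≈-trans (≈-sym (·-∙ b x v)) (≈-trans eq (solve 1 (λ b → b := b :* con 1ℤ) ≈-refl b))) ,
          ⊗-integral (⊗-nonzero b≉0 b≉0) (≈-trans (≈-sym (Q-· b x)) eq′))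
        (λ eq eq′ → ≈-trans (·-∙ b x v) (≈-trans (⊗-cong ≈-refl eq) (solve 1 (λ b → b :* con 1ℤ := b) ≈-refl b)) ,
          ≈-trans (Q-· b x) (≈-trans (⊗-cong ≈-refl eq′) (⊗-zeroʳ (b ⊗ b))))))

    section-𝟙 : ∀ v b → section v b ≡ section v 1# + (section v 0# - section v 1#) * 𝟙 (0# ≟ b)
    section-𝟙 v b = 𝟙-interpolate (0# ≟ b)
      (λ 0≈b → ∑-cong 𝕍 (λ x → cong (_* isotropic x) (𝟙≈-cong ≈-refl (≈-sym 0≈b))))
      (λ 0≉b → section-dilate v (0≉b ∘ ≈-sym))

    ∑-section : ∀ v {h : Carrier → ℤ} → Cong h →
      (∑[ x ← 𝕍 ] h (x ∙ v) * isotropic x) ≡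
      section v 1# * ∑ 𝔽 h + (section v 0# - section v 1#) * h 0#
    ∑-section v {h} h-cong = begin
      ∑[ x ← 𝕍 ] h (x ∙ v) * isotropic x
        ≡⟨ ∑-cong 𝕍 (λ x → cong (_* isotropic x) (sym (pick𝔽 h-cong (x ∙ v)))) ⟩
      ∑[ x ← 𝕍 ] (∑[ b ← 𝔽 ] h b * 𝟙 (x ∙ v ≟ b)) * isotropic x
        ≡⟨ ∑-cong 𝕍 (λ x → trans (sym (∑-*ʳ 𝔽 (isotropic x) (λ b → h b * 𝟙 (x ∙ v ≟ b))))
            (∑-cong 𝔽 (λ b → ℤ.*-assoc (h b) (𝟙 (x ∙ v ≟ b)) (isotropic x)))) ⟩
      ∑[ x ← 𝕍 ] ∑[ b ← 𝔽 ] h b * (𝟙 (x ∙ v ≟ b) * isotropic x)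
        ≡⟨ ∑-comm 𝕍 𝔽 _ ⟩
      ∑[ b ← 𝔽 ] ∑[ x ← 𝕍 ] h b * (𝟙 (x ∙ v ≟ b) * isotropic x)
        ≡⟨ ∑-cong 𝔽 (λ b → ∑-*ˡ 𝕍 (h b) _) ⟩
      ∑[ b ← 𝔽 ] h b * section v b
        ≡⟨ ∑-cong 𝔽 (λ b → trans (cong (h b *_) (section-𝟙 v b)) (lemma (h b) W₁ W₀ (𝟙 (0# ≟ b)))) ⟩
      ∑[ b ← 𝔽 ] W₁ * h b + (W₀ - W₁) * (h b * 𝟙 (0# ≟ b))
        ≡⟨ ∑-+ 𝔽 (λ b → W₁ * h b) (λ b → (W₀ - W₁) * (h b * 𝟙 (0# ≟ b))) ⟩
      (∑[ b ← 𝔽 ] W₁ * h b) + (∑[ b ← 𝔽 ] (W₀ - W₁) * (h b * 𝟙 (0# ≟ b)))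
        ≡⟨ cong₂ _+_ (∑-*ˡ 𝔽 W₁ h) (trans (∑-*ˡ 𝔽 (W₀ - W₁) (λ b → h b * 𝟙 (0# ≟ b)))
            (cong ((W₀ - W₁) *_) (pick𝔽 h-cong 0#))) ⟩
      W₁ * ∑ 𝔽 h + (W₀ - W₁) * h 0# ∎
      where
      W₀ = section v 0#
      W₁ = section v 1#
      lemma : ∀ h w₁ w₀ i → h * (w₁ + (w₀ - w₁) * i) ≡ w₁ * h + (w₀ - w₁) * (h * i)
      lemma = solve-∀

    section-total : ∀ v → section v 0# + (qℤ - 1ℤ) * section v 1# ≡ s * r - ε * r + ε * s
    section-total v = begin
      W₀ + (qℤ - 1ℤ) * W₁                       ≡⟨ lemma W₀ qℤ W₁ ⟩
      W₁ * (qℤ * 1ℤ) + (W₀ - W₁) * 1ℤ           ≡⟨ cong (λ i → W₁ * i + (W₀ - W₁) * 1ℤ) (∑𝔽-const 1ℤ) ⟨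
      W₁ * (∑[ b ← 𝔽 ] 1ℤ) + (W₀ - W₁) * 1ℤ     ≡⟨ ∑-section v {λ _ → 1ℤ} (λ _ → refl) ⟨
      ∑[ x ← 𝕍 ] 1ℤ * isotropic x               ≡⟨ ∑-cong 𝕍 (λ x → ℤ.*-identityˡ (isotropic x)) ⟩
      ∑[ x ← 𝕍 ] isotropic x                    ≡⟨ ∑isotropic ⟩
      s * r - ε * r + ε * s                     ∎
      where
      W₀ = section v 0#
      W₁ = section v 1#
      lemma : ∀ w₀ q w₁ → w₀ + (q - 1ℤ) * w₁ ≡ w₁ * (q * 1ℤ) + (w₀ - w₁) * 1ℤ
      lemma = solve-∀

    -- ∑ₓ ∑ₐ η(Q(x + a v)) = 0 by translation; for fixed x the inner sum is a
    -- quadratic character sum whose discriminant detects the cone.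
    cone-nonisotropic : ∀ v → ¬ Q v ≈ 0# → cone v ≡ s * r
    cone-nonisotropic v Qv≉0 = *-cancel q≢0 (begin
      qℤ * cone v               ≡⟨ lemma (qℤ * cone v) (s * s) ⟩
      s * s + (qℤ * cone v - s * s)
        ≡⟨ cong (s * s +_) (*-cancel ηQv≢0 (trans (sym by-lines) (trans by-translation (sym (ℤ.*-zeroʳ (ηQ v)))))) ⟩
      s * s + 0ℤ                ≡⟨ cong (λ i → i * s + 0ℤ) s≡qr ⟩
      qℤ * r * s + 0ℤ           ≡⟨ lemma′ qℤ r s ⟩
      qℤ * (s * r)              ∎)
      where
      lemma : ∀ i j → i ≡ j + (i - j)
      lemma = solve-∀
      lemma′ : ∀ q r s → q * r * s + 0ℤ ≡ q * (s * r)
      lemma′ = solve-∀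
      ηQv≢0 : ηQ v ≢ 0ℤ
      ηQv≢0 eq = 0≢1 (trans (sym (cong (λ i → i * i) eq)) (η²≡1 Qv≉0))
        where
        0≢1 : 0ℤ ≢ 1ℤ
        0≢1 ()
      T = ∑[ a ← 𝔽 ] ∑[ x ← 𝕍 ] ηQ (x ⊞ a · v)
      by-translation : T ≡ 0ℤ
      by-translation = trans (∑-cong 𝔽 (λ a → trans (∑𝕍-translate (a · v) ηQ-cong) ∑ηQ)) (∑-0 𝔽)
      by-lines : T ≡ ηQ v * (qℤ * cone v - s * s)
      by-lines = begin
        T ≡⟨ ∑-comm 𝔽 𝕍 _ ⟩
        ∑[ x ← 𝕍 ] ∑[ a ← 𝔽 ] ηQ (x ⊞ a · v)
          ≡⟨ ∑-cong 𝕍 (λ x → trans (∑-cong 𝔽 (λ a → η-cong (Q-line x a v))) (∑η-quadratic (x ∙ v) (Q x) Qv≉0)) ⟩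
        ∑[ x ← 𝕍 ] ηQ v * (qℤ * g x - 1ℤ)
          ≡⟨ ∑-*ˡ 𝕍 (ηQ v) (λ x → qℤ * g x - 1ℤ) ⟩
        ηQ v * (∑[ x ← 𝕍 ] qℤ * g x - 1ℤ)
          ≡⟨ cong (ηQ v *_) (∑-+ 𝕍 (λ x → qℤ * g x) (λ _ → - 1ℤ)) ⟩
        ηQ v * ((∑[ x ← 𝕍 ] qℤ * g x) + (∑[ x ← 𝕍 ] -1ℤ * 1ℤ))
          ≡⟨ cong (ηQ v *_) (cong₂ _+_ (∑-*ˡ 𝕍 qℤ g) (trans (∑-*ˡ 𝕍 -1ℤ (λ _ → 1ℤ)) (trans (cong (-1ℤ *_) ∑𝕍-1) (ℤ.-1*i≡-i (s * s))))) ⟩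
        ηQ v * (qℤ * cone v - s * s) ∎
        where
        g : V d → ℤ
        g x = 𝟙 ((x ∙ v) ⊗ (x ∙ v) ≟ Q v ⊗ Q x)

    -- For Q v ≠ 0 every x is y + b u with u = v / Q v, b = x·v and y orthogonal to v. The cone
    -- condition then reads Q v · Q y = 0, so each of the q slices of the cone by b is a copy of the
    -- isotropic vectors orthogonal to v.
    section-0-nonisotropic : ∀ v → ¬ Q v ≈ 0# → section v 0# ≡ r * r
    section-0-nonisotropic v Qv≉0 with inverse Qv≉0
    ... | (w , Qv*w≈1) = *-cancel q≢0 (begin
      qℤ * section v 0#                       ≡⟨ ∑𝔽-const (section v 0#) ⟨
      ∑[ b ← 𝔽 ] section v 0#                 ≡⟨ ∑-cong 𝔽 slice ⟨
      ∑[ b ← 𝔽 ] ∑[ x ← 𝕍 ] g x * 𝟙 (x ∙ v ≟ b) ≡⟨ ∑-comm 𝔽 𝕍 _ ⟩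
      ∑[ x ← 𝕍 ] ∑[ b ← 𝔽 ] g x * 𝟙 (x ∙ v ≟ b)
        ≡⟨ ∑-cong 𝕍 (λ x → trans (∑-*ˡ 𝔽 (g x) _) (trans (cong (g x *_) (once𝔽 (x ∙ v))) (ℤ.*-identityʳ (g x)))) ⟩
      cone v                                  ≡⟨ cone-nonisotropic v Qv≉0 ⟩
      s * r                                   ≡⟨ cong (_* r) s≡qr ⟩
      qℤ * r * r                              ≡⟨ ℤ.*-assoc qℤ r r ⟩
      qℤ * (r * r)                            ∎)
      where
      g : V d → ℤ
      g x = 𝟙 ((x ∙ v) ⊗ (x ∙ v) ≟ Q v ⊗ Q x)
      -- The multiple of v with u·v = 1; then Q u = w = 1 / Q v, which makes the b² terms of the
      -- cone equation cancel.
      u : V d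
      u = w · v
      u∙v : u ∙ v ≈ 1#
      u∙v = ≈-trans (·-∙ w v v) (≈-trans (⊗-comm w (Q v)) Qv*w≈1)
      Q-u : Q u ≈ w
      Q-u = ≈-trans (Q-· w v) (≈-trans (solve 2 (λ w p → w :* w :* p := w :* (p :* w)) ≈-refl w (Q v))
        (≈-trans (⊗-cong ≈-refl Qv*w≈1) (solve 1 (λ w → w :* con 1ℤ := w) ≈-refl w)))
      slice : ∀ b → (∑[ x ← 𝕍 ] g x * 𝟙 (x ∙ v ≟ b)) ≡ section v 0#
      slice b = trans
        (sym (∑𝕍-translate (b · u) (λ eq → cong₂ _*_
          (𝟙≈-cong (⊗-cong (∙-cong eq ≋-refl) (∙-cong eq ≋-refl)) (⊗-cong ≈-refl (Q-cong eq)))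
          (𝟙≈-cong (∙-cong eq ≋-refl) ≈-refl))))
        (∑-cong 𝕍 (λ x → 𝟙-*-cong ((x⁺ x ∙ v) ⊗ (x⁺ x ∙ v) ≟ Q v ⊗ Q (x⁺ x)) (x⁺ x ∙ v ≟ b) (x ∙ v ≟ 0#) (Q x ≟ 0#) (there x) (back x)))
        where
        x⁺ : V d → V d
        x⁺ x = x ⊞ b · u
        x⁺∙v : ∀ x → x⁺ x ∙ v ≈ x ∙ v ⊕ b
        x⁺∙v x = ≈-trans (∙-line x b u v) (⊕-cong ≈-refl
          (≈-trans (⊗-cong ≈-refl u∙v) (solve 1 (λ b → b :* con 1ℤ := b) ≈-refl b)))
        Qv*Qx⁺ : ∀ x → x ∙ v ≈ 0# → Q v ⊗ Q (x⁺ x) ≈ Q v ⊗ Q x ⊕ b ⊗ b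
        Qv*Qx⁺ x xv≈0 = ≈-trans (⊗-cong ≈-refl (≈-trans (Q-line x b u)
          (⊕-cong ≈-refl (⊕-cong (⊗-cong ≈-refl (⊕-cong xu≈0 xu≈0)) (⊗-cong ≈-refl Q-u)))))
          (≈-trans (solve 4 (λ p t b w → p :* (t :+ (b :* (con 0ℤ :+ con 0ℤ) :+ b :* b :* w))
            := p :* t :+ b :* b :* (p :* w)) ≈-refl (Q v) (Q x) b w)
            (⊕-cong ≈-refl (≈-trans (⊗-cong ≈-refl Qv*w≈1) (solve 1 (λ t → t :* con 1ℤ := t) ≈-refl (b ⊗ b)))))
          where
          xu≈0 : x ∙ u ≈ 0#
          xu≈0 = ≈-trans (∙-comm x u) (≈-trans (·-∙ w v x)
            (≈-trans (⊗-cong ≈-refl (≈-trans (∙-comm v x) xv≈0)) (⊗-zeroʳ w)))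
        there : ∀ x → (x⁺ x ∙ v) ⊗ (x⁺ x ∙ v) ≈ Q v ⊗ Q (x⁺ x) → x⁺ x ∙ v ≈ b → x ∙ v ≈ 0# × Q x ≈ 0#
        there x eq eq′ = xv≈0 , ⊗-integral Qv≉0 (≈-trans
          (solve 2 (λ t b → t := t :+ b :* b :- b :* b) ≈-refl (Q v ⊗ Q x) b)
          (⊝-self (≈-trans (≈-sym (Qv*Qx⁺ x xv≈0)) (≈-trans (≈-sym eq) (⊗-cong eq′ eq′)))))
          where
          xv≈0 : x ∙ v ≈ 0#
          xv≈0 = ≈-trans (solve 2 (λ t b → t := t :+ b :- b) ≈-refl (x ∙ v) b)
            (⊝-self (≈-trans (≈-sym (x⁺∙v x)) eq′))
        back : ∀ x → x ∙ v ≈ 0# → Q x ≈ 0# → (x⁺ x ∙ v) ⊗ (x⁺ x ∙ v) ≈ Q v ⊗ Q (x⁺ x) × x⁺ x ∙ v ≈ b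
        back x xv≈0 Qx≈0 = ≈-trans (⊗-cong x⁺v≈b x⁺v≈b) (≈-sym (≈-trans (Qv*Qx⁺ x xv≈0)
            (≈-trans (⊕-cong (≈-trans (⊗-cong ≈-refl Qx≈0) (⊗-zeroʳ (Q v))) ≈-refl) (⊕-identityˡ (b ⊗ b))))) , x⁺v≈b
          where
          x⁺v≈b : x⁺ x ∙ v ≈ b
          x⁺v≈b = ≈-trans (x⁺∙v x) (≈-trans (⊕-cong xv≈0 ≈-refl) (⊕-identityˡ b))

    -- Along a dual vector u the value x·v moves by exactly a, so each line x + a u meets the
    -- hyperplane once. Summing over a gives q times the count on one side and all s² vectors on the
    -- other.
    hyperplane-count : ∀ v → ¬ v ≋ 𝟎 → ∀ b → hyperplane v b ≡ s * r
    hyperplane-count v v≉0 b with dual-vector v v≉0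
    ... | (u , uv≈1) = *-cancel q≢0 (begin
      qℤ * hyperplane v b                        ≡⟨ ∑𝔽-const (hyperplane v b) ⟨
      ∑[ a ← 𝔽 ] hyperplane v b
        ≡⟨ ∑-cong 𝔽 (λ a → ∑𝕍-translate (a · u) (λ eq → 𝟙≈-cong (∙-cong eq ≋-refl) ≈-refl)) ⟨
      ∑[ a ← 𝔽 ] ∑[ x ← 𝕍 ] 𝟙 ((x ⊞ a · u) ∙ v ≟ b) ≡⟨ ∑-comm 𝔽 𝕍 _ ⟩
      ∑[ x ← 𝕍 ] ∑[ a ← 𝔽 ] 𝟙 ((x ⊞ a · u) ∙ v ≟ b)
        ≡⟨ ∑-cong 𝕍 (λ x → trans (∑-cong 𝔽 (solve-line x)) (once𝔽 (b ⊝ x ∙ v))) ⟩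
      ∑[ x ← 𝕍 {d} ] 1ℤ                          ≡⟨ ∑𝕍-1 ⟩
      s * s                                      ≡⟨ cong (_* s) s≡qr ⟩
      qℤ * r * s                                 ≡⟨ lemma qℤ r s ⟩
      qℤ * (s * r)                               ∎)
      where
      lemma : ∀ q r s → q * r * s ≡ q * (s * r)
      lemma = solve-∀
      line : ∀ x a → (x ⊞ a · u) ∙ v ≈ x ∙ v ⊕ a
      line x a = ≈-trans (∙-line x a u v) (⊕-cong ≈-refl
        (≈-trans (⊗-cong ≈-refl uv≈1) (solve 1 (λ a → a :* con 1ℤ := a) ≈-refl a)))
      solve-line : ∀ x a → 𝟙 ((x ⊞ a · u) ∙ v ≟ b) ≡ 𝟙 (b ⊝ x ∙ v ≟ a)
      solve-line x a = 𝟙-cong ((x ⊞ a · u) ∙ v ≟ b) (b ⊝ x ∙ v ≟ a)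
        (λ eq → ≈-trans (⊕-cong (≈-trans (≈-sym eq) (line x a)) ≈-refl)
          (solve 2 (λ t a → t :+ a :- t := a) ≈-refl (x ∙ v) a))
        (λ eq → ≈-trans (line x a) (≈-trans (⊕-cong ≈-refl (≈-sym eq))
          (solve 2 (λ t b → t :+ (b :- t) := b) ≈-refl (x ∙ v) b)))

    -- For isotropic v, translating x by a v along x·v = 1 changes Q by 2a.
    section-1-isotropic : ∀ v → ¬ v ≋ 𝟎 → Q v ≈ 0# → section v 1# ≡ r * r
    section-1-isotropic v v≉0 Qv≈0 with inverse 2≉0
    ... | (½ , 2*½≈1) = *-cancel q≢0 (begin
      qℤ * section v 1#                ≡⟨ ∑𝔽-const (section v 1#) ⟨
      ∑[ a ← 𝔽 ] section v 1#          ≡⟨ ∑-cong 𝔽 slice ⟨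
      ∑[ a ← 𝔽 ] ∑[ x ← 𝕍 ] 𝟙 (x ∙ v ≟ 1#) * 𝟙 (root x ≟ a) ≡⟨ ∑-comm 𝔽 𝕍 _ ⟩
      ∑[ x ← 𝕍 ] ∑[ a ← 𝔽 ] 𝟙 (x ∙ v ≟ 1#) * 𝟙 (root x ≟ a)
        ≡⟨ ∑-cong 𝕍 (λ x → trans (∑-*ˡ 𝔽 (𝟙 (x ∙ v ≟ 1#)) _) (trans (cong (𝟙 (x ∙ v ≟ 1#) *_) (once𝔽 (root x))) (ℤ.*-identityʳ _))) ⟩
      hyperplane v 1#                  ≡⟨ hyperplane-count v v≉0 1# ⟩
      s * r                            ≡⟨ cong (_* r) s≡qr ⟩
      qℤ * r * r                       ≡⟨ ℤ.*-assoc qℤ r r ⟩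
      qℤ * (r * r)                     ∎)
      where
      -- The unique a with Q x + 2 a = 0, that is -Q(x) / 2.
      root : V d → Carrier
      root x = ⊖ Q x ⊗ ½
      line : ∀ x a → (x ⊞ a · v) ∙ v ≈ x ∙ v
      line x a = ≈-trans (∙-line x a v v) (≈-trans (⊕-cong ≈-refl (⊗-cong ≈-refl Qv≈0))
        (solve 2 (λ t a → t :+ a :* con 0ℤ := t) ≈-refl (x ∙ v) a))
      Q-on-line : ∀ x a → x ∙ v ≈ 1# → Q (x ⊞ a · v) ≈ Q x ⊕ (1# ⊕ 1#) ⊗ a
      Q-on-line x a xv≈1 = ≈-trans (Q-line x a v)
        (≈-trans (⊕-cong ≈-refl (⊕-cong (⊗-cong ≈-refl (⊕-cong xv≈1 xv≈1)) (⊗-cong ≈-refl Qv≈0)))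
          (solve 2 (λ t a → t :+ (a :* (con 1ℤ :+ con 1ℤ) :+ a :* a :* con 0ℤ) := t :+ (con 1ℤ :+ con 1ℤ) :* a) ≈-refl (Q x) a))
      2*root : ∀ x → (1# ⊕ 1#) ⊗ root x ≈ ⊖ Q x
      2*root x = ≈-trans (solve 3 (λ k p h → k :* ((:- p) :* h) := (:- p) :* (k :* h)) ≈-refl (1# ⊕ 1#) (Q x) ½)
        (≈-trans (⊗-cong ≈-refl 2*½≈1) (solve 1 (λ t → t :* con 1ℤ := t) ≈-refl (⊖ Q x)))
      slice : ∀ a → (∑[ x ← 𝕍 ] 𝟙 (x ∙ v ≟ 1#) * 𝟙 (root x ≟ a)) ≡ section v 1#
      slice a = trans
        (∑-cong 𝕍 (λ x → 𝟙-*-cong (x ∙ v ≟ 1#) (root x ≟ a) ((x ⊞ a · v) ∙ v ≟ 1#) (Q (x ⊞ a · v) ≟ 0#)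
          (λ xv≈1 eq → ≈-trans (line x a) xv≈1 ,
            ≈-trans (Q-on-line x a xv≈1) (≈-trans (⊕-cong ≈-refl (≈-trans (⊗-cong ≈-refl (≈-sym eq)) (2*root x))) (⊝-self ≈-refl)))
          (λ xv≈1′ eq → let xv≈1 = ≈-trans (≈-sym (line x a)) xv≈1′ in xv≈1 ,
            ⊗-cancelˡ 2≉0 (≈-trans (2*root x)
              (≈-trans (solve 2 (λ t u → :- t := u :- (t :+ u)) ≈-refl (Q x) ((1# ⊕ 1#) ⊗ a))
                (≈-trans (⊕-cong ≈-refl (⊖-cong (≈-trans (≈-sym (Q-on-line x a xv≈1)) eq)))
                  (solve 1 (λ u → u :- con 0ℤ := u) ≈-refl ((1# ⊕ 1#) ⊗ a))))))))
        (∑𝕍-translate (a · v) (λ eq → cong₂ _*_ (𝟙≈-cong (∙-cong eq ≋-refl) ≈-refl) (isotropic-cong eq)))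

    -- For isotropic v the cone equation degenerates to (x·v)² = 0, a hyperplane, and the count
    -- happens to agree with the nonisotropic one.
    cone-count : ∀ v → ¬ v ≋ 𝟎 → cone v ≡ s * r
    cone-count v v≉0 with Q v ≟ 0#
    ... | no Qv≉0 = cone-nonisotropic v Qv≉0
    ... | yes Qv≈0 = trans
      (∑-cong 𝕍 (λ x → 𝟙-cong ((x ∙ v) ⊗ (x ∙ v) ≟ Q v ⊗ Q x) (x ∙ v ≟ 0#) (there x) (back x)))
      (hyperplane-count v v≉0 0#)
      where
      there : ∀ x → (x ∙ v) ⊗ (x ∙ v) ≈ Q v ⊗ Q x → x ∙ v ≈ 0#
      there x eq with x ∙ v ≟ 0#
      ... | yes xv≈0 = xv≈0
      ... | no xv≉0 = ⊥-elim (⊗-nonzero xv≉0 xv≉0 (≈-trans eq (≈-trans (⊗-cong Qv≈0 ≈-refl) (⊗-zeroˡ (Q x)))))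
      back : ∀ x → x ∙ v ≈ 0# → (x ∙ v) ⊗ (x ∙ v) ≈ Q v ⊗ Q x
      back x eq = ≈-trans (≈-trans (⊗-cong eq ≈-refl) (⊗-zeroˡ (x ∙ v)))
        (≈-sym (≈-trans (⊗-cong Qv≈0 ≈-refl) (⊗-zeroˡ (Q x))))

    section-difference : ∀ v → ¬ Q v ≈ 0# → section v 0# - section v 1# ≡ - ε * r
    section-difference v Qv≉0 = *-cancel q-1≢0 (begin
      (qℤ - 1ℤ) * (W₀ - W₁)                             ≡⟨ lemma qℤ W₀ W₁ ⟩
      qℤ * W₀ - (W₀ + (qℤ - 1ℤ) * W₁)
        ≡⟨ cong₂ (λ i j → qℤ * i - j) (section-0-nonisotropic v Qv≉0) (section-total v) ⟩
      qℤ * (r * r) - (s * r - ε * r + ε * s)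
        ≡⟨ cong (λ i → qℤ * (r * r) - (i * r - ε * r + ε * i)) s≡qr ⟩
      qℤ * (r * r) - (qℤ * r * r - ε * r + ε * (qℤ * r)) ≡⟨ lemma′ qℤ r ε ⟩
      (qℤ - 1ℤ) * (- ε * r)                             ∎)
      where
      W₀ = section v 0#
      W₁ = section v 1#
      lemma : ∀ q i j → (q - 1ℤ) * (i - j) ≡ q * i - (i + (q - 1ℤ) * j)
      lemma = solve-∀
      lemma′ : ∀ q r e → q * (r * r) - (q * r * r - e * r + e * (q * r)) ≡ (q - 1ℤ) * (- e * r)
      lemma′ = solve-∀

    -- On isotropic x the quantity Q(v - x) = Q v - 2 x·v depends on x·v alone, so `∑-section`
    -- applies. The full sum over b vanishes since b ↦ Q v - 2 b is a bijection, and only the excess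
    -- of the section at 0 remains. If Q v = 0, both sides carry the factor η(Q v) = 0.
    isotropic*ηQ : ∀ v → (∑[ x ← 𝕍 ] isotropic x * ηQ (v ⊟ x)) ≡ - ε * r * ηQ v
    isotropic*ηQ v = begin
      ∑[ x ← 𝕍 ] isotropic x * ηQ (v ⊟ x)
        ≡⟨ ∑-cong 𝕍 linearise ⟩
      ∑[ x ← 𝕍 ] h (x ∙ v) * isotropic x
        ≡⟨ ∑-section v h-cong ⟩
      section v 1# * ∑ 𝔽 h + (section v 0# - section v 1#) * h 0#
        ≡⟨ cong₂ (λ i j → section v 1# * i + (section v 0# - section v 1#) * j) ∑h h0 ⟩
      section v 1# * 0ℤ + (section v 0# - section v 1#) * ηQ v
        ≡⟨ lemma (section v 1#) _ ⟩
      (section v 0# - section v 1#) * ηQ v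
        ≡⟨ scale ⟩
      - ε * r * ηQ v ∎
      where
      lemma : ∀ i j → i * 0ℤ + j ≡ j
      lemma = solve-∀
      h : Carrier → ℤ
      h b = η′ (Q v ⊝ (b ⊕ b))
      h-cong : Cong h
      h-cong eq = η-cong (⊕-cong ≈-refl (⊖-cong (⊕-cong eq eq)))
      h0 : h 0# ≡ ηQ v
      h0 = η-cong (solve 1 (λ t → t :- (con 0ℤ :+ con 0ℤ) := t) ≈-refl (Q v))
      -2≉0 : ¬ ⊖ (1# ⊕ 1#) ≈ 0#
      -2≉0 eq = 2≉0 (≈-trans (solve 1 (λ t → t := con 0ℤ :- (:- t)) ≈-refl (1# ⊕ 1#)) (⊝-self (≈-sym eq)))
      ∑h : ∑ 𝔽 h ≡ 0ℤ
      ∑h = trans (∑-cong 𝔽 (λ b → η-cong (solve 2 (λ t b → t :- (b :+ b) := (:- (con 1ℤ :+ con 1ℤ)) :* b :+ t) ≈-refl (Q v) b)))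
        (trans (∑-dilate -2≉0 {λ b → η′ (b ⊕ Q v)} (λ eq → η-cong (⊕-cong eq ≈-refl))) (trans (∑-translate (Q v) η-cong) ∑η))
      linearise : ∀ x → isotropic x * ηQ (v ⊟ x) ≡ h (x ∙ v) * isotropic x
      linearise x with Q x ≟ 0#
      ... | yes Qx≈0 = trans (ℤ.*-comm 1ℤ (ηQ (v ⊟ x))) (cong (_* 1ℤ) (η-cong
        (≈-trans (Q-⊟ v x) (≈-trans (⊕-cong ≈-refl Qx≈0) (solve 1 (λ t → t :+ con 0ℤ := t) ≈-refl _)))))
      ... | no _ = sym (ℤ.*-zeroʳ (h (x ∙ v)))
      scale : (section v 0# - section v 1#) * ηQ v ≡ - ε * r * ηQ v
      scale with Q v ≟ 0#
      ... | no Qv≉0 = cong (_* ηQ v) (section-difference v Qv≉0)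
      ... | yes Qv≈0 = trans (cong ((section v 0# - section v 1#) *_) (η-zero Qv≈0))
        (trans (ℤ.*-zeroʳ (section v 0# - section v 1#)) (sym (trans (cong (- ε * r *_) (η-zero Qv≈0)) (ℤ.*-zeroʳ (- ε * r)))))

    autocorrelation-ηQ : V d → ℤ
    autocorrelation-ηQ v = ∑[ x ← 𝕍 ] ηQ x * ηQ (v ⊟ x)

    -- Dilating x by -1/a shows that ∑ₓ η(Q x) η(Q(v + a x)) does not depend on
    -- a ≠ 0, and summing over a reduces it to quadratic character sums.
    autocorrelation-lines : ∀ v → ¬ v ≋ 𝟎 →
      (qℤ - 1ℤ) * autocorrelation-ηQ v ≡ s * r - ε * r + ε * s - qℤ * section v 0#
    autocorrelation-lines v v≉0 = begin
      (qℤ - 1ℤ) * A                               ≡⟨ ℤ.*-comm (qℤ - 1ℤ) A ⟩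
      A * (qℤ - 1ℤ)                               ≡⟨ cong (A *_) (∑-1-𝟙 0#) ⟨
      A * (∑[ a ← 𝔽 ] 1ℤ - 𝟙 (0# ≟ a))            ≡⟨ ∑-*ˡ 𝔽 A (λ a → 1ℤ - 𝟙 (0# ≟ a)) ⟨
      ∑[ a ← 𝔽 ] A * (1ℤ - 𝟙 (0# ≟ a))            ≡⟨ ∑-cong 𝔽 (λ a → sym (line a)) ⟩
      ∑[ a ← 𝔽 ] ∑[ x ← 𝕍 ] ηQ x * ηQ (v ⊞ a · x) ≡⟨ ∑-comm 𝔽 𝕍 _ ⟩
      ∑[ x ← 𝕍 ] ∑[ a ← 𝔽 ] ηQ x * ηQ (v ⊞ a · x)
        ≡⟨ ∑-cong 𝕍 (λ x → trans (∑-*ˡ 𝔽 (ηQ x) (λ a → ηQ (v ⊞ a · x))) (direction x)) ⟩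
      ∑[ x ← 𝕍 ] (1ℤ - isotropic x) * (qℤ * g x - 1ℤ)
        ≡⟨ ∑-cong 𝕍 (λ x → trans (expand (isotropic x) qℤ (g x)) (cong (λ i → qℤ * g x + (-1ℤ * 1ℤ + (- qℤ * i + isotropic x))) (tangent x))) ⟩
      ∑[ x ← 𝕍 ] qℤ * g x + (-1ℤ * 1ℤ + (- qℤ * (𝟙 (x ∙ v ≟ 0#) * isotropic x) + isotropic x))
        ≡⟨ trans (∑-+ 𝕍 (λ x → qℤ * g x) (λ x → -1ℤ * 1ℤ + (- qℤ * (𝟙 (x ∙ v ≟ 0#) * isotropic x) + isotropic x)))
            (cong₂ _+_ (∑-*ˡ 𝕍 qℤ g)
              (trans (∑-+ 𝕍 (λ _ → -1ℤ * 1ℤ) (λ x → - qℤ * (𝟙 (x ∙ v ≟ 0#) * isotropic x) + isotropic x))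
                (cong₂ _+_ (∑-*ˡ 𝕍 -1ℤ (λ _ → 1ℤ))
                  (trans (∑-+ 𝕍 (λ x → - qℤ * (𝟙 (x ∙ v ≟ 0#) * isotropic x)) isotropic)
                    (cong (_+ ∑ 𝕍 isotropic) (∑-*ˡ 𝕍 (- qℤ) (λ x → 𝟙 (x ∙ v ≟ 0#) * isotropic x))))))) ⟩
      qℤ * cone v + (-1ℤ * (∑[ x ← 𝕍 {d} ] 1ℤ) + (- qℤ * section v 0# + ∑ 𝕍 isotropic))
        ≡⟨ cong₂ (λ i j → qℤ * i + j) (cone-count v v≉0)
            (cong₂ (λ i j → -1ℤ * i + (- qℤ * section v 0# + j)) ∑𝕍-1 ∑isotropic) ⟩
      qℤ * (s * r) + (-1ℤ * (s * s) + (- qℤ * section v 0# + (s * r - ε * r + ε * s)))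
        ≡⟨ cong (λ i → qℤ * (s * r) + (-1ℤ * (i * s) + (- qℤ * section v 0# + (s * r - ε * r + ε * s)))) s≡qr ⟩
      qℤ * (s * r) + (-1ℤ * (qℤ * r * s) + (- qℤ * section v 0# + (s * r - ε * r + ε * s)))
        ≡⟨ tidy qℤ s r (section v 0#) (s * r - ε * r + ε * s) ⟩
      s * r - ε * r + ε * s - qℤ * section v 0# ∎
      where
      A = autocorrelation-ηQ v
      g : V d → ℤ
      g x = 𝟙 ((x ∙ v) ⊗ (x ∙ v) ≟ Q v ⊗ Q x)
      expand : ∀ z q g → (1ℤ - z) * (q * g - 1ℤ) ≡ q * g + (-1ℤ * 1ℤ + (- q * (g * z) + z))
      expand = solve-∀
      tidy : ∀ q s r w t → q * (s * r) + (-1ℤ * (q * r * s) + (- q * w + t)) ≡ t - q * w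
      tidy = solve-∀
      -- Isotropic x contribute nothing because of the factor η(Q x). Removing them from the cone
      -- count subtracts those with x·v = 0, and this is where the section at 0 comes in.
      tangent : ∀ x → g x * isotropic x ≡ 𝟙 (x ∙ v ≟ 0#) * isotropic x
      tangent x = 𝟙-*-cong ((x ∙ v) ⊗ (x ∙ v) ≟ Q v ⊗ Q x) (Q x ≟ 0#) (x ∙ v ≟ 0#) (Q x ≟ 0#)
        (λ eq Qx≈0 → there (≈-trans eq (≈-trans (⊗-cong ≈-refl Qx≈0) (⊗-zeroʳ (Q v)))) , Qx≈0)
        (λ xv≈0 Qx≈0 → ≈-trans (≈-trans (⊗-cong xv≈0 ≈-refl) (⊗-zeroˡ (x ∙ v)))
          (≈-sym (≈-trans (⊗-cong ≈-refl Qx≈0) (⊗-zeroʳ (Q v)))) , Qx≈0)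
        where
        there : (x ∙ v) ⊗ (x ∙ v) ≈ 0# → x ∙ v ≈ 0#
        there eq with x ∙ v ≟ 0#
        ... | yes xv≈0 = xv≈0
        ... | no xv≉0 = ⊥-elim (⊗-nonzero xv≉0 xv≉0 eq)
      direction : ∀ x → ηQ x * (∑[ a ← 𝔽 ] ηQ (v ⊞ a · x)) ≡ (1ℤ - isotropic x) * (qℤ * g x - 1ℤ)
      direction x = by-cases (Q x ≟ 0#)
        where
        by-cases : Dec (Q x ≈ 0#) → ηQ x * (∑[ a ← 𝔽 ] ηQ (v ⊞ a · x)) ≡ (1ℤ - isotropic x) * (qℤ * g x - 1ℤ)
        by-cases (yes Qx≈0) = trans (cong (_* (∑[ a ← 𝔽 ] ηQ (v ⊞ a · x))) (η-zero Qx≈0))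
          (cong (λ i → (1ℤ - i) * (qℤ * g x - 1ℤ)) (sym (𝟙-yes (Q x ≟ 0#) Qx≈0)))
        by-cases (no Qx≉0) = begin
          ηQ x * (∑[ a ← 𝔽 ] ηQ (v ⊞ a · x))
            ≡⟨ cong (ηQ x *_) (trans (∑-cong 𝔽 (λ a → η-cong (Q-line v a x))) (∑η-quadratic (v ∙ x) (Q v) Qx≉0)) ⟩
          ηQ x * (ηQ x * (qℤ * 𝟙 ((v ∙ x) ⊗ (v ∙ x) ≟ Q x ⊗ Q v) - 1ℤ))
            ≡⟨ sym (ℤ.*-assoc (ηQ x) (ηQ x) _) ⟩
          ηQ x * ηQ x * (qℤ * 𝟙 ((v ∙ x) ⊗ (v ∙ x) ≟ Q x ⊗ Q v) - 1ℤ)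
            ≡⟨ cong₂ (λ i j → i * (qℤ * j - 1ℤ)) (η² (Q x))
                (𝟙≈-cong (⊗-cong (∙-comm v x) (∙-comm v x)) (⊗-comm (Q x) (Q v))) ⟩
          (1ℤ - isotropic x) * (qℤ * g x - 1ℤ) ∎
      line : ∀ a → (∑[ x ← 𝕍 ] ηQ x * ηQ (v ⊞ a · x)) ≡ A * (1ℤ - 𝟙 (0# ≟ a))
      line a = by-cases (0# ≟ a)
        where
        by-cases : Dec (0# ≈ a) → (∑[ x ← 𝕍 ] ηQ x * ηQ (v ⊞ a · x)) ≡ A * (1ℤ - 𝟙 (0# ≟ a))
        -- At a = 0 the second factor is constant and the sum is a multiple of ∑ η(Q x) = 0, so only
        -- the q - 1 nonzero values of a count.
        by-cases (yes 0≈a) = begin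
          ∑[ x ← 𝕍 ] ηQ x * ηQ (v ⊞ a · x)
            ≡⟨ ∑-cong 𝕍 (λ x → cong (ηQ x *_) (ηQ-cong (λ i → ≈-trans (⊕-cong ≈-refl (⊗-cong (≈-sym 0≈a) ≈-refl))
                (solve 2 (λ v x → v :+ con 0ℤ :* x := v) ≈-refl (v i) (x i))))) ⟩
          ∑[ x ← 𝕍 ] ηQ x * ηQ v     ≡⟨ ∑-*ʳ 𝕍 (ηQ v) ηQ ⟩
          ∑ 𝕍 ηQ * ηQ v              ≡⟨ cong (_* ηQ v) ∑ηQ ⟩
          0ℤ * ηQ v                  ≡⟨ ℤ.*-zeroʳ A ⟨
          A * (1ℤ - 1ℤ)              ≡⟨ cong (λ i → A * (1ℤ - i)) (𝟙-yes (0# ≟ a) 0≈a) ⟨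
          A * (1ℤ - 𝟙 (0# ≟ a))      ∎
        by-cases (no 0≉a) with inverse (0≉a ∘ ≈-sym)
        ... | (b , ab≈1) = begin
          ∑[ x ← 𝕍 ] ηQ x * ηQ (v ⊞ a · x)
            ≡⟨ ∑𝕍-dilate e≉0 (λ eq → cong₂ _*_ (ηQ-cong eq) (ηQ-cong (⊞-cong ≋-refl (·-cong ≈-refl eq)))) ⟨
          ∑[ x ← 𝕍 ] ηQ (e · x) * ηQ (v ⊞ a · (e · x))
            ≡⟨ ∑-cong 𝕍 (λ x → cong₂ _*_ (ηQ-· e≉0 x) (ηQ-cong (λ i →
                ≈-trans (solve 4 (λ v a b x → v :+ a :* ((:- b) :* x) := v :- a :* b :* x) ≈-refl (v i) a b (x i))
                  (⊕-cong ≈-refl (⊖-cong (≈-trans (⊗-cong ab≈1 ≈-refl) (⊗-identityˡ (x i)))))))) ⟩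
          A                          ≡⟨ ℤ.*-identityʳ A ⟨
          A * (1ℤ - 0ℤ)              ≡⟨ cong (λ i → A * (1ℤ - i)) (𝟙-no (0# ≟ a) 0≉a) ⟨
          A * (1ℤ - 𝟙 (0# ≟ a))      ∎
          where
          e = ⊖ b
          e≉0 : ¬ e ≈ 0#
          e≉0 e≈0 = 1≉0 (≈-trans (≈-sym ab≈1) (≈-trans (solve 2 (λ a b → a :* b := (:- a) :* (:- b)) ≈-refl a b)
            (≈-trans (⊗-cong ≈-refl e≈0) (⊗-zeroʳ (⊖ a)))))

    -- The section at 0 is known directly when Q v ≠ 0. When Q v = 0 the section at 1 is the known
    -- one, and `section-total` converts between them; the different outcome is the term in
    -- `isotropic v`.
    ηQ*ηQ-nonzero : ∀ v → ¬ v ≋ 𝟎 → autocorrelation-ηQ v ≡ ε * r - ε * s * isotropic v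
    ηQ*ηQ-nonzero v v≉0 = *-cancel q-1≢0 (trans (autocorrelation-lines v v≉0) (by-cases (Q v ≟ 0#)))
      where
      N = s * r - ε * r + ε * s
      by-cases : Dec (Q v ≈ 0#) → N - qℤ * section v 0# ≡ (qℤ - 1ℤ) * (ε * r - ε * s * isotropic v)
      by-cases (no Qv≉0) = begin
        N - qℤ * section v 0#         ≡⟨ cong (λ i → N - qℤ * i) (section-0-nonisotropic v Qv≉0) ⟩
        N - qℤ * (r * r)              ≡⟨ cong (λ i → i * r - ε * r + ε * i - qℤ * (r * r)) s≡qr ⟩
        qℤ * r * r - ε * r + ε * (qℤ * r) - qℤ * (r * r) ≡⟨ lemma qℤ r ε s ⟩
        (qℤ - 1ℤ) * (ε * r - ε * s * 0ℤ)
          ≡⟨ cong (λ i → (qℤ - 1ℤ) * (ε * r - ε * s * i)) (𝟙-no (Q v ≟ 0#) Qv≉0) ⟨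
        (qℤ - 1ℤ) * (ε * r - ε * s * isotropic v) ∎
        where
        lemma : ∀ q r e s → q * r * r - e * r + e * (q * r) - q * (r * r) ≡ (q - 1ℤ) * (e * r - e * s * 0ℤ)
        lemma = solve-∀
      by-cases (yes Qv≈0) = begin
        N - qℤ * section v 0#         ≡⟨ lemma N qℤ (section v 0#) (section v 1#) ⟩
        N - qℤ * (section v 0# + (qℤ - 1ℤ) * section v 1#) + qℤ * ((qℤ - 1ℤ) * section v 1#)
          ≡⟨ cong₂ (λ i j → N - qℤ * i + qℤ * ((qℤ - 1ℤ) * j)) (section-total v) (section-1-isotropic v v≉0 Qv≈0) ⟩
        N - qℤ * N + qℤ * ((qℤ - 1ℤ) * (r * r)) ≡⟨ lemma′ s r ε qℤ ⟩
        (qℤ - 1ℤ) * (qℤ * r * r - s * r + ε * r - ε * s * 1ℤ)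
          ≡⟨ cong (λ i → (qℤ - 1ℤ) * (i * r - s * r + ε * r - ε * s * 1ℤ)) s≡qr ⟨
        (qℤ - 1ℤ) * (s * r - s * r + ε * r - ε * s * 1ℤ) ≡⟨ lemma″ s r ε qℤ ⟩
        (qℤ - 1ℤ) * (ε * r - ε * s * 1ℤ)
          ≡⟨ cong (λ i → (qℤ - 1ℤ) * (ε * r - ε * s * i)) (𝟙-yes (Q v ≟ 0#) Qv≈0) ⟨
        (qℤ - 1ℤ) * (ε * r - ε * s * isotropic v) ∎
        where
        lemma : ∀ n q w₀ w₁ → n - q * w₀ ≡ n - q * (w₀ + (q - 1ℤ) * w₁) + q * ((q - 1ℤ) * w₁)
        lemma = solve-∀
        lemma′ : ∀ s r e q → (s * r - e * r + e * s) - q * (s * r - e * r + e * s) + q * ((q - 1ℤ) * (r * r)) ≡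
          (q - 1ℤ) * (q * r * r - s * r + e * r - e * s * 1ℤ)
        lemma′ = solve-∀
        lemma″ : ∀ s r e q → (q - 1ℤ) * (s * r - s * r + e * r - e * s * 1ℤ) ≡ (q - 1ℤ) * (e * r - e * s * 1ℤ)
        lemma″ = solve-∀

    -- At v = 0 the correlation counts the nonisotropic vectors. The coefficient s² - s r of the
    -- point mass is the excess over the formula valid at all other v.
    ηQ*ηQ : ∀ v → autocorrelation-ηQ v ≡
      (s * s - s * r) * 𝟙 (v ≋? 𝟎) - ε * s * isotropic v + ε * r
    ηQ*ηQ v = by-cases (v ≋? 𝟎)
      where
      by-cases : Dec (v ≋ 𝟎) → autocorrelation-ηQ v ≡
        (s * s - s * r) * 𝟙 (v ≋? 𝟎) - ε * s * isotropic v + ε * r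
      by-cases (no v≉0) = trans (ηQ*ηQ-nonzero v v≉0) (trans (lemma (s * s - s * r) (ε * r) (ε * s) (isotropic v))
        (cong (λ i → (s * s - s * r) * i - ε * s * isotropic v + ε * r) (sym (𝟙-no (v ≋? 𝟎) v≉0))))
        where
        lemma : ∀ a b c i → b - c * i ≡ a * 0ℤ - c * i + b
        lemma = solve-∀
      by-cases (yes v≈0) = begin
        ∑[ x ← 𝕍 ] ηQ x * ηQ (v ⊟ x)
          ≡⟨ ∑-cong 𝕍 (λ x → trans (cong (ηQ x *_) (reflect x)) (η² (Q x))) ⟩
        ∑[ x ← 𝕍 ] 1ℤ - isotropic x
          ≡⟨ ∑-cong 𝕍 (λ x → cong (1ℤ +_) (sym (ℤ.-1*i≡-i (isotropic x)))) ⟩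
        ∑[ x ← 𝕍 ] 1ℤ + -1ℤ * isotropic x  ≡⟨ ∑-+ 𝕍 (λ _ → 1ℤ) (λ x → -1ℤ * isotropic x) ⟩
        (∑[ x ← 𝕍 {d} ] 1ℤ) + (∑[ x ← 𝕍 ] -1ℤ * isotropic x)
          ≡⟨ cong₂ _+_ ∑𝕍-1 (trans (∑-*ˡ 𝕍 -1ℤ isotropic) (cong (-1ℤ *_) ∑isotropic)) ⟩
        s * s + -1ℤ * (s * r - ε * r + ε * s) ≡⟨ lemma s r ε ⟩
        (s * s - s * r) * 1ℤ - ε * s * 1ℤ + ε * r
          ≡⟨ cong₂ (λ i j → (s * s - s * r) * i - ε * s * j + ε * r) (𝟙-yes (v ≋? 𝟎) v≈0) (𝟙-yes (Q v ≟ 0#) (≈-trans (Q-cong v≈0) (𝟎-∙ (𝟎 {d})))) ⟨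
        (s * s - s * r) * 𝟙 (v ≋? 𝟎) - ε * s * isotropic v + ε * r ∎
        where
        lemma : ∀ s r e → s * s + -1ℤ * (s * r - e * r + e * s) ≡ (s * s - s * r) * 1ℤ - e * s * 1ℤ + e * r
        lemma = solve-∀
        reflect : ∀ x → ηQ (v ⊟ x) ≡ ηQ x
        reflect x = η-cong (≈-trans (Q-⊟-comm v x) (Q-cong (λ i → ≈-trans (⊕-cong ≈-refl (⊖-cong (v≈0 i)))
          (solve 1 (λ x → x :- con 0ℤ := x) ≈-refl (x i)))))

-- Convolution operators, the two quadratic inequalities and their reading for a subset

module Energy {c ℓ₁ ℓ₂} {q : ℕ} (F : FiniteField c ℓ₁ ℓ₂ q) (q-odd : q % 2 ≡ 1) where

  open Sums
  open QuadraticCharacter F q-odd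
  open CharacterSums F q-odd
  open QuadraticSpace F q-odd
  open Kernels F q-odd
  open import Data.Integer.Base as ℤ using (ℤ; 0ℤ; 1ℤ; -1ℤ; _+_; _*_; -_; _-_; _≤_; _<_; -[1+_])
  import Data.Integer.Properties as ℤ
  open import Data.Integer.Tactic.RingSolver using (solve-∀)
  open import Data.List.Base using (List; []; _∷_; length; filter; cartesianProduct)
  open import Data.List.Relation.Unary.All using (All; []; _∷_)
  open import Data.List.Relation.Unary.AllPairs using ([]; _∷_)
  import Data.List.Relation.Unary.Unique.Setoid as UniqueSetoid
  import Data.Nat.Base as ℕ
  open import Data.Product.Base using (_,_)
  open import Relation.Binary.PropositionalEquality.Core
    using (refl; sym; trans; cong; cong₂; subst; subst₂)
  open import Relation.Binary.PropositionalEquality.Properties using (module ≡-Reasoning)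
  open import Relation.Nullary.Decidable using (Dec; yes; no)
  open import Relation.Nullary.Negation using (¬_)
  open import Relation.Unary using (Decidable)
  open ≡-Reasoning

  0≤i*i : ∀ i → 0ℤ ≤ i * i
  0≤i*i (ℤ.+ n) = ℤ.≤-trans (ℤ.+≤+ ℕ.z≤n) (ℤ.≤-reflexive (ℤ.pos-* n n))
  0≤i*i -[1+ n ] = ℤ.+≤+ ℕ.z≤n

  cancel-positive : ∀ {i j} → 0ℤ < i → 0ℤ ≤ i * j → 0ℤ ≤ j
  cancel-positive {i} {j} 0<i le = ℤ.*-cancelˡ-≤-pos 0ℤ j i {{ℤ.positive 0<i}}
    (ℤ.≤-trans (ℤ.≤-reflexive (ℤ.*-zeroʳ i)) le)

  infix 6 ⟨_,_⟩
  ⟨_,_⟩ : ∀ {d} → (V d → ℤ) → (V d → ℤ) → ℤ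
  ⟨ g , h ⟩ = ∑[ x ← 𝕍 ] g x * h x

  convolve : ∀ {d} → (V d → ℤ) → (V d → ℤ) → V d → ℤ
  convolve k g x = ∑[ y ← 𝕍 ] k (x ⊟ y) * g y

  convolve-cong : ∀ {d} {k : V d → ℤ} → Cong𝕍 k → ∀ {g} → Cong𝕍 (convolve k g)
  convolve-cong k-cong {g} eq = ∑-cong 𝕍 (λ y → cong (_* g y) (k-cong (⊟-cong eq ≋-refl)))

  convolve-ext : ∀ {d} {k k′ : V d → ℤ} → (∀ x → k x ≡ k′ x) → ∀ g x → convolve k g x ≡ convolve k′ g x
  convolve-ext eq g x = ∑-cong 𝕍 (λ y → cong (_* g y) (eq (x ⊟ y)))

  -- After the sums are exchanged, substituting x - y for y in the inner one leaves a kernel that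
  -- depends on x - z alone.
  convolve-assoc : ∀ {d} {k l : V d → ℤ} → Cong𝕍 k → Cong𝕍 l → ∀ g x →
    convolve k (convolve l g) x ≡ convolve (λ v → ∑[ y ← 𝕍 ] k y * l (v ⊟ y)) g x
  convolve-assoc {d} {k} {l} k-cong l-cong g x = begin
    ∑[ y ← 𝕍 ] k (x ⊟ y) * (∑[ z ← 𝕍 ] l (y ⊟ z) * g z)
      ≡⟨ ∑-cong 𝕍 (λ y → trans (sym (∑-*ˡ 𝕍 (k (x ⊟ y)) (λ z → l (y ⊟ z) * g z)))
          (∑-cong 𝕍 (λ z → sym (ℤ.*-assoc (k (x ⊟ y)) (l (y ⊟ z)) (g z))))) ⟩
    ∑[ y ← 𝕍 ] ∑[ z ← 𝕍 ] k (x ⊟ y) * l (y ⊟ z) * g z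
      ≡⟨ ∑-comm 𝕍 𝕍 _ ⟩
    ∑[ z ← 𝕍 ] ∑[ y ← 𝕍 ] k (x ⊟ y) * l (y ⊟ z) * g z
      ≡⟨ ∑-cong 𝕍 (λ z → trans (∑-*ʳ 𝕍 (g z) (λ y → k (x ⊟ y) * l (y ⊟ z))) (cong (_* g z) (substitute z))) ⟩
    ∑[ z ← 𝕍 ] (∑[ y ← 𝕍 ] k y * l (x ⊟ z ⊟ y)) * g z ∎
    where
    substitute : ∀ z → (∑[ y ← 𝕍 ] k (x ⊟ y) * l (y ⊟ z)) ≡ (∑[ y ← 𝕍 ] k y * l (x ⊟ z ⊟ y))
    substitute z = trans
      (∑-cong 𝕍 (λ y → cong (k (x ⊟ y) *_) (l-cong (λ i →
        solve 3 (λ x y z → y :- z := x :- z :- (x :- y)) ≈-refl (x i) (y i) (z i)))))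
      (∑𝕍-reflect x {λ y → k y * l (x ⊟ z ⊟ y)} (λ eq → cong₂ _*_ (k-cong eq) (l-cong (⊟-cong ≋-refl eq))))

  convolve-symmetric : ∀ {d} {k : V d → ℤ} → (∀ x y → k (x ⊟ y) ≡ k (y ⊟ x)) → ∀ g h →
    ⟨ g , convolve k h ⟩ ≡ ⟨ convolve k g , h ⟩
  convolve-symmetric {d} {k} k-sym g h = begin
    ∑[ x ← 𝕍 ] g x * (∑[ y ← 𝕍 ] k (x ⊟ y) * h y)
      ≡⟨ ∑-cong 𝕍 (λ x → sym (∑-*ˡ 𝕍 (g x) (λ y → k (x ⊟ y) * h y))) ⟩
    ∑[ x ← 𝕍 ] ∑[ y ← 𝕍 ] g x * (k (x ⊟ y) * h y)
      ≡⟨ ∑-comm 𝕍 𝕍 _ ⟩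
    ∑[ y ← 𝕍 ] ∑[ x ← 𝕍 ] g x * (k (x ⊟ y) * h y)
      ≡⟨ ∑-cong 𝕍 (λ y → trans
          (∑-cong 𝕍 (λ x → trans (cong (λ i → g x * (i * h y)) (k-sym x y)) (shuffle (g x) (k (y ⊟ x)) (h y))))
          (∑-*ʳ 𝕍 (h y) (λ x → k (y ⊟ x) * g x))) ⟩
    ∑[ y ← 𝕍 ] (∑[ x ← 𝕍 ] k (y ⊟ x) * g x) * h y ∎
    where
    shuffle : ∀ a b c → a * (b * c) ≡ b * a * c
    shuffle = solve-∀

  ∑-convolve : ∀ {d} {k : V d → ℤ} → Cong𝕍 k → ∀ g → ∑ 𝕍 (convolve k g) ≡ ∑ 𝕍 k * ∑ 𝕍 g
  ∑-convolve {d} {k} k-cong g = begin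
    ∑[ x ← 𝕍 ] ∑[ y ← 𝕍 ] k (x ⊟ y) * g y   ≡⟨ ∑-comm 𝕍 𝕍 _ ⟩
    ∑[ y ← 𝕍 ] ∑[ x ← 𝕍 ] k (x ⊟ y) * g y
      ≡⟨ ∑-cong 𝕍 (λ y → trans (∑-*ʳ 𝕍 (g y) (λ x → k (x ⊟ y))) (cong (_* g y) (shift y))) ⟩
    ∑[ y ← 𝕍 ] ∑ 𝕍 k * g y                  ≡⟨ ∑-*ˡ 𝕍 (∑ 𝕍 k) g ⟩
    ∑ 𝕍 k * ∑ 𝕍 g                           ∎
    where
    shift : ∀ y → (∑[ x ← 𝕍 ] k (x ⊟ y)) ≡ ∑ 𝕍 k
    shift y = trans (∑-cong 𝕍 (λ x → k-cong (λ i → ≈-refl)))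
      (∑𝕍-translate (λ i → ⊖ y i) k-cong)

  ⟨⟩-expand : ∀ {d} (g h : V d → ℤ) t →
    (∑[ x ← 𝕍 ] (g x - t * h x) * (g x - t * h x)) ≡ ⟨ g , g ⟩ + (- (ℤ.+ 2 * t) * ⟨ g , h ⟩ + t * t * ⟨ h , h ⟩)
  ⟨⟩-expand g h t = trans (∑-cong 𝕍 (λ x → expand (g x) (h x) t))
    (trans (∑-+ 𝕍 (λ x → g x * g x) (λ x → - (ℤ.+ 2 * t) * (g x * h x) + t * t * (h x * h x)))
      (cong (⟨ g , g ⟩ +_) (trans (∑-+ 𝕍 (λ x → - (ℤ.+ 2 * t) * (g x * h x)) (λ x → t * t * (h x * h x)))
        (cong₂ _+_ (∑-*ˡ 𝕍 (- (ℤ.+ 2 * t)) (λ x → g x * h x)) (∑-*ˡ 𝕍 (t * t) (λ x → h x * h x))))))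
    where
    expand : ∀ a b t → (a - t * b) * (a - t * b) ≡ a * a + (- (ℤ.+ 2 * t) * (a * b) + t * t * (b * b))
    expand = solve-∀

  ηQ-symmetric : ∀ {d} (x y : V d) → ηQ (x ⊟ y) ≡ ηQ (y ⊟ x)
  ηQ-symmetric x y = η-cong (Q-⊟-comm x y)

  module EnergyBounds {d : ℕ} (r s ε : ℤ) (0<s : 0ℤ < s) (ε²≡1 : ε * ε ≡ 1ℤ)
    (∑𝕍-1 : (∑[ x ← 𝕍 {d} ] 1ℤ) ≡ s * s)
    (∑ηQ : ∑ (𝕍 {d}) ηQ ≡ 0ℤ)
    (isotropic*ηQ : ∀ (v : V d) → (∑[ x ← 𝕍 ] isotropic x * ηQ (v ⊟ x)) ≡ - ε * r * ηQ v)
    (ηQ*ηQ : ∀ (v : V d) → (∑[ x ← 𝕍 ] ηQ x * ηQ (v ⊟ x)) ≡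
      (s * s - s * r) * 𝟙 (v ≋? 𝟎) - ε * s * isotropic v + ε * r) where

    𝓚 𝓩 : (V d → ℤ) → V d → ℤ
    𝓚 = convolve ηQ
    𝓩 = convolve isotropic

    𝓚-cong : ∀ {g} → Cong𝕍 (𝓚 g)
    𝓚-cong {g} = convolve-cong ηQ-cong {g}

    𝓩-cong : ∀ {g} → Cong𝕍 (𝓩 g)
    𝓩-cong {g} = convolve-cong isotropic-cong {g}

    ∑𝓚 : ∀ g → ∑ 𝕍 (𝓚 g) ≡ 0ℤ
    ∑𝓚 g = trans (∑-convolve ηQ-cong g) (cong (_* ∑ 𝕍 g) ∑ηQ)

    𝓩𝓚 : ∀ g x → 𝓩 (𝓚 g) x ≡ - ε * r * 𝓚 g x
    𝓩𝓚 g x = begin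
      𝓩 (𝓚 g) x
        ≡⟨ convolve-assoc {k = isotropic} {l = ηQ} isotropic-cong ηQ-cong g x ⟩
      convolve (λ v → ∑[ y ← 𝕍 ] isotropic y * ηQ (v ⊟ y)) g x ≡⟨ convolve-ext isotropic*ηQ g x ⟩
      ∑[ y ← 𝕍 ] - ε * r * ηQ (x ⊟ y) * g y
        ≡⟨ ∑-cong 𝕍 (λ y → ℤ.*-assoc (- ε * r) (ηQ (x ⊟ y)) (g y)) ⟩
      ∑[ y ← 𝕍 ] - ε * r * (ηQ (x ⊟ y) * g y)       ≡⟨ ∑-*ˡ 𝕍 (- ε * r) (λ y → ηQ (x ⊟ y) * g y) ⟩
      - ε * r * 𝓚 g x                               ∎

    𝓚𝓚 : ∀ {g} → Cong𝕍 g → ∀ x → 𝓚 (𝓚 g) x ≡ (s * s - s * r) * g x + (- (ε * s) * 𝓩 g x + ε * r * ∑ 𝕍 g)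
    𝓚𝓚 {g} g-cong x = begin
      𝓚 (𝓚 g) x
        ≡⟨ convolve-assoc {k = ηQ} {l = ηQ} ηQ-cong ηQ-cong g x ⟩
      convolve (λ v → ∑[ y ← 𝕍 ] ηQ y * ηQ (v ⊟ y)) g x ≡⟨ convolve-ext ηQ*ηQ g x ⟩
      ∑[ y ← 𝕍 ] (A * 𝟙 (x ⊟ y ≋? 𝟎) - ε * s * isotropic (x ⊟ y) + ε * r) * g y
        ≡⟨ ∑-cong 𝕍 (λ y → trans (expand A (𝟙 (x ⊟ y ≋? 𝟎)) (ε * s) (isotropic (x ⊟ y)) (ε * r) (g y))
            (cong (λ i → A * (g y * i) + (- (ε * s) * (isotropic (x ⊟ y) * g y) + ε * r * g y)) (diagonal y))) ⟩
      ∑[ y ← 𝕍 ] A * (g y * 𝟙 (x ≋? y)) + (- (ε * s) * (isotropic (x ⊟ y) * g y) + ε * r * g y)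
        ≡⟨ trans (∑-+ 𝕍 (λ y → A * (g y * 𝟙 (x ≋? y))) (λ y → - (ε * s) * (isotropic (x ⊟ y) * g y) + ε * r * g y))
            (cong₂ _+_ (trans (∑-*ˡ 𝕍 A (λ y → g y * 𝟙 (x ≋? y))) (cong (A *_) (Finite.pick (vector-finite d) g-cong x)))
              (trans (∑-+ 𝕍 (λ y → - (ε * s) * (isotropic (x ⊟ y) * g y)) (λ y → ε * r * g y))
                (cong₂ _+_ (∑-*ˡ 𝕍 (- (ε * s)) (λ y → isotropic (x ⊟ y) * g y)) (∑-*ˡ 𝕍 (ε * r) g)))) ⟩
      A * g x + (- (ε * s) * 𝓩 g x + ε * r * ∑ 𝕍 g) ∎
      where
      A = s * s - s * r
      expand : ∀ a i b z c g → (a * i - b * z + c) * g ≡ a * (g * i) + (- b * (z * g) + c * g)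
      expand = solve-∀
      diagonal : ∀ y → 𝟙 (x ⊟ y ≋? 𝟎) ≡ 𝟙 (x ≋? y)
      diagonal y = 𝟙-cong (x ⊟ y ≋? 𝟎) (x ≋? y) (λ eq i → ⊝-zero (eq i)) (λ eq i → ⊝-self (eq i))

    -- The formula for 𝓚² is applied to 𝓚 g. There 𝓩 acts as -ε r and the total vanishes, so the
    -- contribution ε² s r cancels -s r.
    𝓚𝓚𝓚 : ∀ g x → 𝓚 (𝓚 (𝓚 g)) x ≡ s * s * 𝓚 g x
    𝓚𝓚𝓚 g x = begin
      𝓚 (𝓚 (𝓚 g)) x ≡⟨ 𝓚𝓚 {𝓚 g} (𝓚-cong {g}) x ⟩
      A * 𝓚 g x + (- (ε * s) * 𝓩 (𝓚 g) x + ε * r * ∑ 𝕍 (𝓚 g))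
        ≡⟨ cong₂ (λ i j → A * 𝓚 g x + (- (ε * s) * i + ε * r * j)) (𝓩𝓚 g x) (∑𝓚 g) ⟩
      A * 𝓚 g x + (- (ε * s) * (- ε * r * 𝓚 g x) + ε * r * 0ℤ)
        ≡⟨ collect s r ε (𝓚 g x) ⟩
      (s * s - s * r + ε * ε * (s * r)) * 𝓚 g x
        ≡⟨ cong (λ i → (s * s - s * r + i * (s * r)) * 𝓚 g x) ε²≡1 ⟩
      (s * s - s * r + 1ℤ * (s * r)) * 𝓚 g x
        ≡⟨ cancel s r (𝓚 g x) ⟩
      s * s * 𝓚 g x ∎
      where
      A = s * s - s * r
      collect : ∀ s r e k → (s * s - s * r) * k + (- (e * s) * (- e * r * k) + e * r * 0ℤ) ≡
        (s * s - s * r + e * e * (s * r)) * k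
      collect = solve-∀
      cancel : ∀ s r k → (s * s - s * r + 1ℤ * (s * r)) * k ≡ s * s * k
      cancel = solve-∀

    𝓚-symmetric : ∀ g h → ⟨ g , 𝓚 h ⟩ ≡ ⟨ 𝓚 g , h ⟩
    𝓚-symmetric = convolve-symmetric {k = ηQ} ηQ-symmetric

    -- Symmetry moves one 𝓚 across the pairing and produces 𝓚³. Each pairing of 𝓚𝓚f with itself or
    -- with 𝓚f drops by two powers of 𝓚 in this way.
    ⟨𝓚𝓚,⟩ : ∀ g h → ⟨ 𝓚 (𝓚 g) , 𝓚 h ⟩ ≡ s * s * ⟨ 𝓚 g , h ⟩
    ⟨𝓚𝓚,⟩ g h = begin
      ⟨ 𝓚 (𝓚 g) , 𝓚 h ⟩                ≡⟨ 𝓚-symmetric (𝓚 (𝓚 g)) h ⟩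
      ⟨ 𝓚 (𝓚 (𝓚 g)) , h ⟩
        ≡⟨ ∑-cong 𝕍 (λ x → trans (cong (_* h x) (𝓚𝓚𝓚 g x)) (ℤ.*-assoc (s * s) (𝓚 g x) (h x))) ⟩
      ∑[ x ← 𝕍 ] s * s * (𝓚 g x * h x) ≡⟨ ∑-*ˡ 𝕍 (s * s) (λ x → 𝓚 g x * h x) ⟩
      s * s * ⟨ 𝓚 g , h ⟩              ∎

    0<s*s : 0ℤ < s * s
    0<s*s = ℤ.≤-<-trans (ℤ.≤-reflexive (sym (ℤ.*-zeroʳ s))) (ℤ.*-monoˡ-<-pos s {{ℤ.positive 0<s}} 0<s)

    -- |𝓚𝓚f - s 𝓚f|² = 2s²(⟨f, 𝓚𝓚f⟩ - s ⟨f, 𝓚f⟩) because 𝓚³ = s² 𝓚.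
    first-bound : ∀ f → s * ⟨ f , 𝓚 f ⟩ ≤ ⟨ f , 𝓚 (𝓚 f) ⟩
    first-bound f = ℤ.0≤i-j⇒j≤i (cancel-positive 0<2s*s (ℤ.≤-trans
      (∑-nonneg 𝕍 (λ x → 0≤i*i (𝓚 (𝓚 f) x - s * 𝓚 f x))) (ℤ.≤-reflexive (begin
        ∑[ x ← 𝕍 ] (𝓚 (𝓚 f) x - s * 𝓚 f x) * (𝓚 (𝓚 f) x - s * 𝓚 f x)
          ≡⟨ ⟨⟩-expand (𝓚 (𝓚 f)) (𝓚 f) s ⟩
        ⟨ 𝓚 (𝓚 f) , 𝓚 (𝓚 f) ⟩ + (- (ℤ.+ 2 * s) * ⟨ 𝓚 (𝓚 f) , 𝓚 f ⟩ + s * s * ⟨ 𝓚 f , 𝓚 f ⟩)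
          ≡⟨ cong₂ (λ i j → i + (- (ℤ.+ 2 * s) * j + s * s * ⟨ 𝓚 f , 𝓚 f ⟩)) (⟨𝓚𝓚,⟩ f (𝓚 f)) (⟨𝓚𝓚,⟩ f f) ⟩
        s * s * ⟨ 𝓚 f , 𝓚 f ⟩ + (- (ℤ.+ 2 * s) * (s * s * ⟨ 𝓚 f , f ⟩) + s * s * ⟨ 𝓚 f , 𝓚 f ⟩)
          ≡⟨ collect s ⟨ 𝓚 f , 𝓚 f ⟩ ⟨ 𝓚 f , f ⟩ ⟩
        ℤ.+ 2 * (s * s) * (⟨ 𝓚 f , 𝓚 f ⟩ - s * ⟨ 𝓚 f , f ⟩)
          ≡⟨ cong₂ (λ i j → ℤ.+ 2 * (s * s) * (i - s * j)) (𝓚-symmetric f (𝓚 f)) (𝓚-symmetric f f) ⟨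
        ℤ.+ 2 * (s * s) * (⟨ f , 𝓚 (𝓚 f) ⟩ - s * ⟨ f , 𝓚 f ⟩) ∎))))
      where
      0<2s*s : 0ℤ < ℤ.+ 2 * (s * s)
      0<2s*s = ℤ.*-monoˡ-<-pos (ℤ.+ 2) 0<s*s
      collect : ∀ s a b → s * s * a + (- (ℤ.+ 2 * s) * (s * s * b) + s * s * a) ≡ ℤ.+ 2 * (s * s) * (a - s * b)
      collect = solve-∀

    -- |s² f - ∑f - 𝓚𝓚f|² = s²(s² |f|² - (∑f)² - ⟨f, 𝓚𝓚f⟩).
    second-bound : ∀ f → ⟨ f , 𝓚 (𝓚 f) ⟩ + ∑ 𝕍 f * ∑ 𝕍 f ≤ s * s * ⟨ f , f ⟩
    second-bound f = ℤ.0≤i-j⇒j≤i (cancel-positive 0<s*s (ℤ.≤-trans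
      (∑-nonneg 𝕍 (λ x → 0≤i*i (u x - 1ℤ * G x))) (ℤ.≤-reflexive (begin
        ∑[ x ← 𝕍 ] (u x - 1ℤ * G x) * (u x - 1ℤ * G x)
          ≡⟨ ⟨⟩-expand u G 1ℤ ⟩
        ⟨ u , u ⟩ + (- (ℤ.+ 2 * 1ℤ) * ⟨ u , G ⟩ + 1ℤ * 1ℤ * ⟨ G , G ⟩)
          ≡⟨ cong₂ _+_ uu (cong₂ (λ i j → - (ℤ.+ 2 * 1ℤ) * i + 1ℤ * 1ℤ * j) uG GG) ⟩
        s * s * (s * s) * ⟨ f , f ⟩ + (- (ℤ.+ 2 * (s * s) * σ) * σ + σ * σ * (s * s)) +
          (- (ℤ.+ 2 * 1ℤ) * (s * s * ⟨ f , G ⟩ + (- σ) * 0ℤ) + 1ℤ * 1ℤ * (s * s * ⟨ f , G ⟩))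
          ≡⟨ collect (s * s) ⟨ f , f ⟩ ⟨ f , G ⟩ σ ⟩
        s * s * (s * s * ⟨ f , f ⟩ - (⟨ f , G ⟩ + σ * σ)) ∎))))
      where
      σ = ∑ 𝕍 f
      G = 𝓚 (𝓚 f)
      u : V d → ℤ
      u x = s * s * f x - σ
      collect : ∀ t a b σ → t * t * a + (- (ℤ.+ 2 * t * σ) * σ + σ * σ * t) +
        (- (ℤ.+ 2 * 1ℤ) * (t * b + (- σ) * 0ℤ) + 1ℤ * 1ℤ * (t * b)) ≡ t * (t * a - (b + σ * σ))
      collect = solve-∀
      uu : ⟨ u , u ⟩ ≡ s * s * (s * s) * ⟨ f , f ⟩ + (- (ℤ.+ 2 * (s * s) * σ) * σ + σ * σ * (s * s))
      uu = trans (∑-cong 𝕍 (λ x → expand (s * s) (f x) σ))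
        (trans (∑-+ 𝕍 (λ x → s * s * (s * s) * (f x * f x)) (λ x → - (ℤ.+ 2 * (s * s) * σ) * f x + σ * σ * 1ℤ))
          (cong₂ _+_ (∑-*ˡ 𝕍 (s * s * (s * s)) (λ x → f x * f x))
            (trans (∑-+ 𝕍 (λ x → - (ℤ.+ 2 * (s * s) * σ) * f x) (λ _ → σ * σ * 1ℤ))
              (cong₂ _+_ (∑-*ˡ 𝕍 (- (ℤ.+ 2 * (s * s) * σ)) f)
                (trans (∑-*ˡ 𝕍 (σ * σ) (λ _ → 1ℤ)) (cong (σ * σ *_) ∑𝕍-1))))))
        where
        expand : ∀ t a σ → (t * a - σ) * (t * a - σ) ≡ t * t * (a * a) + (- (ℤ.+ 2 * t * σ) * a + σ * σ * 1ℤ)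
        expand = solve-∀
      -- G has total 0, like every function in the image of 𝓚, so the constant part of u is
      -- orthogonal to it.
      uG : ⟨ u , G ⟩ ≡ s * s * ⟨ f , G ⟩ + (- σ) * 0ℤ
      uG = trans (∑-cong 𝕍 (λ x → expand (s * s) (f x) σ (G x)))
        (trans (∑-+ 𝕍 (λ x → s * s * (f x * G x)) (λ x → (- σ) * G x))
          (cong₂ _+_ (∑-*ˡ 𝕍 (s * s) (λ x → f x * G x))
            (trans (∑-*ˡ 𝕍 (- σ) G) (cong ((- σ) *_) (∑𝓚 (𝓚 f))))))
        where
        expand : ∀ t a σ g → (t * a - σ) * g ≡ t * (a * g) + (- σ) * g
        expand = solve-∀
      GG : ⟨ G , G ⟩ ≡ s * s * ⟨ f , G ⟩
      GG = trans (⟨𝓚𝓚,⟩ f (𝓚 f)) (cong (s * s *_) (sym (𝓚-symmetric f (𝓚 f))))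

    module _ (A : Subset F d) where
      open Subset A

      -- Defined as a multiplicity in the list, which makes every pairing with it a sum over
      -- `elements`. Freedom from repetition enters only when its squared norm is identified with
      -- the cardinality.
      indicator : V d → ℤ
      indicator x = ∑[ a ← elements ] 𝟙 (a ≋? x)

      size energy isotropic-pairs : ℤ
      size = ℤ.+ ∣ A ∣
      energy = ∑[ a ← elements ] ∑[ b ← elements ] ηQ (a ⊟ b)
      isotropic-pairs = ∑[ a ← elements ] ∑[ b ← elements ] isotropic (a ⊟ b)

      𝟙≋-cong : ∀ a → Cong𝕍 {d} (λ x → 𝟙 (a ≋? x))
      𝟙≋-cong a {x} {y} eq = 𝟙-cong (a ≋? x) (a ≋? y) (λ eq′ → ≋-trans eq′ eq) (λ eq′ → ≋-trans eq′ (≋-sym eq))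

      ∑-indicator : ∀ {h} → Cong𝕍 h → (∑[ x ← 𝕍 ] h x * indicator x) ≡ ∑ elements h
      ∑-indicator {h} h-cong = begin
        ∑[ x ← 𝕍 ] h x * (∑[ a ← elements ] 𝟙 (a ≋? x))
          ≡⟨ ∑-cong 𝕍 (λ x → sym (∑-*ˡ elements (h x) (λ a → 𝟙 (a ≋? x)))) ⟩
        ∑[ x ← 𝕍 ] ∑[ a ← elements ] h x * 𝟙 (a ≋? x)   ≡⟨ ∑-comm 𝕍 elements _ ⟩
        ∑[ a ← elements ] ∑[ x ← 𝕍 ] h x * 𝟙 (a ≋? x)
          ≡⟨ ∑-cong elements (Finite.pick (vector-finite d) h-cong) ⟩
        ∑ elements h                                    ∎

      ⟨indicator,⟩ : ∀ {h} → Cong𝕍 h → ⟨ indicator , h ⟩ ≡ ∑ elements h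
      ⟨indicator,⟩ {h} h-cong = trans (∑-cong 𝕍 (λ x → ℤ.*-comm (indicator x) (h x))) (∑-indicator h-cong)

      convolve-indicator : ∀ {k} → Cong𝕍 k → ⟨ indicator , convolve k indicator ⟩ ≡
        (∑[ a ← elements ] ∑[ b ← elements ] k (a ⊟ b))
      convolve-indicator {k} k-cong = trans (⟨indicator,⟩ (convolve-cong k-cong {indicator}))
        (∑-cong elements (λ a → ∑-indicator {λ y → k (a ⊟ y)} (λ eq → k-cong (⊟-cong ≋-refl eq))))

      indicator-cong : Cong𝕍 indicator
      indicator-cong eq = ∑-cong elements (λ a → 𝟙≋-cong a eq)

      ∑indicator : ∑ 𝕍 indicator ≡ size
      ∑indicator = trans (∑-cong 𝕍 (λ x → sym (ℤ.*-identityˡ (indicator x))))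
        (trans (∑-indicator {λ _ → 1ℤ} (λ _ → refl)) (trans (∑-const elements 1ℤ) (ℤ.*-identityʳ size)))

      ⟨indicator,indicator⟩ : ⟨ indicator , indicator ⟩ ≡ size
      ⟨indicator,indicator⟩ = trans (⟨indicator,⟩ indicator-cong) (coincidences elements unique)
        where
        open UniqueSetoid (≋-setoid d) using (Unique)
        absent : ∀ {x xs} → All (λ y → ¬ x ≋ y) xs → (∑[ y ← xs ] 𝟙 (x ≋? y)) ≡ 0ℤ
        absent [] = refl
        absent {x} {y ∷ _} (x≉y ∷ rest) = cong₂ _+_ (𝟙-no (x ≋? y) x≉y) (absent rest)
        absent′ : ∀ {x xs} → All (λ y → ¬ x ≋ y) xs → (∑[ y ← xs ] 𝟙 (y ≋? x)) ≡ 0ℤ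
        absent′ {x} {xs} x∉xs = trans
          (∑-cong xs (λ y → 𝟙-cong (y ≋? x) (x ≋? y) ≋-sym ≋-sym)) (absent x∉xs)
        coincidences : ∀ xs → Unique xs → (∑[ x ← xs ] ∑[ y ← xs ] 𝟙 (y ≋? x)) ≡ ℤ.+ length xs
        coincidences [] [] = refl
        coincidences (x ∷ xs) (x∉xs ∷ unique) = begin
          𝟙 (x ≋? x) + (∑[ y ← xs ] 𝟙 (y ≋? x)) + (∑[ z ← xs ] 𝟙 (x ≋? z) + (∑[ y ← xs ] 𝟙 (y ≋? z)))
            ≡⟨ cong₂ _+_ (cong₂ _+_ (𝟙-yes (x ≋? x) ≋-refl) (absent′ x∉xs))
                (trans (∑-+ xs (λ z → 𝟙 (x ≋? z)) (λ z → ∑[ y ← xs ] 𝟙 (y ≋? z)))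
                  (cong₂ _+_ (absent x∉xs) (coincidences xs unique))) ⟩
          1ℤ + 0ℤ + (0ℤ + ℤ.+ length xs) ≡⟨ cong (1ℤ +_) (ℤ.+-identityˡ (ℤ.+ length xs)) ⟩
          ℤ.+ length (x ∷ xs) ∎

      -- The squared norm of the indicator counts coincident pairs, and each of these has difference
      -- 0, hence Q = 0.
      size≤isotropic-pairs : size ≤ isotropic-pairs
      size≤isotropic-pairs = ℤ.≤-trans
        (ℤ.≤-reflexive (sym (trans (sym (⟨indicator,⟩ indicator-cong)) ⟨indicator,indicator⟩)))
        (∑-mono elements (λ a → ∑-mono elements (λ b → below a b)))
        where
        below : ∀ a b → 𝟙 (b ≋? a) ≤ isotropic (a ⊟ b)
        below a b = by-cases (b ≋? a)
          where
          by-cases : (b≋?a : Dec (b ≋ a)) → 𝟙 b≋?a ≤ isotropic (a ⊟ b)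
          by-cases (no _) = 0≤𝟙 (Q (a ⊟ b) ≟ 0#)
          by-cases (yes b≋a) = ℤ.≤-reflexive (sym (𝟙-yes (Q (a ⊟ b) ≟ 0#)
            (≈-trans (Q-cong (λ i → ⊝-self (≈-sym (b≋a i)))) (𝟎-∙ (𝟎 {d})))))

      square-form : ⟨ indicator , 𝓚 (𝓚 indicator) ⟩ ≡
        (s * s - s * r) * size + (- (ε * s) * isotropic-pairs + ε * r * size * size)
      square-form = begin
        ⟨ indicator , 𝓚 (𝓚 indicator) ⟩
          ≡⟨ ⟨indicator,⟩ (𝓚-cong {𝓚 indicator}) ⟩
        ∑[ a ← elements ] 𝓚 (𝓚 indicator) a
          ≡⟨ ∑-cong elements (λ a → trans (𝓚𝓚 indicator-cong a) (cong (λ i → B * indicator a + (- (ε * s) * 𝓩 indicator a + ε * r * i)) ∑indicator)) ⟩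
        ∑[ a ← elements ] B * indicator a + (- (ε * s) * 𝓩 indicator a + ε * r * size)
          ≡⟨ trans (∑-+ elements (λ a → B * indicator a) (λ a → - (ε * s) * 𝓩 indicator a + ε * r * size))
              (cong₂ _+_ (∑-*ˡ elements B indicator)
                (trans (∑-+ elements (λ a → - (ε * s) * 𝓩 indicator a) (λ _ → ε * r * size))
                  (cong₂ _+_ (∑-*ˡ elements (- (ε * s)) (𝓩 indicator)) (∑-const elements (ε * r * size))))) ⟩
        B * ∑ elements indicator + (- (ε * s) * ∑ elements (𝓩 indicator) + size * (ε * r * size))
          ≡⟨ cong₂ (λ i j → B * i + (- (ε * s) * j + size * (ε * r * size)))
              (trans (sym (⟨indicator,⟩ indicator-cong)) ⟨indicator,indicator⟩)
              (trans (sym (⟨indicator,⟩ (𝓩-cong {indicator}))) (convolve-indicator {isotropic} isotropic-cong)) ⟩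
        B * size + (- (ε * s) * isotropic-pairs + size * (ε * r * size))
          ≡⟨ cong (λ i → B * size + (- (ε * s) * isotropic-pairs + i)) (ℤ.*-comm size (ε * r * size)) ⟩
        B * size + (- (ε * s) * isotropic-pairs + ε * r * size * size) ∎
        where
        B = s * s - s * r

      energy-bound : s * energy ≤ (s * s - s * r) * size + (- (ε * s) * isotropic-pairs + ε * r * size * size)
      energy-bound = subst₂ (λ i j → s * i ≤ j) (convolve-indicator {ηQ} ηQ-cong) square-form (first-bound indicator)

      isotropic-bound : (s * s - s * r) * size + (- (ε * s) * isotropic-pairs + ε * r * size * size) + size * size
        ≤ s * s * size
      isotropic-bound = subst₂ (λ i j → i + j * j ≤ s * s * size) square-form ∑indicator
        (subst (λ i → ⟨ indicator , 𝓚 (𝓚 indicator) ⟩ + ∑ 𝕍 indicator * ∑ 𝕍 indicator ≤ s * s * i)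
          ⟨indicator,indicator⟩ (second-bound indicator))

      length-filter : ∀ {a p} {X : Set a} {P : X → Set p} (P? : Decidable P) xs →
        ℤ.+ length (filter P? xs) ≡ (∑[ x ← xs ] 𝟙 (P? x))
      length-filter P? [] = refl
      length-filter P? (x ∷ xs) with P? x
      ... | yes _ = cong (1ℤ +_) (length-filter P? xs)
      ... | no _ = trans (length-filter P? xs) (sym (ℤ.+-identityˡ _))

      -- Pointwise, twice the indicator of η(t) = 1 is 1 - 𝟙(t = 0) + η(t); the identity is summed
      -- over all pairs.
      SQ-expansion : ℤ.+ 2 * ℤ.+ SQ A ≡ size * size - isotropic-pairs + energy
      SQ-expansion = begin
        ℤ.+ 2 * ℤ.+ SQ A
          ≡⟨ cong (ℤ.+ 2 *_) (trans (length-filter _ (cartesianProduct elements elements)) (∑-cartesianProductWith _,_ elements elements _)) ⟩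
        ℤ.+ 2 * (∑[ a ← elements ] ∑[ b ← elements ] 𝟙 (η F (Q (a ⊟ b)) ℤ.≟ 1ℤ))
          ≡⟨ ∑-*ˡ elements (ℤ.+ 2) _ ⟨
        ∑[ a ← elements ] ℤ.+ 2 * (∑[ b ← elements ] 𝟙 (η F (Q (a ⊟ b)) ℤ.≟ 1ℤ))
          ≡⟨ ∑-cong elements (λ a → sym (∑-*ˡ elements (ℤ.+ 2) (λ b → 𝟙 (η F (Q (a ⊟ b)) ℤ.≟ 1ℤ)))) ⟩
        ∑[ a ← elements ] ∑[ b ← elements ] ℤ.+ 2 * 𝟙 (η F (Q (a ⊟ b)) ℤ.≟ 1ℤ)
          ≡⟨ ∑-cong elements (λ a → ∑-cong elements (λ b → trans
              (cong (λ i → ℤ.+ 2 * 𝟙 (i ℤ.≟ 1ℤ)) (sym (η′≡η (Q (a ⊟ b))))) (pointwise (Q (a ⊟ b))))) ⟩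
        ∑[ a ← elements ] ∑[ b ← elements ] 1ℤ + (-1ℤ * isotropic (a ⊟ b) + ηQ (a ⊟ b))
          ≡⟨ ∑-cong elements (λ a → trans (∑-+ elements (λ _ → 1ℤ) (λ b → -1ℤ * isotropic (a ⊟ b) + ηQ (a ⊟ b)))
              (cong₂ _+_ (trans (∑-const elements 1ℤ) (ℤ.*-identityʳ size))
                (trans (∑-+ elements (λ b → -1ℤ * isotropic (a ⊟ b)) (λ b → ηQ (a ⊟ b)))
                  (cong (_+ (∑[ b ← elements ] ηQ (a ⊟ b))) (∑-*ˡ elements -1ℤ (λ b → isotropic (a ⊟ b))))))) ⟩
        ∑[ a ← elements ] size + (-1ℤ * (∑[ b ← elements ] isotropic (a ⊟ b)) + (∑[ b ← elements ] ηQ (a ⊟ b)))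
          ≡⟨ trans (∑-+ elements (λ _ → size) (λ a → -1ℤ * (∑[ b ← elements ] isotropic (a ⊟ b)) + (∑[ b ← elements ] ηQ (a ⊟ b))))
              (cong₂ _+_ (∑-const elements size)
                (trans (∑-+ elements (λ a → -1ℤ * (∑[ b ← elements ] isotropic (a ⊟ b))) (λ a → ∑[ b ← elements ] ηQ (a ⊟ b)))
                  (cong (_+ energy) (∑-*ˡ elements -1ℤ (λ a → ∑[ b ← elements ] isotropic (a ⊟ b)))))) ⟩
        size * size + (-1ℤ * isotropic-pairs + energy)
          ≡⟨ tidy (size * size) isotropic-pairs energy ⟩
        size * size - isotropic-pairs + energy ∎
        where
        tidy : ∀ n z e → n + (-1ℤ * z + e) ≡ n - z + e
        tidy = solve-∀
        pointwise : ∀ t → ℤ.+ 2 * 𝟙 (η′ t ℤ.≟ 1ℤ) ≡ 1ℤ + (-1ℤ * 𝟙 (t ≟ 0#) + η′ t)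
        pointwise t with residue t
        ... | zero t≈0 eq rewrite eq | 𝟙-yes (t ≟ 0#) t≈0 = refl
        ... | square t≉0 _ eq rewrite eq | 𝟙-no (t ≟ 0#) t≉0 = refl
        ... | nonsquare t≉0 _ eq rewrite eq | 𝟙-no (t ≟ 0#) t≉0 = refl

-- The parameters in dimension 2(m + 1) and the three bounds over the integers

module EvenDimension {c ℓ₁ ℓ₂} {q : ℕ} (F : FiniteField c ℓ₁ ℓ₂ q) (q-odd : q % 2 ≡ 1) (m : ℕ) where

  open Sums
  open QuadraticCharacter F q-odd
  open CharacterSums F q-odd
  open QuadraticSpace F q-odd
  open Kernels F q-odd
  open Energy F q-odd
  open import Data.Integer.Base as ℤ using (ℤ; 0ℤ; 1ℤ; -1ℤ; _+_; _*_; -_; _-_; _^_; _≤_; _<_)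
  import Data.Integer.Properties as ℤ
  open import Data.Integer.Tactic.RingSolver using (solve-∀)
  import Data.Nat.Base as ℕ
  open import Relation.Binary.PropositionalEquality.Core
    using (refl; sym; trans; cong; cong₂; subst)
  open import Relation.Binary.PropositionalEquality.Properties using (module ≡-Reasoning)

  -- Here m is half the dimension minus one, so that r = q^m is a power without truncated
  -- subtraction and the sign is κ^(m+1).
  d : ℕ
  d = ℕ.suc m ℕ.* 2

  r s ε : ℤ
  r = qℤ ^ m
  s = qℤ * r
  ε = κ ^ ℕ.suc m

  private
    ^-double : ∀ i n → i ^ (n ℕ.* 2) ≡ i ^ n * i ^ n
    ^-double i n = trans (sym (ℤ.^-*-assoc i n 2)) (cong (i ^ n *_) (ℤ.*-identityʳ (i ^ n)))

    ^-square : ∀ n → κ ^ n * κ ^ n ≡ 1ℤ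
    ^-square ℕ.zero = refl
    ^-square (ℕ.suc n) = trans (lemma κ (κ ^ n)) (cong₂ _*_ κ²≡1 (^-square n))
      where
      lemma : ∀ k j → k * j * (k * j) ≡ k * k * (j * j)
      lemma = solve-∀

    ^-distrib : ∀ i j n → (i * j) ^ n ≡ i ^ n * j ^ n
    ^-distrib i j ℕ.zero = refl
    ^-distrib i j (ℕ.suc n) = trans (cong (i * j *_) (^-distrib i j n)) (lemma i j (i ^ n) (j ^ n))
      where
      lemma : ∀ i j k l → i * j * (k * l) ≡ i * k * (j * l)
      lemma = solve-∀

    0<q : 0ℤ < qℤ
    0<q = ℤ.≤∧≢⇒< (ℤ.+≤+ ℕ.z≤n) (λ eq → q≢0 (sym eq))

    0<q^ : ∀ n → 0ℤ < qℤ ^ n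
    0<q^ ℕ.zero = ℤ.+<+ (ℕ.s≤s ℕ.z≤n)
    0<q^ (ℕ.suc n) = ℤ.≤-<-trans (ℤ.≤-reflexive (sym (ℤ.*-zeroʳ qℤ)))
      (ℤ.*-monoˡ-<-pos qℤ {{ℤ.positive 0<q}} (0<q^ n))

  0<s : 0ℤ < s
  0<s = 0<q^ (ℕ.suc m)

  ε²≡1 : ε * ε ≡ 1ℤ
  ε²≡1 = ^-square (ℕ.suc m)

  ∑𝕍-1 : (∑[ x ← 𝕍 {d} ] 1ℤ) ≡ s * s
  ∑𝕍-1 = trans (∑𝕍-const d 1ℤ) (trans (ℤ.*-identityʳ (qℤ ^ d)) (^-double qℤ (ℕ.suc m)))

  ∑ηQ : ∑ (𝕍 {d}) ηQ ≡ 0ℤ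
  ∑ηQ = trans (∑-Q (ℕ.suc m) η-cong) (trans
    (cong₂ (λ i j → (κ * qℤ) ^ ℕ.suc m * i + spread (ℕ.suc m) * j) (η-zero ≈-refl) ∑η)
    (cong₂ _+_ (ℤ.*-zeroʳ ((κ * qℤ) ^ ℕ.suc m)) (ℤ.*-zeroʳ (spread (ℕ.suc m)))))

  spread-value : spread (ℕ.suc m) ≡ s * r - ε * r
  spread-value = *-cancel q≢0 (begin
    qℤ * spread (ℕ.suc m)      ≡⟨ q*spread (ℕ.suc m) ⟩
    s * s - (κ * qℤ) ^ ℕ.suc m ≡⟨ cong (λ i → s * s - i) (^-distrib κ qℤ (ℕ.suc m)) ⟩
    s * s - ε * (qℤ * r)       ≡⟨ lemma qℤ r ε ⟩
    qℤ * (s * r - ε * r)       ∎)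
    where
    open ≡-Reasoning
    lemma : ∀ q r e → q * r * (q * r) - e * (q * r) ≡ q * (q * r * r - e * r)
    lemma = solve-∀

  ∑isotropic : ∑ (𝕍 {d}) isotropic ≡ s * r - ε * r + ε * s
  ∑isotropic = begin
    ∑ (𝕍 {d}) isotropic
      ≡⟨ ∑-Q (ℕ.suc m) {λ t → 𝟙 (t ≟ 0#)} (λ eq → 𝟙≈-cong eq ≈-refl) ⟩
    (κ * qℤ) ^ ℕ.suc m * 𝟙 (0# ≟ 0#) + spread (ℕ.suc m) * (∑[ t ← 𝔽 ] 𝟙 (t ≟ 0#))
      ≡⟨ cong₂ (λ i j → (κ * qℤ) ^ ℕ.suc m * i + spread (ℕ.suc m) * j) (𝟙-yes (0# ≟ 0#) ≈-refl)
          (trans (∑-cong 𝔽 (λ t → 𝟙≈-sym t 0#)) (once𝔽 0#)) ⟩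
    (κ * qℤ) ^ ℕ.suc m * 1ℤ + spread (ℕ.suc m) * 1ℤ
      ≡⟨ cong₂ (λ i j → i * 1ℤ + j * 1ℤ) (^-distrib κ qℤ (ℕ.suc m)) spread-value ⟩
    ε * s * 1ℤ + (s * r - ε * r) * 1ℤ
      ≡⟨ lemma (ε * s) (s * r - ε * r) ⟩
    s * r - ε * r + ε * s ∎
    where
    open ≡-Reasoning
    lemma : ∀ i j → i * 1ℤ + j * 1ℤ ≡ j + i
    lemma = solve-∀

  open Convolutions r s ε refl ∑𝕍-1 ∑ηQ ∑isotropic
  open EnergyBounds r s ε 0<s ε²≡1 ∑𝕍-1 ∑ηQ isotropic*ηQ ηQ*ηQ

  module _ (A : Subset F d) where

    private
      n Z E N : ℤ
      n = ℤ.+ ∣ A ∣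
      N = ℤ.+ SQ A
      E = energy A
      Z = isotropic-pairs A

      -- The value of ⟨f, 𝓚𝓚f⟩ with the sign as an argument, so that a known value of ε can be put
      -- in before ring identities are checked.
      M : ℤ → ℤ
      M e = (s * s - s * r) * n + (- (e * s) * Z + e * r * n * n)

      2N : ℤ.+ 2 * N ≡ n * n - Z + E
      2N = SQ-expansion A

      energy-slack : ∀ {e} → ε ≡ e → 0ℤ ≤ M e - s * E
      energy-slack eq = subst (λ e → 0ℤ ≤ M e - s * E) eq (ℤ.i≤j⇒0≤j-i (energy-bound A))

      isotropic-slack : ∀ {e} → ε ≡ e → 0ℤ ≤ s * s * n - (M e + n * n)
      isotropic-slack eq = subst (λ e → 0ℤ ≤ s * s * n - (M e + n * n)) eq (ℤ.i≤j⇒0≤j-i (isotropic-bound A))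

      diagonal-slack : 0ℤ ≤ s * (Z - n)
      diagonal-slack = ℤ.≤-trans (ℤ.≤-reflexive (sym (ℤ.*-zeroʳ s)))
        (ℤ.*-monoˡ-≤-nonNeg s {{ℤ.nonNegative (ℤ.<⇒≤ 0<s)}} (ℤ.i≤j⇒0≤j-i
          (size≤isotropic-pairs A)))

      -- Each bound is certified by an exact ring identity: right-hand side minus s · 2N is a
      -- combination of quantities already known to be nonnegative.
      by-slack : ∀ {i j} → 0ℤ ≤ j → i - s * (n * n - Z + E) ≡ j → N * (ℤ.+ 2 * s) ≤ i
      by-slack {i} 0≤j eq = ℤ.0≤i-j⇒j≤i (ℤ.≤-trans 0≤j (ℤ.≤-reflexive (sym (trans
        (cong (λ j → i - j) (trans (shuffle N s) (cong (s *_) 2N))) eq))))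
        where
        shuffle : ∀ n s → n * (ℤ.+ 2 * s) ≡ s * (ℤ.+ 2 * n)
        shuffle = solve-∀

    -- The energy inequality contributes +s Z, which cancels the -s Z from the expansion of 2 s N.
    -- In this and the next two bounds each term is a numerator over the common denominator 2 s,
    -- left unsimplified to match the fractions term by term.
    bound-ε≡-1 : ε ≡ -1ℤ → N * (ℤ.+ 2 * s) ≤ n * n * s + s * n * s - n * n * r - r * n * s
    bound-ε≡-1 eq = by-slack (energy-slack eq) (identity n s r Z E)
      where
      identity : ∀ n s r z e → n * n * s + s * n * s - n * n * r - r * n * s - s * (n * n - z + e) ≡
        (s * s - s * r) * n + (- (-1ℤ * s) * z + -1ℤ * r * n * n) - s * e
      identity = solve-∀

    -- The energy inequality now contributes a second -s Z; two copies of the isotropic inequality,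
    -- each bounding -s Z from above, absorb both. They are the source of the term 2 n².
    bound-ε≡1 : ε ≡ 1ℤ → N * (ℤ.+ 2 * s) ≤
      n * n * s + s * n * s - n * n * ℤ.+ 2 - n * n * r + r * n * s
    bound-ε≡1 eq = by-slack
      (ℤ.+-mono-≤ (energy-slack eq) (ℤ.+-mono-≤ (isotropic-slack eq) (isotropic-slack eq)))
      (identity n s r Z E)
      where
      identity : ∀ n s r z e → n * n * s + s * n * s - n * n * ℤ.+ 2 - n * n * r + r * n * s - s * (n * n - z + e) ≡
        (s * s - s * r) * n + (- (1ℤ * s) * z + 1ℤ * r * n * n) - s * e +
        (s * s * n - ((s * s - s * r) * n + (- (1ℤ * s) * z + 1ℤ * r * n * n) + n * n) +
        (s * s * n - ((s * s - s * r) * n + (- (1ℤ * s) * z + 1ℤ * r * n * n) + n * n)))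
      identity = solve-∀

    -- Energy and isotropic inequality add up to s E + n² ≤ s² n, free of Z, r and ε. The remaining
    -- -Z is at most -n.
    bound-diagonal : N * (ℤ.+ 2 * s) ≤ n * n * s + s * n * s - n * n * 1ℤ - n * s
    bound-diagonal = by-slack
      (ℤ.+-mono-≤ (energy-slack {ε} refl) (ℤ.+-mono-≤ (isotropic-slack {ε} refl) diagonal-slack))
      (identity n s r Z E ε)
      where
      identity : ∀ n s r z e t → n * n * s + s * n * s - n * n * 1ℤ - n * s - s * (n * n - z + e) ≡
        (s * s - s * r) * n + (- (t * s) * z + t * r * n * n) - s * e +
        (s * s * n - ((s * s - s * r) * n + (- (t * s) * z + t * r * n * n) + n * n) + s * (z - n))
      identity = solve-∀

-- Arithmetic of rational fractions with equal denominators

module Fractions where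

  open import Data.Integer.Base as ℤ using (ℤ)
  import Data.Integer.Properties as ℤ
  open import Data.Integer.Tactic.RingSolver using (solve-∀)
  open import Data.Nat.Base as ℕ using (ℕ; suc; NonZero)
  open import Data.Rational.Base as ℚ using (ℚ; toℚᵘ)
  import Data.Rational.Properties as ℚ
  open import Data.Rational.Unnormalised.Base as ℚᵘ using (mkℚᵘ; *≡*; *≤*)
  import Data.Rational.Unnormalised.Properties as ℚᵘ
  open import Relation.Binary.PropositionalEquality.Core using (refl; sym; trans; cong; cong₂)

  toℚᵘ-/ : ∀ i k → toℚᵘ (i ℚ./ suc k) ℚᵘ.≃ mkℚᵘ i k
  toℚᵘ-/ i k = ℚ.toℚᵘ-fromℚᵘ (mkℚᵘ i k)

  /-+ : ∀ i j n .{{_ : NonZero n}} → i ℚ./ n ℚ.+ j ℚ./ n ≡ (i ℤ.+ j) ℚ./ n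
  /-+ i j (suc k) = ℚ.toℚᵘ-injective (ℚᵘ.≃-trans (ℚ.toℚᵘ-homo-+ (i ℚ./ suc k) (j ℚ./ suc k))
    (ℚᵘ.≃-trans (ℚᵘ.+-cong (toℚᵘ-/ i k) (toℚᵘ-/ j k))
      (ℚᵘ.≃-trans (*≡* (lemma i j (ℤ.+ suc k))) (ℚᵘ.≃-sym (toℚᵘ-/ (i ℤ.+ j) k)))))
    where
    lemma : ∀ i j n → (i ℤ.* n ℤ.+ j ℤ.* n) ℤ.* n ≡ (i ℤ.+ j) ℤ.* (n ℤ.* n)
    lemma = solve-∀

  /-neg : ∀ i n .{{_ : NonZero n}} → ℚ.- (i ℚ./ n) ≡ (ℤ.- i) ℚ./ n
  /-neg i (suc k) = ℚ.toℚᵘ-injective (ℚᵘ.≃-trans (ℚ.toℚᵘ-homo‿- (i ℚ./ suc k))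
    (ℚᵘ.≃-trans (ℚᵘ.-‿cong (toℚᵘ-/ i k)) (ℚᵘ.≃-sym (toℚᵘ-/ (ℤ.- i) k))))

  /-- : ∀ i j n .{{_ : NonZero n}} → i ℚ./ n ℚ.- j ℚ./ n ≡ (i ℤ.- j) ℚ./ n
  /-- i j n = trans (cong (i ℚ./ n ℚ.+_) (/-neg j n)) (/-+ i (ℤ.- j) n)

  /-mono-≤ : ∀ {i j} n .{{_ : NonZero n}} → i ℤ.≤ j → i ℚ./ n ℚ.≤ j ℚ./ n
  /-mono-≤ {i} {j} (suc k) i≤j = ℚ.toℚᵘ-cancel-≤
    (ℚᵘ.≤-respˡ-≃ (ℚᵘ.≃-sym (toℚᵘ-/ i k)) (ℚᵘ.≤-respʳ-≃ (ℚᵘ.≃-sym (toℚᵘ-/ j k))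
      (*≤* (ℤ.*-monoʳ-≤-nonNeg (ℤ.+ suc k) i≤j))))

  ⁄-extend : ∀ a b k n .{{_ : NonZero b}} .{{_ : NonZero n}} → b ℕ.* k ≡ n →
    a ⁄ b ≡ (ℤ.+ a ℤ.* ℤ.+ k) ℚ./ n
  ⁄-extend a (suc b) k (suc n) eq = ℚ.toℚᵘ-injective (ℚᵘ.≃-trans (toℚᵘ-/ (ℤ.+ a) b)
    (ℚᵘ.≃-trans (*≡* (trans (cong (λ i → ℤ.+ a ℤ.* ℤ.+ i) (sym eq)) (trans
      (cong (ℤ.+ a ℤ.*_) (ℤ.pos-* (suc b) k)) (lemma (ℤ.+ a) (ℤ.+ suc b) (ℤ.+ k)))))
      (ℚᵘ.≃-sym (toℚᵘ-/ (ℤ.+ a ℤ.* ℤ.+ k) n))))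
    where
    lemma : ∀ a b k → a ℤ.* (b ℤ.* k) ≡ a ℤ.* k ℤ.* b
    lemma = solve-∀

-- From the integer bounds to the stated rational inequalities

module ClearDenominators where

  open Fractions
  open import Data.Integer.Base as ℤ using (ℤ; 1ℤ)
  import Data.Integer.Properties as ℤ
  open import Data.Nat.Base as ℕ using (ℕ; suc; NonZero)
  import Data.Nat.Properties as ℕ
  open import Data.Rational.Base using (ℚ; _/_; _+_; _-_; _≤_)
  open import Relation.Binary.PropositionalEquality.Core using (refl; sym; trans; cong; cong₂; subst₂)

  module CommonDenominator (q S R : ℕ) (s r : ℤ) (S≡qR : S ≡ q ℕ.* R) (S≡s : ℤ.+ S ≡ s) (R≡r : ℤ.+ R ≡ r)
    .{{_ : NonZero q}} .{{_ : NonZero S}} .{{_ : NonZero (2 ℕ.* q)}} .{{_ : NonZero (2 ℕ.* S)}} (n : ℕ) where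

    private
      -- A common multiple of all denominators 1, 2, S, 2 q and 2 S; the case of 2 q uses S = q R. S
      -- and R stand for q^(d/2) and q^((d-2)/2).
      D = 2 ℕ.* S
      nℤ = ℤ.+ n

      -- A record, so that the numerator is recovered by unification.
      record _over-D_ (x : ℚ) (i : ℤ) : Set where
        constructor over
        field equation : x ≡ i / D
      open _over-D_

      infix 4 _over-D_

      extend : ∀ a b k {i j} .{{_ : NonZero b}} → b ℕ.* k ≡ D → ℤ.+ a ≡ i → ℤ.+ k ≡ j →
        a ⁄ b over-D i ℤ.* j
      extend a b k eq a≡i k≡j = over (trans (⁄-extend a b k D eq) (cong (_/ D) (cong₂ ℤ._*_ a≡i k≡j)))

      n² : ℤ.+ (n ℕ.^ 2) ≡ nℤ ℤ.* nℤ
      n² = trans (cong (λ k → ℤ.+ (n ℕ.* k)) (ℕ.*-identityʳ n)) (ℤ.pos-* n n)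

      2qR≡D : 2 ℕ.* q ℕ.* R ≡ D
      2qR≡D = trans (ℕ.*-assoc 2 q R) (cong (2 ℕ.*_) (sym S≡qR))

      integer : ∀ a → a ⁄ 1 over-D ℤ.+ a ℤ.* (ℤ.+ 2 ℤ.* s)
      integer a = extend a 1 D (ℕ.*-identityˡ D) refl (trans (ℤ.pos-* 2 S) (cong (ℤ.+ 2 ℤ.*_) S≡s))

      n²/2 : (n ℕ.^ 2) ⁄ 2 over-D nℤ ℤ.* nℤ ℤ.* s
      n²/2 = extend (n ℕ.^ 2) 2 S refl n² S≡s

      Sn/2 : (S ℕ.* n) ⁄ 2 over-D s ℤ.* nℤ ℤ.* s
      Sn/2 = extend (S ℕ.* n) 2 S refl (trans (ℤ.pos-* S n) (cong (ℤ._* nℤ) S≡s)) S≡s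

      Rn/2 : (R ℕ.* n) ⁄ 2 over-D r ℤ.* nℤ ℤ.* s
      Rn/2 = extend (R ℕ.* n) 2 S refl (trans (ℤ.pos-* R n) (cong (ℤ._* nℤ) R≡r)) S≡s

      n²/2q : (n ℕ.^ 2) ⁄ (2 ℕ.* q) over-D nℤ ℤ.* nℤ ℤ.* r
      n²/2q = extend (n ℕ.^ 2) (2 ℕ.* q) R 2qR≡D n² R≡r

      n²/S : (n ℕ.^ 2) ⁄ S over-D nℤ ℤ.* nℤ ℤ.* ℤ.+ 2
      n²/S = extend (n ℕ.^ 2) S 2 (ℕ.*-comm S 2) n² refl

      n²/2S : (n ℕ.^ 2) ⁄ (2 ℕ.* S) over-D nℤ ℤ.* nℤ ℤ.* 1ℤ
      n²/2S = extend (n ℕ.^ 2) D 1 (ℕ.*-identityʳ D) n² refl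

      n/2 : n ⁄ 2 over-D nℤ ℤ.* s
      n/2 = extend n 2 S refl refl S≡s

      infixl 6 _⟨+⟩_ _⟨-⟩_
      _⟨+⟩_ : ∀ {x y i j} → x over-D i → y over-D j → x + y over-D i ℤ.+ j
      _⟨+⟩_ {i = i} {j} (over eq) (over eq′) = over (trans (cong₂ _+_ eq eq′) (/-+ i j D))

      _⟨-⟩_ : ∀ {x y i j} → x over-D i → y over-D j → x - y over-D i ℤ.- j
      _⟨-⟩_ {i = i} {j} (over eq) (over eq′) = over (trans (cong₂ _-_ eq eq′) (/-- i j D))

      compare : ∀ {x y i j} → x over-D i → y over-D j → i ℤ.≤ j → x ≤ y
      compare (over eq) (over eq′) i≤j = subst₂ _≤_ (sym eq) (sym eq′) (/-mono-≤ D i≤j)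

    fractions-ε≡-1 : ∀ N →
      ℤ.+ N ℤ.* (ℤ.+ 2 ℤ.* s) ℤ.≤ nℤ ℤ.* nℤ ℤ.* s ℤ.+ s ℤ.* nℤ ℤ.* s ℤ.- nℤ ℤ.* nℤ ℤ.* r ℤ.- r ℤ.* nℤ ℤ.* s →
      N ⁄ 1 ≤ (n ℕ.^ 2) ⁄ 2 + (S ℕ.* n) ⁄ 2 - (n ℕ.^ 2) ⁄ (2 ℕ.* q) - (R ℕ.* n) ⁄ 2
    fractions-ε≡-1 N = compare (integer N) (n²/2 ⟨+⟩ Sn/2 ⟨-⟩ n²/2q ⟨-⟩ Rn/2)

    fractions-ε≡1 : ∀ N →
      ℤ.+ N ℤ.* (ℤ.+ 2 ℤ.* s) ℤ.≤
        nℤ ℤ.* nℤ ℤ.* s ℤ.+ s ℤ.* nℤ ℤ.* s ℤ.- nℤ ℤ.* nℤ ℤ.* ℤ.+ 2 ℤ.- nℤ ℤ.* nℤ ℤ.* r ℤ.+ r ℤ.* nℤ ℤ.* s →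
      N ⁄ 1 ≤ (n ℕ.^ 2) ⁄ 2 + (S ℕ.* n) ⁄ 2 - (n ℕ.^ 2) ⁄ S - (n ℕ.^ 2) ⁄ (2 ℕ.* q) + (R ℕ.* n) ⁄ 2
    fractions-ε≡1 N = compare (integer N) (n²/2 ⟨+⟩ Sn/2 ⟨-⟩ n²/S ⟨-⟩ n²/2q ⟨+⟩ Rn/2)

    fractions-diagonal : ∀ N →
      ℤ.+ N ℤ.* (ℤ.+ 2 ℤ.* s) ℤ.≤ nℤ ℤ.* nℤ ℤ.* s ℤ.+ s ℤ.* nℤ ℤ.* s ℤ.- nℤ ℤ.* nℤ ℤ.* 1ℤ ℤ.- nℤ ℤ.* s →
      N ⁄ 1 ≤ (n ℕ.^ 2) ⁄ 2 + (S ℕ.* n) ⁄ 2 - (n ℕ.^ 2) ⁄ (2 ℕ.* S) - n ⁄ 2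
    fractions-diagonal N = compare (integer N) (n²/2 ⟨+⟩ Sn/2 ⟨-⟩ n²/2S ⟨-⟩ n/2)

-- The sign ε from the residues of d and q, and the final assembly

open import Defs
open import Data.Nat using (ℕ; NonZero; _*_; _^_; _∸_; _/_; _%_) renaming (_+_ to _+ℕ_)
open import Data.Product using (_×_)
open import Data.Sum using (_⊎_)
open import Data.Rational using (1ℚ; _≤_; _+_; _-_; _÷_)
open import Relation.Binary.PropositionalEquality using (_≡_)

open import Data.Integer.Base as ℤ using (ℤ; 1ℤ; -1ℤ)
import Data.Integer.Properties as ℤ
open import Data.Nat using (zero; suc)
open import Data.Nat.DivMod using (m*n/n≡m; m≡m%n+[m/n]*n)
import Data.Nat.Properties as ℕ
open import Data.Product using (∃; _,_)
open import Data.Sum using (inj₁; inj₂)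
open import Relation.Binary.PropositionalEquality using (refl; sym; trans; cong; cong₂)
open import Data.Nat.Tactic.RingSolver using (solve-∀)

module _ {c ℓ₁ ℓ₂} {q : ℕ} .{{_ : NonZero q}} (F : FiniteField c ℓ₁ ℓ₂ q) (q-odd : q % 2 ≡ 1) where

  open CharacterSums F q-odd using (κ; κ²≡1)

  κ^-even : ∀ k → κ ℤ.^ (k * 2) ≡ 1ℤ
  κ^-even zero = refl
  κ^-even (suc k) = trans (sym (ℤ.*-assoc κ κ (κ ℤ.^ (k * 2)))) (cong₂ ℤ._*_ κ²≡1 (κ^-even k))

  κ^-odd : ∀ k → κ ℤ.^ suc (k * 2) ≡ κ
  κ^-odd k = trans (cong (κ ℤ.*_) (κ^-even k)) (ℤ.*-identityʳ κ)

  pos-^ : ∀ k → ℤ.+ (q ^ k) ≡ (ℤ.+ q) ℤ.^ k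
  pos-^ zero = refl
  pos-^ (suc k) = trans (ℤ.pos-* q (q ^ k)) (cong (ℤ.+ q ℤ.*_) (pos-^ k))

  module _ (m : ℕ) where

    open EvenDimension F q-odd m using (r; s; bound-ε≡-1; bound-ε≡1; bound-diagonal)

    private
      S≡ : q ^ (suc m * 2 / 2) ≡ q ^ suc m
      S≡ = cong (q ^_) (m*n/n≡m (suc m) 2)

      R≡ : q ^ ((suc m * 2 ∸ 2) / 2) ≡ q ^ m
      R≡ = cong (q ^_) (m*n/n≡m m 2)

      open Denominators q (suc m * 2)
      open ClearDenominators.CommonDenominator q (q ^ (suc m * 2 / 2)) (q ^ ((suc m * 2 ∸ 2) / 2)) s r
        (trans S≡ (cong (q *_) (sym R≡)))
        (trans (cong (λ k → ℤ.+ k) S≡) (pos-^ (suc m))) (trans (cong (λ k → ℤ.+ k) R≡) (pos-^ m))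

    -- The dimension stays a variable tied by an equation, so that a single match on `refl` adjusts
    -- the exponents, the nonzero instances and the type of A together.
    SQ-ε≡-1 : ∀ {d} (A : Subset F d) → d ≡ suc m * 2 → κ ℤ.^ suc m ≡ -1ℤ → let open Denominators q d in
      SQ A ⁄ 1 ≤ (∣ A ∣ ^ 2) ⁄ 2 + (q ^ (d / 2) * ∣ A ∣) ⁄ 2
                 - (∣ A ∣ ^ 2) ⁄ (2 * q) - (q ^ ((d ∸ 2) / 2) * ∣ A ∣) ⁄ 2
    SQ-ε≡-1 A refl eq = fractions-ε≡-1 ∣ A ∣ (SQ A) (bound-ε≡-1 A eq)

    SQ-ε≡1 : ∀ {d} (A : Subset F d) → d ≡ suc m * 2 → κ ℤ.^ suc m ≡ 1ℤ → let open Denominators q d in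
      SQ A ⁄ 1 ≤ (∣ A ∣ ^ 2) ⁄ 2 + (q ^ (d / 2) * ∣ A ∣) ⁄ 2
                 - (∣ A ∣ ^ 2) ⁄ (q ^ (d / 2)) - (∣ A ∣ ^ 2) ⁄ (2 * q)
                 + (q ^ ((d ∸ 2) / 2) * ∣ A ∣) ⁄ 2
    SQ-ε≡1 A refl eq = fractions-ε≡1 ∣ A ∣ (SQ A) (bound-ε≡1 A eq)

    SQ-diagonal : ∀ {d} (A : Subset F d) → d ≡ suc m * 2 → let open Denominators q d in
      SQ A ⁄ 1 ≤ (∣ A ∣ ^ 2) ⁄ 2 + (q ^ (d / 2) * ∣ A ∣) ⁄ 2
                 - (∣ A ∣ ^ 2) ⁄ (2 * q ^ (d / 2)) - ∣ A ∣ ⁄ 2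
    SQ-diagonal A refl = fractions-diagonal ∣ A ∣ (SQ A) (bound-diagonal A)

2mod4 : ∀ d → d % 4 ≡ 2 → d ≡ suc (d / 4 * 2) * 2
2mod4 d eq = trans (m≡m%n+[m/n]*n d 4) (trans (cong (_+ℕ d / 4 * 4) eq) (lemma (d / 4)))
  where
  lemma : ∀ k → 2 +ℕ k * 4 ≡ suc (k * 2) * 2
  lemma = solve-∀

-- Positivity of d excludes the quotient 0, which makes room for writing half the dimension as a
-- successor, here the even number 2(k + 1).
0mod4 : ∀ d .{{_ : NonZero d}} → d % 4 ≡ 0 → ∃ λ k → d ≡ suc (suc (k * 2)) * 2
0mod4 d eq = go d (d / 4) (trans (m≡m%n+[m/n]*n d 4) (cong (_+ℕ d / 4 * 4) eq))
  where
  lemma : ∀ k → suc k * 4 ≡ suc (suc (k * 2)) * 2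
  lemma = solve-∀
  go : ∀ d k .{{_ : NonZero d}} → d ≡ k * 4 → ∃ λ k → d ≡ suc (suc (k * 2)) * 2
  go (suc d) zero ()
  go d (suc k) eq = k , trans eq (lemma k)

theorem1p5 : ∀ {c ℓ₁ ℓ₂} (q : ℕ) .{{_ : NonZero q}} → OddPrimePower q →
    (F : FiniteField c ℓ₁ ℓ₂ q) (d : ℕ) .{{_ : NonZero d}} (A : Subset F d) →
    let open Denominators q d
        threshold = ((q ^ (d / 2) +ℕ q) ⁄ 1) ÷ (1ℚ + 1 ⁄ (q ^ ((d ∸ 2) / 2)))
    in
    (d % 4 ≡ 2 → q % 4 ≡ 3 →
      SQ A ⁄ 1 ≤ (∣ A ∣ ^ 2) ⁄ 2 + (q ^ (d / 2) * ∣ A ∣) ⁄ 2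
                 - (∣ A ∣ ^ 2) ⁄ (2 * q) - (q ^ ((d ∸ 2) / 2) * ∣ A ∣) ⁄ 2)
    ×
    (d % 4 ≡ 0 ⊎ (d % 4 ≡ 2 × q % 4 ≡ 1) →
      (threshold ≤ ∣ A ∣ ⁄ 1 →
        SQ A ⁄ 1 ≤ (∣ A ∣ ^ 2) ⁄ 2 + (q ^ (d / 2) * ∣ A ∣) ⁄ 2
                   - (∣ A ∣ ^ 2) ⁄ (q ^ (d / 2)) - (∣ A ∣ ^ 2) ⁄ (2 * q)
                   + (q ^ ((d ∸ 2) / 2) * ∣ A ∣) ⁄ 2)
      ×
      (∣ A ∣ ⁄ 1 ≤ threshold →
        SQ A ⁄ 1 ≤ (∣ A ∣ ^ 2) ⁄ 2 + (q ^ (d / 2) * ∣ A ∣) ⁄ 2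
                   - (∣ A ∣ ^ 2) ⁄ (2 * q ^ (d / 2)) - ∣ A ∣ ⁄ 2))
theorem1p5 q (q-odd , _) F d A =
  -- Half the dimension is odd, so ε = κ, and κ = -1 because q is 3 modulo 4.
  (λ d≡2 q≡3 → SQ-ε≡-1 F q-odd (d / 4 * 2) A (2mod4 d d≡2)
    (trans (κ^-odd F q-odd (d / 4)) (κ≡-1 q≡3))) ,
  λ where
    -- Half the dimension is even, so ε is a power of κ² = 1.
    (inj₁ d≡0) → let (k , d≡) = 0mod4 d d≡0 in
      (λ _ → SQ-ε≡1 F q-odd (suc (k * 2)) A d≡ (κ^-even F q-odd (suc k))) ,
      (λ _ → SQ-diagonal F q-odd (suc (k * 2)) A d≡)
    -- Half the dimension is odd and ε = κ again, now equal to 1 because q is 1 modulo 4.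
    (inj₂ (d≡2 , q≡1)) →
      (λ _ → SQ-ε≡1 F q-odd (d / 4 * 2) A (2mod4 d d≡2)
        (trans (κ^-odd F q-odd (d / 4)) (κ≡1 q≡1))) ,
      (λ _ → SQ-diagonal F q-odd (d / 4 * 2) A (2mod4 d d≡2))
  where open CharacterSums F q-odd using (κ≡1; κ≡-1)
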